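{- For every integer $k\ge 0$ let $$S_k=\sum_{n=1}^\infty\frac{p_n^k}{n!},$$ where $p_n$ denotes the $n$-th prime number. Then the real numbers $1,S_0,S_1,S_2,\ldots$ are linearly independent over $\mathbb{Q}$.
   Context: Primes are indexed by $p_1=2,\ p_2=3,\ p_3=5,\ldots$. -}

module Defs where

open import Algebra.Bundles using (Ring)
open import Algebra.Module.Bundles using (LeftModule)
import Algebra.Properties.Monoid.Sum as MonoidSum
open import Data.Fin.Base as Fin using (Fin; toℕ; fromℕ<; combine; funToFin; finToFun)
import Data.Fin.Properties as Fin
open import Data.Integer.Base as ℤ using (+_; +[1+_]; -[1+_])
import Data.Integer.Properties as ℤ
import Data.Integer.Solver as ℤSolver
open import Data.List.Base using ([]; _∷_)
open import Data.List.Relation.Unary.All as All using (All; []; _∷_)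
open import Data.Nat.Base as ℕ using (ℕ; zero; suc; z≤n; s≤s; z<s; _^_; _!)
open import Data.Nat.Coprimality using (Coprime)
open import Data.Nat.Divisibility using
  (_∣_; ∣-trans; ∣1⇒≡1; ∣⇒≤; m∣m*n; n∣m*n; ∣m+n∣m⇒∣n; m≤n⇒m!∣n!)
open import Data.Nat.Primality using (Prime; prime?; productOfPrimes≢0; ¬prime[0]; ¬prime[1])
open import Data.Nat.Primality.Factorisation using (factorise)
open import Data.Nat.ListAction using (product)
import Data.Nat.Properties as ℕ
import Data.Nat.Solver as ℕSolver
open import Data.Product.Base using (∃; ∃₂; _×_; _,_; proj₁; proj₂)
open import Data.Rational.Base
open import Data.Rational.Properties
import Data.Rational.Solver as ℚSolver
import Data.Rational.Unnormalised.Base as ℚᵘ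
import Data.Rational.Unnormalised.Properties as ℚᵘ
open import Data.Sum.Base using (inj₁; inj₂)
open import Data.Vec.Functional as Vector using (Vector)
open import Function.Base using (_∘_)
open import Function.Definitions using (Injective)
open import Level using (0ℓ)
open import Relation.Binary.Definitions using (tri<; tri≈; tri>)
open import Relation.Binary.PropositionalEquality
open import Relation.Nullary using (¬_; yes; no; contradiction)
open import Relation.Nullary.Decidable using (_×-dec_)
open import Relation.Unary using (Pred; Decidable)

-- A finite subfamily of v lies in some initial segment v 0, …, v (n - 1);
-- coefficients of the missing terms may be taken to be 0.

LinearlyIndependent : ∀ {r ℓr m ℓm} {R : Ring r ℓr} (M : LeftModule R m ℓm) →
                      (ℕ → LeftModule.Carrierᴹ M) → Set (r Level.⊔ ℓr Level.⊔ ℓm)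
LinearlyIndependent {R = R} M v =
  ∀ n (c : Vector Carrier n) →
  sum (λ i → c i *ₗ v (toℕ i)) ≈ᴹ 0ᴹ → ∀ i → c i ≈ 0#
  where
  open Ring R using (Carrier; _≈_; 0#)
  open LeftModule M
  open MonoidSum +ᴹ-monoid using (sum)

-- ℝ is the Cauchy completion of ℚ: Cauchy sequences of rationals, two of them
-- being equal (_≈ᴿ_) when their difference is a null sequence.  Only its
-- ℚ-vector space structure is developed.

Null : (ℕ → ℚ) → Set
Null x = ∀ {ε} → 0ℚ < ε → ∃ λ N → ∀ {n} → N ℕ.≤ n → ∣ x n ∣ < ε

Cauchy : (ℕ → ℚ) → Set
Cauchy x = ∀ {ε} → 0ℚ < ε →
           ∃ λ N → ∀ {m n} → N ℕ.≤ m → N ℕ.≤ n → ∣ x m - x n ∣ < ε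

record ℝ : Set where
  constructor mkℝ
  field
    seq      : ℕ → ℚ
    isCauchy : Cauchy seq

open ℝ public

infix 4 _≈ᴿ_

_≈ᴿ_ : ℝ → ℝ → Set
x ≈ᴿ y = Null (λ n → seq x n - seq y n)

private
  module ℚ-Solver = ℚSolver.+-*-Solver

  halve-pos : ∀ {ε} → 0ℚ < ε → 0ℚ < ½ * ε
  halve-pos {ε} ε>0 = positive⁻¹ (½ * ε) {{pos*pos⇒pos ½ ε {{positive ε>0}}}}

  halves : ∀ ε → ½ * ε + ½ * ε ≡ ε
  halves ε = trans (sym (*-distribʳ-+ ε ½ ½)) (*-identityˡ ε)

  ∣+∣<ε : ∀ {a b ε} → ∣ a ∣ < ½ * ε → ∣ b ∣ < ½ * ε → ∣ a + b ∣ < ε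
  ∣+∣<ε {a} {b} {ε} a< b< = ≤-<-trans (∣p+q∣≤∣p∣+∣q∣ a b)
    (subst (∣ a ∣ + ∣ b ∣ <_) (halves ε) (+-mono-< a< b<))

  +-diff : ∀ a b c d → (a - c) + (b - d) ≡ (a + b) - (c + d)
  +-diff = solve 4 (λ a b c d → (a :- c) :+ (b :- d) := (a :+ b) :- (c :+ d)) refl
    where open ℚ-Solver

  trans-diff : ∀ a b c → (a - b) + (b - c) ≡ a - c
  trans-diff = solve 3 (λ a b c → (a :- b) :+ (b :- c) := a :- c) refl
    where open ℚ-Solver

  neg-diff : ∀ a b → - (a - b) ≡ b - a
  neg-diff = solve 2 (λ a b → :- (a :- b) := b :- a) refl
    where open ℚ-Solver

  neg-diff′ : ∀ a b → - (a - b) ≡ (- a) - (- b)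
  neg-diff′ = solve 2 (λ a b → :- (a :- b) := (:- a) :- (:- b)) refl
    where open ℚ-Solver

  *-diff : ∀ c a b → c * (a - b) ≡ c * a - c * b
  *-diff = solve 3 (λ c a b → c :* (a :- b) := c :* a :- c :* b) refl
    where open ℚ-Solver

  -- δ = ε / (|c| + 1)
  scale : ∀ c {ε} → 0ℚ < ε →
          ∃ λ δ → 0ℚ < δ × (∀ a → ∣ a ∣ < δ → ∣ c * a ∣ < ε)
  scale c {ε} ε>0 = δ , δ>0 , bound
    where
    d = ∣ c ∣ + 1ℚ
    instance
      ∣c∣-nonNeg : NonNegative ∣ c ∣
      ∣c∣-nonNeg = ∣-∣-nonNeg c
      d-pos : Positive d
      d-pos = nonNeg+pos⇒pos ∣ c ∣ 1ℚ
      d-nonZero : NonZero d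
      d-nonZero = pos⇒nonZero d
      ε-pos : Positive ε
      ε-pos = positive ε>0
      1/d-pos : Positive (1/ d)
      1/d-pos = 1/pos⇒pos d
    δ = 1/ d * ε
    δ-pos : Positive δ
    δ-pos = pos*pos⇒pos (1/ d) ε
    δ>0 = positive⁻¹ δ {{δ-pos}}
    dδ≡ε : d * δ ≡ ε
    dδ≡ε = trans (sym (*-assoc d (1/ d) ε))
             (trans (cong (_* ε) (*-inverseʳ d)) (*-identityˡ ε))
    ∣c∣≤d : ∣ c ∣ ≤ d
    ∣c∣≤d = subst (_≤ d) (+-identityʳ ∣ c ∣)
              (+-monoʳ-≤ ∣ c ∣ (nonNegative⁻¹ 1ℚ))
    bound : ∀ a → ∣ a ∣ < δ → ∣ c * a ∣ < ε
    bound a a<δ = begin-strict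
      ∣ c * a ∣      ≡⟨ ∣p*q∣≡∣p∣*∣q∣ c a ⟩
      ∣ c ∣ * ∣ a ∣  ≤⟨ *-monoʳ-≤-nonNeg ∣ a ∣ {{∣-∣-nonNeg a}} ∣c∣≤d ⟩
      d * ∣ a ∣      <⟨ *-monoʳ-<-pos d a<δ ⟩
      d * δ          ≡⟨ dδ≡ε ⟩
      ε              ∎
      where open ≤-Reasoning

  ∣0∣<ε : ∀ {ε a} → 0ℚ < ε → a ≡ 0ℚ → ∣ a ∣ < ε
  ∣0∣<ε ε>0 refl = ε>0

  x-x≡0 : ∀ x → x - x ≡ 0ℚ
  x-x≡0 = +-inverseʳ

fromℚ : ℚ → ℝ
fromℚ q = mkℝ (λ _ → q) λ ε>0 → 0 , λ _ _ → ∣0∣<ε ε>0 (x-x≡0 q)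

0ᴿ 1ᴿ : ℝ
0ᴿ = fromℚ 0ℚ
1ᴿ = fromℚ 1ℚ

infixl 6 _+ᴿ_
infixr 7 _·ᴿ_
infix  8 -ᴿ_

_+ᴿ_ : ℝ → ℝ → ℝ
x +ᴿ y = mkℝ (λ n → seq x n + seq y n) cauchy
  where
  cauchy : Cauchy (λ n → seq x n + seq y n)
  cauchy ε>0 with isCauchy x (halve-pos ε>0) | isCauchy y (halve-pos ε>0)
  ... | N₁ , h₁ | N₂ , h₂ = N₁ ℕ.⊔ N₂ , λ {m} {n} m≥ n≥ →
    subst (λ z → ∣ z ∣ < _) (+-diff (seq x m) (seq y m) (seq x n) (seq y n))
      (∣+∣<ε {seq x m - seq x n}
        (h₁ (ℕ.m⊔n≤o⇒m≤o N₁ N₂ m≥) (ℕ.m⊔n≤o⇒m≤o N₁ N₂ n≥))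
        (h₂ (ℕ.m⊔n≤o⇒n≤o N₁ N₂ m≥) (ℕ.m⊔n≤o⇒n≤o N₁ N₂ n≥)))

-ᴿ_ : ℝ → ℝ
-ᴿ x = mkℝ (λ n → - seq x n) cauchy
  where
  cauchy : Cauchy (λ n → - seq x n)
  cauchy ε>0 with isCauchy x ε>0
  ... | N , h = N , λ {m} {n} m≥ n≥ →
    subst (_< _)
      (trans (sym (∣-p∣≡∣p∣ (seq x m - seq x n)))
             (cong ∣_∣ (neg-diff′ (seq x m) (seq x n))))
      (h m≥ n≥)

_·ᴿ_ : ℚ → ℝ → ℝ
c ·ᴿ x = mkℝ (λ n → c * seq x n) cauchy
  where
  cauchy : Cauchy (λ n → c * seq x n)
  cauchy ε>0 with scale c ε>0
  ... | δ , δ>0 , bound with isCauchy x δ>0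
  ...   | N , h = N , λ {m} {n} m≥ n≥ →
    subst (λ z → ∣ z ∣ < _) (*-diff c (seq x m) (seq x n)) (bound _ (h m≥ n≥))

private
  ≗⇒≈ᴿ : ∀ {x y} → seq x ≗ seq y → x ≈ᴿ y
  ≗⇒≈ᴿ {x} {y} x≗y ε>0 = 0 , λ {n} _ →
    ∣0∣<ε ε>0 (trans (cong (_- seq y n) (x≗y n)) (x-x≡0 (seq y n)))

  ≈ᴿ-sym : ∀ {x y} → x ≈ᴿ y → y ≈ᴿ x
  ≈ᴿ-sym {x} {y} x≈y ε>0 with x≈y ε>0
  ... | N , h = N , λ {n} n≥ →
    subst (_< _)
      (trans (sym (∣-p∣≡∣p∣ (seq x n - seq y n)))
             (cong ∣_∣ (neg-diff (seq x n) (seq y n))))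
      (h n≥)

  ≈ᴿ-trans : ∀ {x y z} → x ≈ᴿ y → y ≈ᴿ z → x ≈ᴿ z
  ≈ᴿ-trans {x} {y} {z} x≈y y≈z ε>0 with x≈y (halve-pos ε>0) | y≈z (halve-pos ε>0)
  ... | N₁ , h₁ | N₂ , h₂ = N₁ ℕ.⊔ N₂ , λ {n} n≥ →
    subst (λ w → ∣ w ∣ < _) (trans-diff (seq x n) (seq y n) (seq z n))
      (∣+∣<ε {seq x n - seq y n}
        (h₁ (ℕ.m⊔n≤o⇒m≤o N₁ N₂ n≥)) (h₂ (ℕ.m⊔n≤o⇒n≤o N₁ N₂ n≥)))

  +ᴿ-cong : ∀ {x y u v} → x ≈ᴿ y → u ≈ᴿ v → x +ᴿ u ≈ᴿ y +ᴿ v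
  +ᴿ-cong {x} {y} {u} {v} x≈y u≈v ε>0 with x≈y (halve-pos ε>0) | u≈v (halve-pos ε>0)
  ... | N₁ , h₁ | N₂ , h₂ = N₁ ℕ.⊔ N₂ , λ {n} n≥ →
    subst (λ w → ∣ w ∣ < _) (+-diff (seq x n) (seq u n) (seq y n) (seq v n))
      (∣+∣<ε {seq x n - seq y n}
        (h₁ (ℕ.m⊔n≤o⇒m≤o N₁ N₂ n≥)) (h₂ (ℕ.m⊔n≤o⇒n≤o N₁ N₂ n≥)))

  -ᴿ-cong : ∀ {x y} → x ≈ᴿ y → -ᴿ x ≈ᴿ -ᴿ y
  -ᴿ-cong {x} {y} x≈y ε>0 with x≈y ε>0
  ... | N , h = N , λ {n} n≥ →
    subst (_< _)
      (trans (sym (∣-p∣≡∣p∣ (seq x n - seq y n)))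
             (cong ∣_∣ (neg-diff′ (seq x n) (seq y n))))
      (h n≥)

  ·ᴿ-cong : ∀ {c d x y} → c ≡ d → x ≈ᴿ y → c ·ᴿ x ≈ᴿ d ·ᴿ y
  ·ᴿ-cong {c} {_} {x} {y} refl x≈y ε>0 with scale c ε>0
  ... | δ , δ>0 , bound with x≈y δ>0
  ...   | N , h = N , λ {n} n≥ →
    subst (λ z → ∣ z ∣ < _) (*-diff c (seq x n) (seq y n)) (bound _ (h n≥))

ℝ-leftModule : LeftModule +-*-ring 0ℓ 0ℓ
ℝ-leftModule = record
  { Carrierᴹ = ℝ
  ; _≈ᴹ_ = _≈ᴿ_
  ; _+ᴹ_ = _+ᴿ_
  ; _*ₗ_ = _·ᴿ_
  ; 0ᴹ   = 0ᴿ
  ; -ᴹ_  = -ᴿ_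
  ; isLeftModule = record
    { isLeftSemimodule = record
      { +ᴹ-isCommutativeMonoid = record
        { isMonoid = record
          { isSemigroup = record
            { isMagma = record
              { isEquivalence = record
                { refl  = λ {x} → ≗⇒≈ᴿ {x} {x} λ _ → refl
                ; sym   = λ {x} {y} → ≈ᴿ-sym {x} {y}
                ; trans = λ {x} {y} {z} → ≈ᴿ-trans {x} {y} {z}
                }
              ; ∙-cong = λ {x} {y} {u} {v} → +ᴿ-cong {x} {y} {u} {v}
              }
            ; assoc = λ x y z → ≗⇒≈ᴿ {(x +ᴿ y) +ᴿ z} {x +ᴿ (y +ᴿ z)}
                λ n → +-assoc (seq x n) (seq y n) (seq z n)
            }
          ; identity = (λ x → ≗⇒≈ᴿ {0ᴿ +ᴿ x} {x} λ n → +-identityˡ (seq x n))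
                     , (λ x → ≗⇒≈ᴿ {x +ᴿ 0ᴿ} {x} λ n → +-identityʳ (seq x n))
          }
        ; comm = λ x y → ≗⇒≈ᴿ {x +ᴿ y} {y +ᴿ x} λ n → +-comm (seq x n) (seq y n)
        }
      ; isPreleftSemimodule = record
        { *ₗ-cong = λ {c} {d} {x} {y} → ·ᴿ-cong {c} {d} {x} {y}
        ; *ₗ-zeroˡ = λ x → ≗⇒≈ᴿ {0ℚ ·ᴿ x} {0ᴿ} λ n → *-zeroˡ (seq x n)
        ; *ₗ-distribʳ = λ x c d → ≗⇒≈ᴿ {(c + d) ·ᴿ x} {c ·ᴿ x +ᴿ d ·ᴿ x}
            λ n → *-distribʳ-+ (seq x n) c d
        ; *ₗ-identityˡ = λ x → ≗⇒≈ᴿ {1ℚ ·ᴿ x} {x} λ n → *-identityˡ (seq x n)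
        ; *ₗ-assoc = λ c d x → ≗⇒≈ᴿ {(c * d) ·ᴿ x} {c ·ᴿ (d ·ᴿ x)}
            λ n → *-assoc c d (seq x n)
        ; *ₗ-zeroʳ = λ c → ≗⇒≈ᴿ {c ·ᴿ 0ᴿ} {0ᴿ} λ n → *-zeroʳ c
        ; *ₗ-distribˡ = λ c x y → ≗⇒≈ᴿ {c ·ᴿ (x +ᴿ y)} {c ·ᴿ x +ᴿ c ·ᴿ y}
            λ n → *-distribˡ-+ c (seq x n) (seq y n)
        }
      }
    ; -ᴹ‿cong = λ {x} {y} → -ᴿ-cong {x} {y}
    ; -ᴹ‿inverse = (λ x → ≗⇒≈ᴿ {(-ᴿ x) +ᴿ x} {0ᴿ} λ n → +-inverseˡ (seq x n))
                 , (λ x → ≗⇒≈ᴿ {x +ᴿ (-ᴿ x)} {0ᴿ} λ n → +-inverseʳ (seq x n))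
    }
  }

private
  least : ∀ {P : Pred ℕ 0ℓ} → Decidable P → ∀ {b} → P b →
          ∃ λ m → P m × (∀ {r} → P r → m ℕ.≤ r)
  least P? {zero}  Pb = zero , Pb , λ _ → z≤n
  least {P} P? {suc b} Pb with P? zero
  ... | yes P0 = zero , P0 , λ _ → z≤n
  ... | no ¬P0 with least (P? ∘ suc) {b} Pb
  ...   | m , Pm , m-least = suc m , Pm , λ
    { {zero}  P0 → contradiction P0 ¬P0
    ; {suc r} Pr → s≤s (m-least Pr)
    }

  ∃prime> : ∀ n → ∃ λ q → Prime q × n ℕ.< q
  ∃prime> n with factorise (suc (n !))
  ... | record { factors = [] ; isFactorisation = eq } =
    contradiction (ℕ.suc-injective eq) (ℕ.m<n⇒n≢0 (ℕ.1≤n! n))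
  ... | record { factors = q ∷ qs ; isFactorisation = eq ; factorsPrime = pq ∷ _ }
      with n ℕ.<? q
  ...   | yes n<q = q , pq , n<q
  ...   | no n≮q = contradiction pq (subst (¬_ ∘ Prime) (sym q≡1) ¬prime[1])
    where
    n∣n! : ∀ m → Prime m → m ∣ m !
    n∣n! zero    pm = contradiction pm ¬prime[0]
    n∣n! (suc m) _  = m∣m*n (m !)
    q∣n! : q ∣ n !
    q∣n! = ∣-trans (n∣n! q pq) (m≤n⇒m!∣n! (ℕ.≮⇒≥ n≮q))
    q∣n!+1 : q ∣ n ! ℕ.+ 1
    q∣n!+1 = subst (q ∣_) (trans (sym eq) (ℕ.+-comm 1 (n !))) (m∣m*n (product qs))
    q≡1 : q ≡ 1
    q≡1 = ∣1⇒≡1 (∣m+n∣m⇒∣n q∣n!+1 q∣n!)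

  leastPrime> : ∀ n → ∃ λ q → (Prime q × n ℕ.< q) ×
                              (∀ {r} → Prime r × n ℕ.< r → q ℕ.≤ r)
  leastPrime> n = least (λ q → prime? q ×-dec (n ℕ.<? q)) (proj₂ (∃prime> n))

nextPrime : ℕ → ℕ
nextPrime n = proj₁ (leastPrime> n)

nextPrime-prime : ∀ n → Prime (nextPrime n)
nextPrime-prime n = proj₁ (proj₁ (proj₂ (leastPrime> n)))

nextPrime-> : ∀ n → n ℕ.< nextPrime n
nextPrime-> n = proj₂ (proj₁ (proj₂ (leastPrime> n)))

nextPrime-least : ∀ n {r} → Prime r → n ℕ.< r → nextPrime n ℕ.≤ r
nextPrime-least n pr n<r = proj₂ (proj₂ (leastPrime> n)) (pr , n<r)

-- p 1 = 2, p 2 = 3, p 3 = 5, …; the value p 0 = 0 is only a seed for the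
-- recursion and is not a prime.

p : ℕ → ℕ
p zero    = 0
p (suc n) = nextPrime (p n)

_ : p 1 ≡ 2 × p 2 ≡ 3 × p 3 ≡ 5 × p 4 ≡ 7
_ = refl , refl , refl , refl

p-prime : ∀ n → Prime (p (suc n))
p-prime n = nextPrime-prime (p n)

p-complete : ∀ n {q} → Prime q → q ℕ.< p (suc n) → ∃ λ (i : Fin n) → q ≡ p (suc (toℕ i))
p-complete zero {q} pq q< = contradiction (nextPrime-least 0 pq q>0) (ℕ.<⇒≱ q<)
  where
  q>0 : 0 ℕ.< q
  q>0 = ℕ.n≢0⇒n>0 λ { refl → ¬prime[0] pq }
p-complete (suc n) {q} pq q< with ℕ.<-cmp q (p (suc n))
... | tri> _ _ q> = contradiction (nextPrime-least (p (suc n)) pq q>) (ℕ.<⇒≱ q<)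
... | tri≈ _ q≡ _ = Fin.fromℕ n , trans q≡ (cong (p ∘ suc) (sym (Fin.toℕ-fromℕ n)))
... | tri< q<′ _ _ with p-complete n pq q<′
...   | i , q≡ = Fin.inject₁ i , trans q≡ (cong (p ∘ suc) (sym (Fin.toℕ-inject₁ i)))

-- Proof of p n ≤ 4 ^ n, which gives convergence of the series: if
-- p (n + 1) > N = 4 ^ (n + 1), then each m ∈ {1, …, N} is a b² with a
-- a product of distinct primes among p 1, …, p n and 1 ≤ b ≤ 2 ^ (n + 1),
-- so N ≤ 2 ^ n · 2 ^ (n + 1) < N.

private
  subproduct : ∀ {n} → Vector ℕ n → Vector (Fin 2) n → ℕ
  subproduct {zero}  v e = 1
  subproduct {suc n} v e =
    Vector.head v ^ toℕ (Vector.head e) ℕ.* subproduct (Vector.tail v) (Vector.tail e)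

  subproduct-cong : ∀ {n} (v : Vector ℕ n) {e f} → e ≗ f → subproduct v e ≡ subproduct v f
  subproduct-cong {zero}  v e≗f = refl
  subproduct-cong {suc n} v e≗f =
    cong₂ ℕ._*_ (cong (λ i → Vector.head v ^ toℕ i) (e≗f Fin.zero))
                (subproduct-cong (Vector.tail v) (e≗f ∘ Fin.suc))

  subproduct-1 : ∀ {n} (v : Vector ℕ n) → subproduct v (λ _ → Fin.zero) ≡ 1
  subproduct-1 {zero}  v = refl
  subproduct-1 {suc n} v = trans (ℕ.+-identityʳ _) (subproduct-1 (Vector.tail v))

  toggle : ∀ {n} (v : Vector ℕ n) (e : Vector (Fin 2) n) i →
           ∃₂ λ e′ c → v i ℕ.* subproduct v e ≡ subproduct v e′ ℕ.* (c ℕ.* c)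
  toggle v e Fin.zero with e Fin.zero
  ... | Fin.zero = (Fin.suc Fin.zero Vector.∷ Vector.tail e) , 1 ,
    solve 2 (λ x a → x :* (con 1 :* a) := x :* con 1 :* a :* con 1) refl
      (v Fin.zero) (subproduct (Vector.tail v) (Vector.tail e))
    where open ℕSolver.+-*-Solver
  ... | Fin.suc Fin.zero = (Fin.zero Vector.∷ Vector.tail e) , v Fin.zero ,
    solve 2 (λ x a → x :* (x :* con 1 :* a) := con 1 :* a :* (x :* x)) refl
      (v Fin.zero) (subproduct (Vector.tail v) (Vector.tail e))
    where open ℕSolver.+-*-Solver
  toggle v e (Fin.suc i) with toggle (Vector.tail v) (Vector.tail e) i
  ... | e′ , c , eq = (e Fin.zero Vector.∷ e′) , c , (begin
    y ℕ.* (x ℕ.* a)          ≡⟨ ℕ.*-assoc y x a ⟨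
    y ℕ.* x ℕ.* a            ≡⟨ cong (ℕ._* a) (ℕ.*-comm y x) ⟩
    x ℕ.* y ℕ.* a            ≡⟨ ℕ.*-assoc x y a ⟩
    x ℕ.* (y ℕ.* a)          ≡⟨ cong (x ℕ.*_) eq ⟩
    x ℕ.* (a′ ℕ.* (c ℕ.* c)) ≡⟨ ℕ.*-assoc x a′ (c ℕ.* c) ⟨
    x ℕ.* a′ ℕ.* (c ℕ.* c)   ∎)
    where
    open ≡-Reasoning
    x = v Fin.zero ^ toℕ (e Fin.zero)
    y = v (Fin.suc i)
    a = subproduct (Vector.tail v) (Vector.tail e)
    a′ = subproduct (Vector.tail v) e′

  module _ {n} (v : Vector ℕ n) where

    SquareTimes : ℕ → Set
    SquareTimes m = ∃₂ λ e b → m ≡ subproduct v e ℕ.* (b ℕ.* b)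

    squareTimes : ∀ {qs} → All (λ q → ∃ λ i → q ≡ v i) qs → SquareTimes (product qs)
    squareTimes [] = (λ _ → Fin.zero) , 1 ,
      sym (trans (ℕ.*-identityʳ _) (subproduct-1 v))
    squareTimes {q ∷ qs} ((i , refl) ∷ all) with squareTimes all
    ... | e , b , eq with toggle v e i
    ...   | e′ , c , eq′ = e′ , c ℕ.* b , (begin
      v i ℕ.* product qs                       ≡⟨ cong (v i ℕ.*_) eq ⟩
      v i ℕ.* (a ℕ.* (b ℕ.* b))                ≡⟨ ℕ.*-assoc (v i) a _ ⟨
      v i ℕ.* a ℕ.* (b ℕ.* b)                  ≡⟨ cong (ℕ._* (b ℕ.* b)) eq′ ⟩
      a′ ℕ.* (c ℕ.* c) ℕ.* (b ℕ.* b)           ≡⟨ regroup a′ c b ⟩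
      a′ ℕ.* ((c ℕ.* b) ℕ.* (c ℕ.* b))         ∎)
      where
      open ≡-Reasoning
      a = subproduct v e
      a′ = subproduct v e′
      regroup : ∀ a c b → a ℕ.* (c ℕ.* c) ℕ.* (b ℕ.* b) ≡ a ℕ.* ((c ℕ.* b) ℕ.* (c ℕ.* b))
      regroup = solve 3 (λ a c b → a :* (c :* c) :* (b :* b) :=
                                   a :* ((c :* b) :* (c :* b))) refl
        where open ℕSolver.+-*-Solver

    square-≤ : ∀ {b B} → b ℕ.* b ℕ.≤ B ℕ.* B → b ℕ.≤ B
    square-≤ {b} {B} b²≤B² with b ℕ.≤? B
    ... | yes b≤B = b≤B
    ... | no b≰B  = contradiction b²≤B² (ℕ.<⇒≱ (ℕ.*-mono-< (ℕ.≰⇒> b≰B) (ℕ.≰⇒> b≰B)))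

    count : ∀ B → (∀ m → suc m ℕ.≤ B ℕ.* B → SquareTimes (suc m)) → B ℕ.* B ℕ.≤ 2 ^ n ℕ.* B
    count B decompose = Fin.injective⇒≤ {f = code} code-injective
      where
      exps : Fin (B ℕ.* B) → Vector (Fin 2) n
      exps i = proj₁ (decompose (toℕ i) (Fin.toℕ<n i))

      root : Fin (B ℕ.* B) → ℕ
      root i = proj₁ (proj₂ (decompose (toℕ i) (Fin.toℕ<n i)))

      eqn : ∀ i → suc (toℕ i) ≡ subproduct v (exps i) ℕ.* (root i ℕ.* root i)
      eqn i = proj₂ (proj₂ (decompose (toℕ i) (Fin.toℕ<n i)))

      root≢0 : ∀ i → root i ≢ 0
      root≢0 i eq = ℕ.1+n≢0 (trans (eqn i) (trans
        (cong (λ b → subproduct v (exps i) ℕ.* (b ℕ.* b)) eq) (ℕ.*-zeroʳ (subproduct v (exps i)))))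

      factor≢0 : ∀ i → subproduct v (exps i) ≢ 0
      factor≢0 i eq = ℕ.1+n≢0 (trans (eqn i) (cong (ℕ._* (root i ℕ.* root i)) eq))

      root≤B : ∀ i → root i ℕ.≤ B
      root≤B i = square-≤ (ℕ.≤-trans
        (ℕ.m≤n*m (root i ℕ.* root i) (subproduct v (exps i)) {{ℕ.≢-nonZero (factor≢0 i)}})
        (subst (ℕ._≤ B ℕ.* B) (eqn i) (Fin.toℕ<n i)))

      suc-pred-root : ∀ i → suc (ℕ.pred (root i)) ≡ root i
      suc-pred-root i = ℕ.suc-pred (root i) {{ℕ.≢-nonZero (root≢0 i)}}

      pred-root<B : ∀ i → ℕ.pred (root i) ℕ.< B
      pred-root<B i = subst (ℕ._≤ B) (sym (suc-pred-root i)) (root≤B i)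

      code : Fin (B ℕ.* B) → Fin (2 ^ n ℕ.* B)
      code i = combine (funToFin (exps i)) (fromℕ< (pred-root<B i))

      code-injective : Injective _≡_ _≡_ code
      code-injective {i} {j} eq = Fin.toℕ-injective (ℕ.suc-injective (begin
        suc (toℕ i)                                     ≡⟨ eqn i ⟩
        subproduct v (exps i) ℕ.* (root i ℕ.* root i)   ≡⟨ cong₂ (λ a b → a ℕ.* (b ℕ.* b)) exps≡ root≡ ⟩
        subproduct v (exps j) ℕ.* (root j ℕ.* root j)   ≡⟨ eqn j ⟨
        suc (toℕ j)                                     ∎))
        where
        open ≡-Reasoning
        both : funToFin (exps i) ≡ funToFin (exps j) ×
               fromℕ< (pred-root<B i) ≡ fromℕ< (pred-root<B j)
        both = Fin.combine-injective (funToFin (exps i)) _ (funToFin (exps j)) _ eq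
        exps≡ : subproduct v (exps i) ≡ subproduct v (exps j)
        exps≡ = subproduct-cong v λ k → begin
          exps i k                       ≡⟨ Fin.finToFun-funToFin (exps i) k ⟨
          finToFun (funToFin (exps i)) k ≡⟨ cong (λ x → finToFun x k) (proj₁ both) ⟩
          finToFun (funToFin (exps j)) k ≡⟨ Fin.finToFun-funToFin (exps j) k ⟩
          exps j k                       ∎
        root≡ : root i ≡ root j
        root≡ = begin
          root i                               ≡⟨ suc-pred-root i ⟨
          suc (ℕ.pred (root i))                ≡⟨ cong suc (Fin.toℕ-fromℕ< (pred-root<B i)) ⟨
          suc (toℕ (fromℕ< (pred-root<B i)))   ≡⟨ cong (suc ∘ toℕ) (proj₂ both) ⟩
          suc (toℕ (fromℕ< (pred-root<B j)))   ≡⟨ cong suc (Fin.toℕ-fromℕ< (pred-root<B j)) ⟩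
          suc (ℕ.pred (root j))                ≡⟨ suc-pred-root j ⟩
          root j                               ∎

  factors≤ : ∀ {qs} → All Prime qs → All (ℕ._≤ product qs) qs
  factors≤ {qs} pqs = go pqs (λ q∈ → q∈)
    where
    go : ∀ {rs} → All Prime rs → (∀ {q} → q ∣ product rs → q ∣ product qs) →
         All (ℕ._≤ product qs) rs
    go [] _ = []
    go {r ∷ rs} (pr ∷ prs) sub =
      ∣⇒≤ {{productOfPrimes≢0 pqs}} (sub (m∣m*n (product rs))) ∷
      go prs (λ q∣ → sub (∣-trans q∣ (n∣m*n r)))

p≤4^n : ∀ n → p n ℕ.≤ 4 ^ n
p≤4^n zero    = z≤n
p≤4^n (suc n) = ℕ.≮⇒≥ λ 4^<p → ℕ.<⇒≱
  (ℕ.*-monoˡ-< B {{ℕ.m^n≢0 2 (suc n)}} (ℕ.^-monoʳ-< 2 ℕ.≤-refl (ℕ.n<1+n n)))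
  (count (λ i → p (suc (toℕ i))) B λ m m≤ → decompose m (ℕ.≤-<-trans m≤ (subst (ℕ._< p (suc n)) 4^≡B² 4^<p)))
  where
  B = 2 ^ suc n
  4^≡B² : 4 ^ suc n ≡ B ℕ.* B
  4^≡B² = begin
    4 ^ suc n           ≡⟨ ℕ.^-*-assoc 2 2 (suc n) ⟩
    2 ^ (2 ℕ.* suc n)   ≡⟨ cong (λ k → 2 ^ (suc n ℕ.+ k)) (ℕ.+-identityʳ (suc n)) ⟩
    2 ^ (suc n ℕ.+ suc n) ≡⟨ ℕ.^-distribˡ-+-* 2 (suc n) (suc n) ⟩
    B ℕ.* B             ∎
    where open ≡-Reasoning
  decompose : ∀ m → suc m ℕ.< p (suc n) → SquareTimes (λ (i : Fin n) → p (suc (toℕ i))) (suc m)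
  decompose m m< with factorise (suc m)
  ... | record { factors = qs ; isFactorisation = eq ; factorsPrime = pqs } =
    subst (SquareTimes _) (sym eq) (squareTimes _
      (All.zipWith (λ { (pq , q≤) → p-complete n pq
                          (ℕ.≤-<-trans q≤ (subst (ℕ._< p (suc n)) eq m<)) })
                   (pqs , factors≤ pqs)))

term : ℕ → ℕ → ℚ
term k n = (+ (p n ^ k) / n !) {{n ℕ.!≢0}}

-- The sum runs over 1 ≤ n ≤ N, so the seed p 0 does not contribute.
partialSum : ℕ → ℕ → ℚ
partialSum k zero    = 0ℚ
partialSum k (suc N) = partialSum k N + term k (suc N)

private
  /-mono-≤ : ∀ a b d e .{{_ : ℕ.NonZero d}} .{{_ : ℕ.NonZero e}} →
             a ℕ.* e ℕ.≤ b ℕ.* d → + a / d ≤ + b / e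
  /-mono-≤ a b (suc d) (suc e) h = toℚᵘ-cancel-≤
    (ℚᵘ.≤-respˡ-≃ (ℚᵘ.≃-sym (toℚᵘ-fromℚᵘ (ℚᵘ.mkℚᵘ (+ a) d)))
    (ℚᵘ.≤-respʳ-≃ (ℚᵘ.≃-sym (toℚᵘ-fromℚᵘ (ℚᵘ.mkℚᵘ (+ b) e)))
    (ℚᵘ.*≤* (subst₂ ℤ._≤_ (ℤ.pos-* a (suc e)) (ℤ.pos-* b (suc d)) (ℤ.+≤+ h)))))

  /-< : ∀ a d y e .{{_ : ℕ.NonZero d}} .(c : Coprime (suc y) (suc e)) →
        a ℕ.* suc e ℕ.< suc y ℕ.* d → + a / d < mkℚ +[1+ y ] e c
  /-< a (suc d) y e c h = toℚᵘ-cancel-<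
    (ℚᵘ.<-respˡ-≃ (ℚᵘ.≃-sym (toℚᵘ-fromℚᵘ (ℚᵘ.mkℚᵘ (+ a) d)))
    (ℚᵘ.*<* (subst₂ ℤ._<_ (ℤ.pos-* a (suc e)) (ℤ.pos-* (suc y) (suc d)) (ℤ.+<+ h))))

  /-double : ∀ a d e .{{_ : ℕ.NonZero d}} .{{_ : ℕ.NonZero e}} → d ≡ 2 ℕ.* e →
             + a / d + + a / d ≡ + a / e
  /-double a (suc d) (suc e) d≡2e = toℚᵘ-injective (begin
    toℚᵘ (+ a / suc d + + a / suc d)           ≈⟨ toℚᵘ-homo-+ (+ a / suc d) (+ a / suc d) ⟩
    toℚᵘ (+ a / suc d) ℚᵘ.+ toℚᵘ (+ a / suc d) ≈⟨ ℚᵘ.+-cong a/d a/d ⟩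
    ℚᵘ.mkℚᵘ (+ a) d ℚᵘ.+ ℚᵘ.mkℚᵘ (+ a) d       ≈⟨ ℚᵘ.*≡* cross ⟩
    ℚᵘ.mkℚᵘ (+ a) e                            ≈⟨ toℚᵘ-fromℚᵘ (ℚᵘ.mkℚᵘ (+ a) e) ⟨
    toℚᵘ (+ a / suc e)                         ∎)
    where
    open ℚᵘ.≃-Reasoning
    a/d = toℚᵘ-fromℚᵘ (ℚᵘ.mkℚᵘ (+ a) d)
    D = + suc d
    E = + suc e
    D≡2E : D ≡ + 2 ℤ.* E
    D≡2E = trans (cong +_ d≡2e) (ℤ.pos-* 2 (suc e))
    alg : ∀ x E → (x ℤ.* (+ 2 ℤ.* E) ℤ.+ x ℤ.* (+ 2 ℤ.* E)) ℤ.* E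
                ≡ x ℤ.* ((+ 2 ℤ.* E) ℤ.* (+ 2 ℤ.* E))
    alg = solve 2 (λ x E → (x :* (con (+ 2) :* E) :+ x :* (con (+ 2) :* E)) :* E
                        := x :* ((con (+ 2) :* E) :* (con (+ 2) :* E))) refl
      where open ℤSolver.+-*-Solver
    cross : (+ a ℤ.* D ℤ.+ + a ℤ.* D) ℤ.* E ≡ + a ℤ.* + (suc d ℕ.* suc d)
    cross = trans
      (subst (λ D → (+ a ℤ.* D ℤ.+ + a ℤ.* D) ℤ.* E ≡ + a ℤ.* (D ℤ.* D)) (sym D≡2E) (alg (+ a) E))
      (cong (+ a ℤ.*_) (sym (ℤ.pos-* (suc d) (suc d))))

  n<2^n : ∀ n → n ℕ.< 2 ^ n
  n<2^n zero    = z<s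
  n<2^n (suc n) = begin-strict
    suc n              <⟨ s≤s (n<2^n n) ⟩
    1 ℕ.+ 2 ^ n        ≤⟨ ℕ.+-monoˡ-≤ (2 ^ n) (ℕ.m^n>0 2 n) ⟩
    2 ^ n ℕ.+ 2 ^ n    ≡⟨ cong (2 ^ n ℕ.+_) (ℕ.+-identityʳ (2 ^ n)) ⟨
    2 ^ suc n          ∎
    where open ℕ.≤-Reasoning

  a^n≤a^a*n! : ∀ a .{{_ : ℕ.NonZero a}} n → a ^ n ℕ.≤ a ^ a ℕ.* n !
  a^n≤a^a*n! a zero = ℕ.≤-trans (ℕ.m^n>0 a a) (ℕ.m≤m*n (a ^ a) 1)
  a^n≤a^a*n! a (suc n) with suc n ℕ.≤? a
  ... | yes n<a = begin
    a ^ suc n            ≤⟨ ℕ.^-monoʳ-≤ a n<a ⟩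
    a ^ a                ≤⟨ ℕ.m≤m*n (a ^ a) (suc n !) {{suc n ℕ.!≢0}} ⟩
    a ^ a ℕ.* suc n !    ∎
    where open ℕ.≤-Reasoning
  ... | no n≮a = begin
    a ℕ.* a ^ n                 ≤⟨ ℕ.*-mono-≤ (ℕ.<⇒≤ (ℕ.≰⇒> n≮a)) (a^n≤a^a*n! a n) ⟩
    suc n ℕ.* (a ^ a ℕ.* n !)   ≡⟨ ℕ.*-assoc (suc n) (a ^ a) (n !) ⟨
    suc n ℕ.* a ^ a ℕ.* n !     ≡⟨ cong (ℕ._* n !) (ℕ.*-comm (suc n) (a ^ a)) ⟩
    a ^ a ℕ.* suc n ℕ.* n !     ≡⟨ ℕ.*-assoc (a ^ a) (suc n) (n !) ⟩
    a ^ a ℕ.* suc n !           ∎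
    where open ℕ.≤-Reasoning

  module _ (k : ℕ) where

    base : ℕ
    base = 2 ^ suc (2 ℕ.* k)

    instance
      base≢0 : ℕ.NonZero base
      base≢0 = ℕ.m^n≢0 2 (suc (2 ℕ.* k))

    C : ℕ
    C = base ^ base

    p^k*2^n≤ : ∀ n → p n ^ k ℕ.* 2 ^ n ℕ.≤ C ℕ.* n !
    p^k*2^n≤ n = begin
      p n ^ k ℕ.* 2 ^ n            ≤⟨ ℕ.*-monoˡ-≤ (2 ^ n) (ℕ.^-monoˡ-≤ k (p≤4^n n)) ⟩
      (4 ^ n) ^ k ℕ.* 2 ^ n        ≡⟨ cong (λ z → z ^ k ℕ.* 2 ^ n) (ℕ.^-*-assoc 2 2 n) ⟩
      (2 ^ (2 ℕ.* n)) ^ k ℕ.* 2 ^ n  ≡⟨ cong (ℕ._* 2 ^ n) (ℕ.^-*-assoc 2 (2 ℕ.* n) k) ⟩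
      2 ^ (2 ℕ.* n ℕ.* k) ℕ.* 2 ^ n  ≡⟨ ℕ.^-distribˡ-+-* 2 (2 ℕ.* n ℕ.* k) n ⟨
      2 ^ (2 ℕ.* n ℕ.* k ℕ.+ n)    ≡⟨ cong (2 ^_) (exponent n k) ⟩
      2 ^ (suc (2 ℕ.* k) ℕ.* n)    ≡⟨ ℕ.^-*-assoc 2 (suc (2 ℕ.* k)) n ⟨
      base ^ n                     ≤⟨ a^n≤a^a*n! base n ⟩
      C ℕ.* n !                    ∎
      where
      open ℕ.≤-Reasoning
      exponent : ∀ n k → 2 ℕ.* n ℕ.* k ℕ.+ n ≡ suc (2 ℕ.* k) ℕ.* n
      exponent = solve 2 (λ n k → con 2 :* n :* k :+ n :=
                                  (con 1 :+ con 2 :* k) :* n) refl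
        where open ℕSolver.+-*-Solver

    gap : ℕ → ℚ
    gap n = (+ C / 2 ^ n) {{ℕ.m^n≢0 2 n}}

    term≤gap : ∀ n → term k n ≤ gap n
    term≤gap n = /-mono-≤ (p n ^ k) C (n !) (2 ^ n)
      {{n ℕ.!≢0}} {{ℕ.m^n≢0 2 n}} (p^k*2^n≤ n)

    0≤term : ∀ n → 0ℚ ≤ term k n
    0≤term n = nonNegative⁻¹ (term k n) {{normalize-nonNeg (p n ^ k) (n !) {{n ℕ.!≢0}}}}

    partialSum-mono : ∀ {N n} → N ℕ.≤′ n → partialSum k N ≤ partialSum k n
    partialSum-mono ℕ.≤′-refl = ≤-refl
    partialSum-mono {N} {suc n} (ℕ.≤′-step N≤n) = begin
      partialSum k N             ≤⟨ partialSum-mono N≤n ⟩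
      partialSum k n             ≡⟨ +-identityʳ (partialSum k n) ⟨
      partialSum k n + 0ℚ        ≤⟨ +-monoʳ-≤ (partialSum k n) (0≤term (suc n)) ⟩
      partialSum k (suc n)       ∎
      where open ≤-Reasoning

    partialSum+gap-antimono : ∀ {N n} → N ℕ.≤′ n →
                              partialSum k n + gap n ≤ partialSum k N + gap N
    partialSum+gap-antimono ℕ.≤′-refl = ≤-refl
    partialSum+gap-antimono {N} {suc n} (ℕ.≤′-step N≤n) = begin
      s + term k (suc n) + g     ≡⟨ +-assoc s (term k (suc n)) g ⟩
      s + (term k (suc n) + g)   ≤⟨ +-monoʳ-≤ s (+-monoˡ-≤ g (term≤gap (suc n))) ⟩
      s + (g + g)                ≡⟨ cong (λ z → s + z) (/-double C (2 ^ suc n) (2 ^ n)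
                                      {{ℕ.m^n≢0 2 (suc n)}} {{ℕ.m^n≢0 2 n}} refl) ⟩
      s + gap n                  ≤⟨ partialSum+gap-antimono N≤n ⟩
      partialSum k N + gap N     ∎
      where
      open ≤-Reasoning
      s = partialSum k n
      g = gap (suc n)

    0≤gap : ∀ n → 0ℚ ≤ gap n
    0≤gap n = ≤-trans (0≤term n) (term≤gap n)

    partialSum-≤ : ∀ {N m n} → N ℕ.≤ m → N ℕ.≤ n →
                   partialSum k m - partialSum k n ≤ gap N
    partialSum-≤ {N} {m} {n} N≤m N≤n = begin
      x - y                        ≡⟨ cong (_- y) (+-identityʳ x) ⟨
      x + 0ℚ - y                   ≤⟨ +-monoˡ-≤ (- y) (+-monoʳ-≤ x (0≤gap m)) ⟩
      x + gap m - y                ≤⟨ +-monoˡ-≤ (- y) (partialSum+gap-antimono (ℕ.≤⇒≤′ N≤m)) ⟩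
      partialSum k N + gap N - y   ≤⟨ +-monoˡ-≤ (- y) (+-monoˡ-≤ (gap N) (partialSum-mono (ℕ.≤⇒≤′ N≤n))) ⟩
      y + gap N - y                ≡⟨ cancel y (gap N) ⟩
      gap N                        ∎
      where
      open ≤-Reasoning
      x = partialSum k m
      y = partialSum k n
      cancel : ∀ y g → y + g - y ≡ g
      cancel = solve 2 (λ y g → y :+ g :- y := g) refl
        where open ℚ-Solver

    ∣partialSum∣-≤ : ∀ {N m n} → N ℕ.≤ m → N ℕ.≤ n →
                     ∣ partialSum k m - partialSum k n ∣ ≤ gap N
    ∣partialSum∣-≤ {N} {m} {n} N≤m N≤n with ∣p∣≡p∨∣p∣≡-p (partialSum k m - partialSum k n)
    ... | inj₁ eq = subst (_≤ gap N) (sym eq) (partialSum-≤ N≤m N≤n)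
    ... | inj₂ eq = subst (_≤ gap N)
      (sym (trans eq (neg-diff (partialSum k m) (partialSum k n)))) (partialSum-≤ N≤n N≤m)

    gap-< : ∀ {ε} → 0ℚ < ε → ∃ λ N → gap N < ε
    gap-< {mkℚ +[1+ y ] e c} _ = N , /-< C (2 ^ N) y e {{ℕ.m^n≢0 2 N}} c
      (ℕ.<-≤-trans (n<2^n N) (ℕ.m≤n*m (2 ^ N) (suc y)))
      where N = C ℕ.* suc e
    gap-< {mkℚ (+ 0) e c} (*<* (ℤ.+<+ ()))
    gap-< {mkℚ -[1+ y ] e c} (*<* ())

partialSum-cauchy : ∀ k → Cauchy (partialSum k)
partialSum-cauchy k ε>0 with gap-< k ε>0
... | N , gap<ε = N , λ N≤m N≤n → ≤-<-trans (∣partialSum∣-≤ k N≤m N≤n) gap<ε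

-- A Cauchy sequence of rationals represents its own limit, so the sum of the
-- series is the real number represented by its partial sums.
S : ℕ → ℝ
S k = mkℝ (partialSum k) (partialSum-cauchy k)

1,S : ℕ → ℝ
1,S zero    = 1ᴿ
1,S (suc k) = S k

{-# OPTIONS --safe #-}

-- Multiplying a relation by its denominators and by factorials gives integers
-- T n with n T(n) - T(n + 1) = f(p n), where f is a nonzero integer polynomial
-- of degree d, and Chebyshev's bound p n = n^(1 + o(1)) makes T(n) about as
-- large as f(p n) / n.  Near a large N, the pigeonhole principle yields cubes
-- with p (n + ε·Δ) = p n + ε·η for which the following gaps between primes are
-- the same at all vertices.  For integers u and v put Z n = v p(n) - u n; after
-- subtraction of a polynomial in n and Z, vᵈ T becomes an integer sequence R
-- with n R(n) - R(n + 1) = s(n), where s(n) is a polynomial in Z n, …, Z (n + d)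
-- whose coefficients do not depend on n.
--
-- With u = p n and v = n, alternating sums of R over d-dimensional faces show
-- that ∏ (n ηⱼ - p(n) Δⱼ) is small; hence many edges (Δⱼ , ηⱼ) are parallel.
-- With u = η and v = Δ taken from such an edge, Z is constant on the vertices
-- of the parallel face, and divided differences of R there force R = s = 0.
-- Therefore Z is small, so that R = s = 0 on a long interval, and s = 0 is a
-- recurrence which determines Z.  As Z agrees near n and near n + Δ, it has
-- period Δ: the primes contain an arithmetic progression with difference η and
-- more than η terms, which is impossible.

module Submission where

open import Defs
open import Data.Empty using (⊥)
open import Data.Fin.Base as Fin using (Fin; toℕ; fromℕ<; combine)
import Data.Fin.Properties as Fin
open import Data.Nat.Base as ℕ using (ℕ; zero; suc; z≤n; s≤s; z<s)
open import Data.Product.Base using (∃; ∃₂; _×_; _,_; proj₁; proj₂)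
import Data.Rational.Base as ℚ
import Data.Rational.Properties as ℚ
open import Data.Sum.Base using (_⊎_; inj₁; inj₂)
open import Data.Unit.Base using (⊤; tt)
open import Data.Vec.Base using (Vec; []; _∷_)
open import Function.Base using (_∘_)
open import Relation.Binary.PropositionalEquality
open import Relation.Nullary using (Dec; ¬_; yes; no; contradiction)

-- The facts used about primes are an upper bound for p n, monotonicity and the absence of long
-- progressions; nothing is known about individual gaps. Two scales compensate: N, and a power of
-- two `a` comparable with log N, such that p (2 N + 1) ≤ a N. Exponents are fixed before `a` and N,
-- so that every power of `a` in use is below N. Quantities are then shown to vanish by integrality:
-- a multiple of mᵏ⁺¹ with m ≥ N that is at most aᵉ Nᵏ is zero. The cube has 3 d edges. On a face
-- spanned by d of them the subtracted polynomial P has degree below d, so alternating sums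
-- annihilate it; hence fewer than d edges can fail to be nearly parallel to (n , p n), and 2 d + 1
-- remain. A path along these has 2 d + 2 vertices, as many as the divided differences need, because
-- R is known a priori only to have size N^(2 d) and each difference gains one factor N. The
-- integers u and v are left free because the same peeling serves twice: along the secant, where Z
-- is 0 at the base point, and along an edge, where Z takes equal values at all these vertices.

-- Growth of the primes and their arithmetic progressions

module Primes where

  open import Data.List.Base using (List; []; _∷_; length; tabulate)
  open import Data.List.Membership.Propositional using (_∈_)
  open import Data.List.Membership.Propositional.Properties using (∈-tabulate⁺)
  open import Data.List.Properties using (length-tabulate)
  open import Data.List.Relation.Unary.All using (All; []; _∷_)
  import Data.List.Relation.Unary.All.Properties as All
  open import Data.List.Relation.Unary.Any using (here; there)
  open import Data.Nat.Base
  open import Data.Nat.Divisibility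
  open import Data.Nat.DivMod using (_/_; _%_; m%n<n; m≡m%n+[m/n]*n)
  open import Data.Nat.Induction using (<-rec)
  open import Data.Nat.ListAction using (product)
  open import Data.Nat.Primality using (Prime; prime⇒nonTrivial; prime⇒irreducible; ¬prime[0]; ¬prime[1])
  open import Data.Nat.Primality.Factorisation using (factorise)
  open import Data.Nat.Properties
  open import Data.Nat.Tactic.RingSolver using (solve-∀)

  -- Chebyshev's bound

  split-power : ∀ {q} → 1 < q → ∀ m → 0 < m → ∃₂ λ e m′ → m ≡ q ^ e * m′ × ¬ (q ∣ m′)
  split-power {q} 1<q = <-rec _ go
    where
    go : ∀ m → (∀ {k} → k < m → 0 < k → ∃₂ λ e m′ → k ≡ q ^ e * m′ × ¬ (q ∣ m′)) →
         0 < m → ∃₂ λ e m′ → m ≡ q ^ e * m′ × ¬ (q ∣ m′)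
    go m rec 0<m with q ∣? m
    ... | no q∤m = 0 , m , sym (*-identityˡ m) , q∤m
    ... | yes (divides zero refl) = contradiction 0<m (<-irrefl refl)
    ... | yes (divides k@(suc _) refl) with rec (m<m*n k q 1<q) z<s
    ...   | e , m′ , eq , q∤m′ = suc e , m′ , trans (cong (_* q) eq) (rearrange (q ^ e) m′ q) , q∤m′
      where
      rearrange : ∀ a b c → a * b * c ≡ c * a * b
      rearrange = solve-∀

  n<q^n : ∀ {q} → 1 < q → ∀ n → n < q ^ n
  n<q^n 1<q zero = z<s
  n<q^n {q} 1<q (suc n) = ≤-trans (s≤s (n<q^n 1<q n)) (subst (q ^ n <_) (*-comm (q ^ n) q) (m<m*n (q ^ n) q {{>-nonZero (≤-<-trans z≤n (n<q^n 1<q n))}} 1<q))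

  ^-distribʳ-* : ∀ n a b → (a * b) ^ n ≡ a ^ n * b ^ n
  ^-distribʳ-* zero a b = refl
  ^-distribʳ-* (suc n) a b = trans (cong (a * b *_) (^-distribʳ-* n a b)) (swap a b (a ^ n) (b ^ n))
    where
    swap : ∀ a b c d → a * b * (c * d) ≡ a * c * (b * d)
    swap = solve-∀

  largest-power : ∀ {q} → 1 < q → ∀ {n} → 0 < n → ∃ λ e → q ^ e ≤ n × n < q ^ suc e
  largest-power {q} 1<q {n} 0<n = search n (<-trans (n<q^n 1<q n) (^-monoʳ-< q 1<q (n<1+n n)))
    where
    search : ∀ j → n < q ^ suc j → ∃ λ e → q ^ e ≤ n × n < q ^ suc e
    search zero n< = 0 , 0<n , n<
    search (suc j) n< with q ^ suc j ≤? n
    ... | yes q^≤n = suc j , q^≤n , n<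
    ... | no q^≰n = search j (≰⇒> q^≰n)

  floorPower : ∀ {q} → Prime q → ∀ {n} → 0 < n → ℕ
  floorPower {q} pq 0<n = q ^ proj₁ (largest-power (nonTrivial⇒n>1 q {{prime⇒nonTrivial pq}}) 0<n)

  ∣floorPower : ∀ {q} (pq : Prime q) {n} (0<n : 0 < n) {e} → q ^ e ≤ n → q ^ e ∣ floorPower pq 0<n
  ∣floorPower {q} pq {n} 0<n {e} q^e≤n = ^-∣ {e} {proj₁ largest} (≤-pred (≰⇒> λ f<e →
      <⇒≱ (proj₂ (proj₂ largest)) (≤-trans (^-monoʳ-≤ q {{>-nonZero (<-trans z<s 1<q)}} f<e) q^e≤n)))
    where
    1<q = nonTrivial⇒n>1 q {{prime⇒nonTrivial pq}}
    largest = largest-power 1<q 0<n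
    ^-∣ : ∀ {e f} → e ≤ f → q ^ e ∣ q ^ f
    ^-∣ {f = f} z≤n = 1∣ (q ^ f)
    ^-∣ (s≤s {e} {f} e≤f) = *-monoʳ-∣ q (^-∣ {e} {f} e≤f)

  module _ {n} (0<n : 0 < n) where

    -- When `qs` lists the primes up to `n`, this is lcm(1, ..., n), the product of the largest
    -- prime powers up to `n`. As each factor is at most `n`, so is the product at most `n` to the
    -- number of primes.
    floorPowers : ∀ {qs} → All Prime qs → ℕ
    floorPowers [] = 1
    floorPowers (pq ∷ pqs) = floorPower pq 0<n * floorPowers pqs

    floorPowers≤ : ∀ {qs} (pqs : All Prime qs) → floorPowers pqs ≤ n ^ length qs
    floorPowers≤ [] = ≤-refl
    floorPowers≤ (pq ∷ pqs) = *-mono-≤ (proj₁ (proj₂ (largest-power (nonTrivial⇒n>1 _ {{prime⇒nonTrivial pq}}) 0<n))) (floorPowers≤ pqs)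

    -- The exact power of the head prime in `m` is at most `n`, so it divides the first factor; the
    -- cofactor has its prime divisors in the tail.
    ∣floorPowers : ∀ {qs} (pqs : All Prime qs) {m} → 0 < m → m ≤ n →
                   (∀ {q} → Prime q → q ∣ m → q ∈ qs) → m ∣ floorPowers pqs
    ∣floorPowers [] {m} 0<m m≤n smooth with factorise m {{>-nonZero 0<m}}
    ... | record { factors = [] ; isFactorisation = eq } = subst (_∣ 1) (sym eq) ∣-refl
    ... | record { factors = q ∷ qs ; isFactorisation = eq ; factorsPrime = pq ∷ _ }
      with () ← smooth pq (subst (q ∣_) (sym eq) (m∣m*n (product qs)))
    ∣floorPowers {q ∷ qs} (pq ∷ pqs) {m} 0<m m≤n smooth
      with e , m′ , eq , q∤m′ ← split-power (nonTrivial⇒n>1 q {{prime⇒nonTrivial pq}}) m 0<m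
      = subst (_∣ _) (sym eq) (*-pres-∣ (∣floorPower pq 0<n {e} (≤-trans (∣⇒≤ {{m≢0}} (subst (q ^ e ∣_) (sym eq) (m∣m*n m′))) m≤n))
                        (∣floorPowers pqs 0<m′ (≤-trans (∣⇒≤ {{m≢0}} m′∣m) m≤n) smooth′))
      where
      instance
        m≢0 : NonZero m
        m≢0 = >-nonZero 0<m
      m′∣m : m′ ∣ m
      m′∣m = subst (m′ ∣_) (sym eq) (n∣m*n (q ^ e))
      0<m′ : 0 < m′
      0<m′ = n≢0⇒n>0 λ { refl → q∤m′ (q ∣0) }
      smooth′ : ∀ {r} → Prime r → r ∣ m′ → r ∈ qs
      smooth′ pr r∣m′ with smooth pr (∣-trans r∣m′ m′∣m)
      ... | here refl = contradiction r∣m′ q∤m′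
      ... | there r∈ = r∈

  -- ∫ xᵏ (1 - x)ʳ dx = k! r! / (k + r + 1)! is an integer combination of 1/1, …, 1/(k + r + 1).
  beta-∣ : ∀ k r {M} → (∀ m → 0 < m → m ≤ suc (k + r) → m ∣ M) → suc (k + r) ! ∣ M * (k ! * r !)
  beta-∣ zero r {M} common = subst (suc r ! ∣_) (cong (M *_) (sym (+-identityʳ (r !))))
    (*-monoˡ-∣ (r !) (common (suc r) z<s ≤-refl))
  beta-∣ (suc k) r {M} common = ∣m+n∣m⇒∣n
    -- Integrating xᵏ (1 - x)ʳ = xᵏ (1 - x)ʳ⁺¹ + xᵏ⁺¹ (1 - x)ʳ and multiplying by M (k + r + 2)!
    -- gives `split`.
    (subst (suc (suc k + r) ! ∣_) (split M (k !) (r !) k r)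
      (*-monoʳ-∣ (suc (suc k + r)) (beta-∣ k r λ m 0<m m≤ → common m 0<m (m≤n⇒m≤1+n m≤))))
    (subst (λ s → suc s ! ∣ M * (k ! * suc r !)) (+-suc k r)
      (beta-∣ k (suc r) λ m 0<m m≤ → common m 0<m (subst (λ s → m ≤ suc s) (+-suc k r) m≤)))
    where
    split : ∀ M a b k r → suc (suc k + r) * (M * (a * b)) ≡ M * (a * (suc r * b)) + M * ((suc k * a) * b)
    split = solve-∀

  -- As x (1 - x) ≤ 1/4, the integral m!² / (2 m + 1)! is at most 4⁻ᵐ; the induction compares (2 m +
  -- 2)² with (2 m + 3) (2 m + 2).
  4^m*m!²≤ : ∀ m → 4 ^ m * (m ! * m !) ≤ suc (m + m) !
  4^m*m!²≤ zero = ≤-refl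
  4^m*m!²≤ (suc m) = begin
    4 * 4 ^ m * (suc m * m ! * (suc m * m !))          ≡⟨ regroup (4 ^ m) (m !) m ⟩
    (2 * suc m) * (2 * suc m) * (4 ^ m * (m ! * m !))  ≤⟨ *-mono-≤ bound (4^m*m!²≤ m) ⟩
    (3 + (m + m)) * (2 + (m + m)) * suc (m + m) !      ≡⟨ *-assoc (3 + (m + m)) (2 + (m + m)) (suc (m + m) !) ⟩
    (3 + (m + m)) !                                    ≡⟨ cong (λ s → suc (suc s) !) (sym (+-suc m m)) ⟩
    suc (suc m + suc m) !                              ∎
    where
    open ≤-Reasoning
    regroup : ∀ a b m → 4 * a * (suc m * b * (suc m * b)) ≡ (2 * suc m) * (2 * suc m) * (a * (b * b))
    regroup = solve-∀
    double : ∀ m → 2 * suc m ≡ 2 + (m + m)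
    double = solve-∀
    bound : (2 * suc m) * (2 * suc m) ≤ (3 + (m + m)) * (2 + (m + m))
    bound = *-mono-≤ (≤-trans (≤-reflexive (double m)) (n≤1+n _)) (≤-reflexive (double m))

  -- Nair's argument: M m!² / (2 m + 1)! is a positive integer, while m!² / (2 m + 1)! is at most
  -- 4⁻ᵐ.
  4^m≤commonMultiple : ∀ m {M} → 0 < M → (∀ n → 0 < n → n ≤ suc (m + m) → n ∣ M) → 4 ^ m ≤ M
  4^m≤commonMultiple m {M} 0<M common = *-cancelʳ-≤ (4 ^ m) M (m ! * m !) {{m!²≢0}}
    (≤-trans (4^m*m!²≤ m) (∣⇒≤ {{m*n≢0 M (m ! * m !) {{>-nonZero 0<M}} {{m!²≢0}}}} (beta-∣ m m common)))
    where
    m!²≢0 : NonZero (m ! * m !)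
    m!²≢0 = m*n≢0 (m !) (m !) {{m !≢0}} {{m !≢0}}

  -- If p (k + 1) exceeded n = 2ᵗ, there would be at most k primes up to n, so that lcm(1, ..., n) ≤
  -- nᵏ = 2^(t k). The lower bound 2^(n - 2) for it contradicts the hypothesis.
  p[1+k]≤2^t : ∀ t k → suc (suc (t * k)) < 2 ^ t → p (suc k) ≤ 2 ^ t
  p[1+k]≤2^t zero k (s≤s ())
  p[1+k]≤2^t (suc t) k tk<2^t = ≮⇒≥ λ n<p → <⇒≱ tk<2^t (too-many n<p)
    where
    n = 2 ^ suc t
    0<n : 0 < n
    0<n = m^n>0 2 (suc t)
    qs : List ℕ
    qs = tabulate {n = k} (λ i → p (suc (toℕ i)))
    pqs : All Prime qs
    pqs = All.tabulate⁺ λ i → p-prime (toℕ i)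
    M = floorPowers 0<n pqs
    -- 2 h + 1 = n - 1 is the largest odd number up to n, and 4ʰ = 2^(n - 2).
    h = 2 ^ t ∸ 1
    suc-h : suc h ≡ 2 ^ t
    suc-h = m+[n∸m]≡n (m^n>0 2 t)
    n≡ : n ≡ suc h + suc h
    n≡ = trans (cong (2 ^ t +_) (+-identityʳ (2 ^ t))) (cong₂ _+_ (sym suc-h) (sym suc-h))
    too-many : n < p (suc k) → n ≤ suc (suc (suc t * k))
    too-many n<p = subst (_≤ suc (suc (suc t * k))) (sym (trans n≡ (cong suc (+-suc h h)))) (s≤s (s≤s
      (^-cancelʳ-≤ (h + h) (suc t * k) (begin
        2 ^ (h + h)           ≡⟨ ^-distribˡ-+-* 2 h h ⟩
        2 ^ h * 2 ^ h         ≡⟨ ^-distribʳ-* h 2 2 ⟨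
        4 ^ h                 ≤⟨ 4^m≤commonMultiple h 0<M common ⟩
        M                     ≤⟨ floorPowers≤ 0<n pqs ⟩
        n ^ length qs         ≡⟨ cong (n ^_) (length-tabulate {n = k} (λ i → p (suc (toℕ i)))) ⟩
        n ^ k                 ≡⟨ ^-*-assoc 2 (suc t) k ⟩
        2 ^ (suc t * k)       ∎))))
      where
      open ≤-Reasoning
      ^-cancelʳ-≤ : ∀ i j → 2 ^ i ≤ 2 ^ j → i ≤ j
      ^-cancelʳ-≤ i j le = ≮⇒≥ λ j<i → <⇒≱ (^-monoʳ-< 2 ≤-refl j<i) le
      divides′ : ∀ m → 0 < m → m ≤ n → m ∣ M
      divides′ m 0<m m≤n = ∣floorPowers 0<n pqs 0<m m≤n λ {q} pq q∣m →
        let i , q≡ = p-complete k pq (≤-<-trans (≤-trans (∣⇒≤ {{>-nonZero 0<m}} q∣m) m≤n) n<p) in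
        subst (_∈ qs) (sym q≡) (∈-tabulate⁺ i)
      common : ∀ m → 0 < m → m ≤ suc (h + h) → m ∣ M
      common m 0<m m≤ = divides′ m 0<m (≤-trans m≤ (subst (suc (h + h) ≤_) (sym n≡) (s≤s (+-monoʳ-≤ h (n≤1+n h)))))
      0<M : 0 < M
      0<M = go pqs
        where
        go : ∀ {qs} (pqs : All Prime qs) → 0 < floorPowers 0<n pqs
        go [] = z<s
        go {q ∷ _} (pq ∷ pqs) = *-mono-< {0} {floorPower pq 0<n} {0} (m^n>0 q {{>-nonZero (<-trans z<s (nonTrivial⇒n>1 q {{prime⇒nonTrivial pq}}))}} (proj₁ (largest-power (nonTrivial⇒n>1 q {{prime⇒nonTrivial pq}}) 0<n))) (go pqs)

  -- One of x + D, …, x + (D + 1) D is a proper multiple of D + 1, since D ≡ -1.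
  no-prime-AP : ∀ x D → 0 < D → ¬ (∀ k → k ≤ suc D → Prime (x + k * D))
  no-prime-AP x D 0<D primes = go (x % suc D) (x / suc D) (m%n<n x (suc D)) (m≡m%n+[m/n]*n x (suc D))
    where
    prime-x : Prime x
    prime-x = subst Prime (+-identityʳ x) (primes 0 z≤n)
    composite : ∀ c → 1 < c → ¬ Prime (c * suc D)
    composite c 1<c pr with prime⇒irreducible pr (n∣m*n c)
    ... | inj₁ eq = <-irrefl (sym (suc-injective eq)) 0<D
    ... | inj₂ eq = <-irrefl eq (subst (suc D <_) (*-comm (suc D) c) (m<m*n (suc D) c 1<c))
    go : ∀ r q → r < suc D → ¬ (x ≡ r + q * suc D)
    go zero zero _ x≡ = ¬prime[0] (subst Prime x≡ prime-x)
    -- `x` is itself a multiple of D + 1 but may be the prime D + 1; the index D + 1 reaches a later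
    -- multiple, whose cofactor `suc q + D` exceeds 1.
    go zero (suc q) _ refl = composite (suc q + D) (s≤s (≤-trans 0<D (m≤n+m D q)))
      (subst Prime (alg q D) (primes (suc D) ≤-refl))
      where
      alg : ∀ q D → suc q * suc D + suc D * D ≡ (suc q + D) * suc D
      alg = solve-∀
    go (suc zero) zero _ x≡ = ¬prime[1] (subst Prime x≡ prime-x)
    go (suc r) q r< refl = composite (suc r + q) (large r q refl)
      (subst Prime (alg r q D) (primes (suc r) (<⇒≤ r<)))
      where
      alg : ∀ r q D → suc r + q * suc D + suc r * D ≡ (suc r + q) * suc D
      alg = solve-∀
      large : ∀ r q → x ≡ suc r + q * suc D → 1 < suc r + q
      large (suc r) q _ = s≤s z<s
      large zero (suc q) _ = s≤s z<s
      large zero zero x≡ = contradiction (subst Prime x≡ prime-x) ¬prime[1]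

-- Translation cubes from the pigeonhole principle

module GraphCubes where

  open import Data.Nat.Base
  open import Data.Nat.Properties
  open import Data.Nat.Tactic.RingSolver using (solve-∀)
  open import Data.Vec.Base as Vec using (Vec; []; _∷_; _++_; map; tabulate)
  import Data.Vec.Properties as Vec
  open import Data.Vec.Relation.Unary.All as All using (All; []; _∷_)
  import Data.Vec.Relation.Unary.All.Properties as All
  open Primes using (n<q^n)

  -- Cubes in the graph of an increasing function

  module _ {X : ℕ} where

    encode : ∀ {m} (xs : Vec ℕ m) → All (_< X) xs → Fin (X ^ m)
    encode [] [] = Fin.zero
    encode (x ∷ xs) (x< ∷ xs<) = combine (fromℕ< x<) (encode xs xs<)

    encode-injective : ∀ {m} {xs ys : Vec ℕ m} (xs< : All (_< X) xs) (ys< : All (_< X) ys) →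
                       encode xs xs< ≡ encode ys ys< → xs ≡ ys
    encode-injective [] [] _ = refl
    encode-injective (x< ∷ xs<) (y< ∷ ys<) eq with Fin.combine-injective (fromℕ< x<) (encode _ xs<) (fromℕ< y<) (encode _ ys<) eq
    ... | x≡y , xs≡ys = cong₂ _∷_
      (trans (sym (Fin.toℕ-fromℕ< x<)) (trans (cong toℕ x≡y) (Fin.toℕ-fromℕ< y<)))
      (encode-injective xs< ys< xs≡ys)

    pigeonhole-vec : ∀ {m r} → X ^ m < r → (w : Fin r → Vec ℕ m) → (∀ i → All (_< X) (w i)) →
                     ∃₂ λ i j → i Fin.< j × w i ≡ w j
    pigeonhole-vec X^m<r w w< with Fin.pigeonhole X^m<r (λ i → encode (w i) (w< i))
    ... | i , j , i<j , eq = i , j , i<j , encode-injective (w< i) (w< j) eq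

  module Cubes (g : ℕ → ℕ) (g-< : ∀ n → g n < g (suc n)) where

    g-≤+ : ∀ n i → g n ≤ g (n + i)
    g-≤+ n zero = ≤-reflexive (cong g (sym (+-identityʳ n)))
    g-≤+ n (suc i) = ≤-trans (g-≤+ n i) (≤-trans (<⇒≤ (g-< (n + i))) (≤-reflexive (cong g (sym (+-suc n i)))))

    g-mono-≤ : ∀ {m n} → m ≤ n → g m ≤ g n
    g-mono-≤ {m} {n} m≤n = subst (λ z → g m ≤ g z) (m+[n∸m]≡n m≤n) (g-≤+ m (n ∸ m))

    g-mono-< : ∀ {m n} → m < n → g m < g n
    g-mono-< {m} m<n = <-≤-trans (g-< m) (g-mono-≤ m<n)

    -- Among r consecutive blocks of length L at most m can grow by more than c, because the total
    -- growth is at most c m. In the recursion m counts the bad blocks still possible and k the good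
    -- ones still wanted.
    good-blocks : ∀ L c r m k b → g (b + r * L) ≤ g b + c * m → m + k ≤ r → 0 < L →
      ∃ λ (s : ℕ → ℕ) → (∀ i → i < k → b ≤ s i × s i + L ≤ b + r * L × g (s i + L) ≤ g (s i) + c) ×
                        (∀ i j → i < j → j < k → s i < s j)
    good-blocks L c r m zero b _ _ _ = (λ _ → 0) , (λ _ ()) , λ _ _ _ ()
    good-blocks L c zero m (suc k) b _ m+k≤r _ = contradiction (≤-trans (m≤n+m (suc k) m) m+k≤r) λ ()
    good-blocks L c (suc r) m (suc k) b total m+k≤r 0<L with g (b + L) ≤? g b + c
    ... | yes good with good-blocks L c r m k (b + L) total′ (≤-pred (subst (_≤ suc r) (+-suc m k) m+k≤r)) 0<L
      where
      total′ : g (b + L + r * L) ≤ g (b + L) + c * m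
      total′ = subst (λ z → g z ≤ g (b + L) + c * m) (sym (+-assoc b L (r * L)))
                 (≤-trans total (+-monoˡ-≤ (c * m) (g-≤+ b L)))
    ...   | s , props , mono = s′ , props′ , mono′
      where
      s′ : ℕ → ℕ
      s′ zero = b
      s′ (suc i) = s i
      props′ : ∀ i → i < suc k → b ≤ s′ i × s′ i + L ≤ b + suc r * L × g (s′ i + L) ≤ g (s′ i) + c
      props′ zero _ = ≤-refl , +-monoʳ-≤ b (m≤m+n L (r * L)) , good
      props′ (suc i) (s≤s i<k) with props i i<k
      ... | b≤ , ≤b , good′ = ≤-trans (m≤m+n b L) b≤ , ≤-trans ≤b (≤-reflexive (+-assoc b L (r * L))) , good′
      mono′ : ∀ i j → i < j → j < suc k → s′ i < s′ j
      mono′ zero (suc j) _ (s≤s j<k) = <-≤-trans (m<m+n b 0<L) (proj₁ (props j j<k))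
      mono′ (suc i) (suc j) (s≤s i<j) (s≤s j<k) = mono i j i<j j<k
    good-blocks L c (suc r) zero (suc k) b total m+k≤r 0<L | no bad =
      contradiction (≤-trans (g-mono-≤ (+-monoʳ-≤ b (m≤m+n L (r * L)))) (≤-trans total
        (+-monoʳ-≤ (g b) (≤-trans (≤-reflexive (*-zeroʳ c)) z≤n)))) bad
    good-blocks L c (suc r) (suc m) (suc k) b total m+k≤r 0<L | no bad
      with good-blocks L c r m (suc k) (b + L) total′ (≤-pred m+k≤r) 0<L
      where
      total′ : g (b + L + r * L) ≤ g (b + L) + c * m
      total′ = subst (λ z → g z ≤ g (b + L) + c * m) (sym (+-assoc b L (r * L)))
        (≤-trans total (≤-trans (≤-reflexive (trans (cong (g b +_) (*-suc c m)) (sym (+-assoc (g b) c (c * m)))))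
          (+-monoˡ-≤ (c * m) (<⇒≤ (≰⇒> bad)))))
    ... | s , props , mono = s , (λ i i<k → let b≤ , ≤b , good = props i i<k in
      ≤-trans (m≤m+n b L) b≤ , ≤-trans ≤b (≤-reflexive (+-assoc b L (r * L))) , good) , mono

    -- All vertices of the cube carry the same pattern of M consecutive increments of g.
    Cube : ∀ {k} → ℕ → Vec (ℕ × ℕ) k → ℕ → Set
    Cube M [] n = ⊤
    Cube M ((Δ , η) ∷ vs) n =
      Cube M vs n × Cube M vs (n + Δ) × (∀ j → j ≤ M → g (n + Δ + j) ≡ g (n + j) + η)

    Small : ℕ → ℕ × ℕ → Set
    Small X (Δ , η) = (0 < Δ × Δ < X) × (0 < η × η < X)

    unzip-injective : ∀ {k} {vs ws : Vec (ℕ × ℕ) k} →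
                      map proj₁ vs ≡ map proj₁ ws → map proj₂ vs ≡ map proj₂ ws → vs ≡ ws
    unzip-injective {vs = []} {[]} _ _ = refl
    unzip-injective {vs = _ ∷ _} {_ ∷ _} eq₁ eq₂ = cong₂ _∷_
      (cong₂ _,_ (Vec.∷-injectiveˡ eq₁) (Vec.∷-injectiveˡ eq₂))
      (unzip-injective (Vec.∷-injectiveʳ eq₁) (Vec.∷-injectiveʳ eq₂))

    record Located (M k L X b : ℕ) : Set where
      constructor located
      field
        pos    : ℕ
        vecs   : Vec (ℕ × ℕ) k
        ≤pos   : b ≤ pos
        pos<   : pos + M < b + L
        cube   : Cube M vecs pos
        small  : All (Small X) vecs

    open Located

    pattern-at : ∀ M → ℕ → Vec ℕ (suc M)
    pattern-at M x = tabulate {n = suc M} λ j → g (x + toℕ j) ∸ g x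

    pattern-at-≡ : ∀ M x y → pattern-at M x ≡ pattern-at M y → ∀ t → t ≤ M → g (x + t) ∸ g x ≡ g (y + t) ∸ g y
    pattern-at-≡ M x y eq t t≤M = subst (λ t → g (x + t) ∸ g x ≡ g (y + t) ∸ g y) (Fin.toℕ-fromℕ< (s≤s t≤M))
      (trans (sym (Vec.lookup∘tabulate (λ j → g (x + toℕ j) ∸ g x) j))
        (trans (cong (λ v → Vec.lookup v j) eq) (Vec.lookup∘tabulate (λ j → g (y + toℕ j) ∸ g y) j)))
      where
      j : Fin (suc M)
      j = fromℕ< (s≤s t≤M)

    -- Everything that must agree for two cubes in different blocks to be opposite faces of a larger
    -- one: edges and increments make them parallel, and equal offsets in the blocks make the
    -- displacement positive.
    code : ∀ {M k L X b} → Located M k L X b → Vec ℕ (suc (k + (k + suc M)))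
    code {M} {b = b} l = (pos l ∸ b) ∷ map proj₁ (vecs l) ++ (map proj₂ (vecs l) ++ pattern-at M (pos l))

    code< : ∀ {M k L X X′ b c} (l : Located M k L X b) → X ≤ X′ → L < X′ → c < X′ → g (b + L) ≤ g b + c →
            All (_< X′) (code l)
    code< {M} {k} {L} {X} {X′} {b} {c} l X≤ L< c< growth =
      ≤-<-trans (m≤n+o⇒m∸n≤o (pos l) b pos≤) L< ∷
      All.++⁺ (All.map⁺ (All.map (λ { ((_ , Δ<) , _) → <-≤-trans Δ< X≤ }) (small l)))
        (All.++⁺ (All.map⁺ (All.map (λ { (_ , (_ , η<)) → <-≤-trans η< X≤ }) (small l)))
                 (All.tabulate⁺ {n = suc M} pattern<))
      where
      pos≤ : pos l ≤ b + L
      pos≤ = <⇒≤ (≤-<-trans (m≤m+n (pos l) M) (pos< l))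
      pattern< : ∀ (j : Fin (suc M)) → g (pos l + toℕ j) ∸ g (pos l) < X′
      pattern< j = ≤-<-trans (m≤n+o⇒m∸n≤o (g (pos l + toℕ j)) (g (pos l)) (begin
        g (pos l + toℕ j)  ≤⟨ g-mono-≤ (<⇒≤ (≤-<-trans (+-monoʳ-≤ (pos l) (≤-pred (Fin.toℕ<n j))) (pos< l))) ⟩
        g (b + L)          ≤⟨ growth ⟩
        g b + c            ≤⟨ +-monoˡ-≤ c (g-mono-≤ (≤pos l)) ⟩
        g (pos l) + c      ∎)) c<
        where open ≤-Reasoning

    join : ∀ {M k L X b b′ B L′ c Y} (l : Located M k L X b) (l′ : Located M k L X b′) → code l ≡ code l′ → b < b′ →
           B ≤ b → b′ + L ≤ B + L′ → g (B + L′) ≤ g B + c → L′ < Y → c < Y → X ≤ Y → Located M (suc k) L′ Y B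
    join {M} {k} {L} {X} {b} {b′} {B} {L′} {c} {Y} l l′ same b<b′ B≤b end growth L′< c< X≤ =
      located (pos l) ((Δ , η) ∷ vecs l) B≤pos (≤-<-trans (+-monoˡ-≤ M (<⇒≤ pos<pos)) end′)
        (cube l , subst₂ (Cube M) (sym vecs≡) (sym pos+Δ) (cube l′) , shift)
        (((m<n⇒0<n∸m pos<pos , Δ<) , (m<n⇒0<n∸m (g-mono-< pos<pos) , η<)) ∷
          All.map (λ { ((Δ>0 , Δ<) , (η>0 , η<)) → (Δ>0 , <-≤-trans Δ< X≤) , (η>0 , <-≤-trans η< X≤) }) (small l))
      where
      Δ = pos l′ ∸ pos l
      η = g (pos l′) ∸ g (pos l)
      offset≡ : pos l ∸ b ≡ pos l′ ∸ b′
      offset≡ = Vec.∷-injectiveˡ same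
      tail≡ = Vec.∷-injectiveʳ same
      rest≡ : map proj₂ (vecs l) ++ pattern-at M (pos l) ≡ map proj₂ (vecs l′) ++ pattern-at M (pos l′)
      rest≡ = Vec.++-injectiveʳ (map proj₁ (vecs l)) (map proj₁ (vecs l′)) tail≡
      vecs≡ : vecs l ≡ vecs l′
      vecs≡ = unzip-injective (Vec.++-injectiveˡ (map proj₁ (vecs l)) (map proj₁ (vecs l′)) tail≡)
                              (Vec.++-injectiveˡ (map proj₂ (vecs l)) (map proj₂ (vecs l′)) rest≡)
      pattern≡ : pattern-at M (pos l) ≡ pattern-at M (pos l′)
      pattern≡ = Vec.++-injectiveʳ (map proj₂ (vecs l)) (map proj₂ (vecs l′)) rest≡
      B≤pos : B ≤ pos l
      B≤pos = ≤-trans B≤b (≤pos l)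
      pos<pos : pos l < pos l′
      pos<pos = begin-strict
        pos l               ≡⟨ m+[n∸m]≡n (≤pos l) ⟨
        b + (pos l ∸ b)     <⟨ +-monoˡ-< (pos l ∸ b) b<b′ ⟩
        b′ + (pos l ∸ b)    ≡⟨ cong (b′ +_) offset≡ ⟩
        b′ + (pos l′ ∸ b′)  ≡⟨ m+[n∸m]≡n (≤pos l′) ⟩
        pos l′              ∎
        where open ≤-Reasoning
      pos+Δ : pos l + Δ ≡ pos l′
      pos+Δ = m+[n∸m]≡n (<⇒≤ pos<pos)
      g+η : g (pos l) + η ≡ g (pos l′)
      g+η = m+[n∸m]≡n (g-mono-≤ (<⇒≤ pos<pos))
      shift : ∀ t → t ≤ M → g (pos l + Δ + t) ≡ g (pos l + t) + η
      shift t t≤M = begin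
        g (pos l + Δ + t)                            ≡⟨ cong (λ z → g (z + t)) pos+Δ ⟩
        g (pos l′ + t)                               ≡⟨ m+[n∸m]≡n (g-≤+ (pos l′) t) ⟨
        g (pos l′) + (g (pos l′ + t) ∸ g (pos l′))   ≡⟨ cong₂ _+_ (sym g+η) (sym (pattern-at-≡ M (pos l) (pos l′) pattern≡ t t≤M)) ⟩
        g (pos l) + η + (g (pos l + t) ∸ g (pos l))  ≡⟨ swap (g (pos l)) η (g (pos l + t) ∸ g (pos l)) ⟩
        g (pos l) + (g (pos l + t) ∸ g (pos l)) + η  ≡⟨ cong (_+ η) (m+[n∸m]≡n (g-≤+ (pos l) t)) ⟩
        g (pos l + t) + η                            ∎
        where
        open ≡-Reasoning
        swap : ∀ x y z → x + y + z ≡ x + z + y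
        swap = solve-∀
      end′ : pos l′ + M < B + L′
      end′ = <-≤-trans (pos< l′) end
      pos′≤ : pos l′ ≤ B + L′
      pos′≤ = ≤-trans (m≤m+n (pos l′) M) (<⇒≤ end′)
      Δ< : Δ < Y
      Δ< = ≤-<-trans (m≤n+o⇒m∸n≤o (pos l′) (pos l) (≤-trans pos′≤ (+-monoˡ-≤ L′ B≤pos))) L′<
      η< : η < Y
      η< = ≤-<-trans (m≤n+o⇒m∸n≤o (g (pos l′)) (g (pos l))
        (≤-trans (g-mono-≤ pos′≤) (≤-trans growth (+-monoˡ-≤ c (g-mono-≤ B≤pos))))) c<

    -- Every level of the recursion splits an interval into blocks, of which at
    -- least half are not too long, and applies the pigeonhole principle to them.
    cubes : ∀ M k β → ∃₂ λ κ ξ → ∀ a b → 2 ≤ a → g (b + a ^ κ) ≤ g b + a ^ (κ + β) → Located M k (a ^ κ) (a ^ ξ) b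
    cubes M zero β = M , 0 , λ a b 2≤a _ →
      located b [] ≤-refl (+-monoʳ-< b (<-≤-trans (n<q^n {2} ≤-refl M) (^-monoˡ-≤ M 2≤a))) tt []
    -- The growth exponent is larger by one in the recursive call: a good block may grow by `a`
    -- times the average allowed, so that at most one block in `a` is bad.
    cubes M (suc k) β with cubes M k (suc β)
    ... | κ , ξ , rec = κ + suc ρ , ξ″ , build
      where
      len = suc (k + (k + suc M))
      ξ′ = suc (κ + suc β + ξ)
      -- Of a^(ρ + 1) blocks at most a^ρ are bad, so at least a^ρ are good, more than the X^len =
      -- a^(ξ′ len) possible codes.
      ρ = suc (ξ′ * len)
      ξ″ = suc (κ + suc ρ + β + ξ)

      build : ∀ a b → 2 ≤ a → g (b + a ^ (κ + suc ρ)) ≤ g b + a ^ (κ + suc ρ + β) →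
              Located M (suc k) (a ^ (κ + suc ρ)) (a ^ ξ″) b
      build a b 2≤a total = collide (good-blocks L (a ^ (κ + suc β)) (a ^ suc ρ) (a ^ ρ) (suc (X ^ len)) b total′ enough (m^n>0 a κ))
        where
        instance
          a≢0 : NonZero a
          a≢0 = >-nonZero (<-trans z<s 2≤a)
        L = a ^ κ
        X = a ^ ξ′
        L*r : a ^ (κ + suc ρ) ≡ a ^ suc ρ * L
        L*r = trans (^-distribˡ-+-* a κ (suc ρ)) (*-comm L (a ^ suc ρ))
        total′ : g (b + a ^ suc ρ * L) ≤ g b + a ^ (κ + suc β) * a ^ ρ
        total′ = subst₂ (λ x y → g (b + x) ≤ g b + y) L*r
          (trans (cong (a ^_) (exponents κ ρ β)) (^-distribˡ-+-* a (κ + suc β) ρ)) total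
          where
          exponents : ∀ κ ρ β → κ + suc ρ + β ≡ (κ + suc β) + ρ
          exponents = solve-∀
        enough : a ^ ρ + suc (X ^ len) ≤ a ^ suc ρ
        enough = begin
          a ^ ρ + suc (X ^ len)        ≡⟨ cong (λ z → a ^ ρ + suc z) (^-*-assoc a ξ′ len) ⟩
          a ^ ρ + suc (a ^ (ξ′ * len)) ≤⟨ +-monoʳ-≤ (a ^ ρ) (^-monoʳ-< a 2≤a (n<1+n (ξ′ * len))) ⟩
          a ^ ρ + a ^ ρ                ≡⟨ cong (a ^ ρ +_) (sym (+-identityʳ (a ^ ρ))) ⟩
          2 * a ^ ρ                    ≤⟨ *-monoˡ-≤ (a ^ ρ) 2≤a ⟩
          a ^ suc ρ                    ∎
          where open ≤-Reasoning
        collide : (∃ λ (s : ℕ → ℕ) →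
            (∀ i → i < suc (X ^ len) → b ≤ s i × s i + L ≤ b + a ^ suc ρ * L × g (s i + L) ≤ g (s i) + a ^ (κ + suc β)) ×
            (∀ i j → i < j → j < suc (X ^ len) → s i < s j)) →
          Located M (suc k) (a ^ (κ + suc ρ)) (a ^ ξ″) b
        collide (s , block , s-mono) = finish (pigeonhole-vec (n<1+n (X ^ len)) (λ i → code (sub i)) codes<)
          where
          block′ : ∀ (i : Fin (suc (X ^ len))) → _
          block′ i = block (toℕ i) (Fin.toℕ<n i)
          sub : ∀ (i : Fin (suc (X ^ len))) → Located M k L (a ^ ξ) (s (toℕ i))
          sub i = rec a (s (toℕ i)) 2≤a (proj₂ (proj₂ (block′ i)))
          codes< : ∀ i → All (_< X) (code (sub i))
          codes< i = code< (sub i) (^-monoʳ-≤ a (≤-trans (m≤n+m ξ (κ + suc β)) (n≤1+n _)))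
            (^-monoʳ-< a 2≤a (s≤s (≤-trans (m≤m+n κ (suc β)) (m≤m+n _ ξ)))) (^-monoʳ-< a 2≤a (s≤s (m≤m+n (κ + suc β) ξ)))
            (proj₂ (proj₂ (block′ i)))
          finish : (∃₂ λ i j → i Fin.< j × code (sub i) ≡ code (sub j)) → Located M (suc k) (a ^ (κ + suc ρ)) (a ^ ξ″) b
          finish (i , j , i<j , same) = join (sub i) (sub j) same (s-mono (toℕ i) (toℕ j) i<j (Fin.toℕ<n j))
            (proj₁ (block′ i)) (≤-trans (proj₁ (proj₂ (block′ j))) (≤-reflexive (cong (b +_) (sym L*r)))) total
            (^-monoʳ-< a 2≤a (s≤s (≤-trans (m≤m+n (κ + suc ρ) β) (m≤m+n _ ξ))))
            (^-monoʳ-< a 2≤a (s≤s (m≤m+n (κ + suc ρ + β) ξ)))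
            (^-monoʳ-≤ a (≤-trans (m≤n+m ξ (κ + suc ρ + β)) (n≤1+n _)))

-- Peeling, and polynomial functions on cubes

module Polynomials where

  open import Data.Integer.Base hiding (suc; pred)
  open import Data.Integer.Properties
  open import Data.Integer.Tactic.RingSolver using (solve-∀)
  open import Data.Nat.Base as ℕ using (_!)
  import Data.Nat.Properties as ℕ
  open import Data.Vec.Relation.Unary.All using (All; []; _∷_)
  open GraphCubes

  -- Peeling off the polynomial part

  sumTo : (ℕ → ℤ) → ℕ → ℤ
  sumTo g zero = 0ℤ
  sumTo g (suc n) = sumTo g n + g n

  falling : ℕ → ℤ → ℤ
  falling zero x = 1ℤ
  falling (suc l) x = x * falling l (x - 1ℤ)

  *-falling : ∀ l x → x * falling l x ≡ falling (suc l) x + + l * falling l x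
  *-falling zero x = trans (*-identityʳ x) (sym (trans (+-identityʳ _) (*-identityʳ x)))
  *-falling (suc l) x = begin
    x * (x * F)                                  ≡⟨ expand x F ⟩
    x * ((x - 1ℤ) * F + F)                       ≡⟨ cong (λ z → x * (z + F)) (*-falling l (x - 1ℤ)) ⟩
    x * (falling (suc l) (x - 1ℤ) + + l * F + F) ≡⟨ collect x F (+ l) (falling (suc l) (x - 1ℤ)) ⟩
    falling (suc (suc l)) x + + suc l * (x * F)  ∎
    where
    open ≡-Reasoning
    F = falling l (x - 1ℤ)
    expand : ∀ x F → x * (x * F) ≡ x * ((x - 1ℤ) * F + F)
    expand = solve-∀
    collect : ∀ x F l G → x * (G + l * F + F) ≡ x * G + (1ℤ + l) * (x * F)
    collect = solve-∀

  -- Coefficients are listed from the leading one downwards.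
  horner : (ℕ → ℤ) → ℕ → ℤ → ℤ
  horner c zero x = c 0
  horner c (suc i) x = x * horner c i x + c (suc i)

  -- In the sequel v x = u m + z, and coeff c u v i l z is the coefficient of
  -- falling l m in vⁱ · horner c i x.
  coeff : (ℕ → ℤ) → ℤ → ℤ → ℕ → ℕ → ℤ → ℤ
  coeff c u v zero zero z = c 0
  coeff c u v zero (suc l) z = 0ℤ
  coeff c u v (suc i) zero z = z * coeff c u v i zero z + v ^ suc i * c (suc i)
  coeff c u v (suc i) (suc l) z =
    z * coeff c u v i (suc l) z + u * (coeff c u v i l z + + suc l * coeff c u v i (suc l) z)

  remainder : ℕ → (ℕ → ℕ → ℤ) → ℕ → ℤ
  remainder d Y m = sumTo (λ l → Y l (l ℕ.+ m)) d

  -- With q m = falling l (m - 1) · Y m, the difference m q(m) - q(m + 1) equals falling (l + 1) m ·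
  -- Y m - falling l m · Y (m + 1): one degree in m is traded for a shift of Y. In the end only a
  -- shifted Y is left, which `remainder` collects.
  quotient₁ : ℕ → (ℕ → ℤ) → ℕ → ℤ
  quotient₁ zero Y m = 0ℤ
  quotient₁ (suc l) Y m = falling l (+ m - 1ℤ) * Y m + quotient₁ l (Y ∘ suc) m

  quotient : ℕ → (ℕ → ℕ → ℤ) → ℕ → ℤ
  quotient d Y m = sumTo (λ l → quotient₁ l (Y l) m) d

  module _ (c : ℕ → ℤ) (u v : ℤ) where

    coeff-zero : ∀ {i l} z → i ℕ.< l → coeff c u v i l z ≡ 0ℤ
    coeff-zero {zero} {suc l} z _ = refl
    coeff-zero {suc i} {suc l} z (s≤s i<l)
      rewrite coeff-zero {i} {l} z i<l | coeff-zero {i} {suc l} z (ℕ.m≤n⇒m≤1+n i<l) = alg z u (+ suc l)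
      where
      alg : ∀ z u k → z * 0ℤ + u * (0ℤ + k * 0ℤ) ≡ 0ℤ
      alg = solve-∀

    private
      -- Cutting the sum at an arbitrary n makes induction possible; the price is a boundary term
      -- with `coeff c u v i n z`, which disappears at n = i + 1.
      sum-coeff : ∀ m z i n → sumTo (λ l → falling l m * coeff c u v (suc i) l z) (suc n) ≡
                  (u * m + z) * sumTo (λ l → falling l m * coeff c u v i l z) n +
                  falling n m * (z + u * + n) * coeff c u v i n z + v ^ suc i * c (suc i)
      sum-coeff m z i zero = alg z (coeff c u v i 0 z) (v ^ suc i * c (suc i)) u m
        where
        alg : ∀ z y k u m → 0ℤ + 1ℤ * (z * y + k) ≡ (u * m + z) * 0ℤ + 1ℤ * (z + u * 0ℤ) * y + k
        alg = solve-∀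
      sum-coeff m z i (suc n) = begin
        sumTo (λ l → falling l m * coeff c u v (suc i) l z) (suc n) + F′ * (z * y′ + u * (y + + suc n * y′))
          ≡⟨ cong (_+ F′ * (z * y′ + u * (y + + suc n * y′))) (sum-coeff m z i n) ⟩
        (u * m + z) * Σ + F * (z + u * + n) * y + k + F′ * (z * y′ + u * (y + + suc n * y′))
          ≡⟨ alg₁ u m z Σ F (+ n) y k F′ y′ (+ suc n) ⟩
        (u * m + z) * Σ + z * (F * y) + u * ((F′ + + n * F) * y) + F′ * (z + u * + suc n) * y′ + k
          ≡⟨ cong (λ w → (u * m + z) * Σ + z * (F * y) + u * (w * y) + F′ * (z + u * + suc n) * y′ + k) (sym (*-falling n m)) ⟩
        (u * m + z) * Σ + z * (F * y) + u * ((m * F) * y) + F′ * (z + u * + suc n) * y′ + k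
          ≡⟨ alg₂ u m z Σ F y (F′ * (z + u * + suc n) * y′ + k) k (F′ * (z + u * + suc n) * y′) ⟩
        (u * m + z) * (Σ + F * y) + F′ * (z + u * + suc n) * y′ + k ∎
        where
        open ≡-Reasoning
        Σ = sumTo (λ l → falling l m * coeff c u v i l z) n
        F = falling n m
        F′ = falling (suc n) m
        y = coeff c u v i n z
        y′ = coeff c u v i (suc n) z
        k = v ^ suc i * c (suc i)
        alg₁ : ∀ u m z Σ F n y k F′ y′ n′ →
          (u * m + z) * Σ + F * (z + u * n) * y + k + F′ * (z * y′ + u * (y + n′ * y′)) ≡
          (u * m + z) * Σ + z * (F * y) + u * ((F′ + n * F) * y) + F′ * (z + u * n′) * y′ + k
        alg₁ = solve-∀
        alg₂ : ∀ u m z Σ F y w k w′ → (u * m + z) * Σ + z * (F * y) + u * ((m * F) * y) + w′ + k ≡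
          (u * m + z) * (Σ + F * y) + w′ + k
        alg₂ = solve-∀

    coeff-value : ∀ {m z x} → v * x ≡ u * m + z → ∀ i →
                  sumTo (λ l → falling l m * coeff c u v i l z) (suc i) ≡ v ^ i * horner c i x
    coeff-value eq zero = alg (c 0)
      where
      alg : ∀ k → 0ℤ + 1ℤ * k ≡ 1ℤ * k
      alg = solve-∀
    coeff-value {m} {z} {x} eq (suc i) = begin
      sumTo (λ l → falling l m * coeff c u v (suc i) l z) (suc (suc i))
        ≡⟨ sum-coeff m z i (suc i) ⟩
      (u * m + z) * sumTo (λ l → falling l m * coeff c u v i l z) (suc i) +
        falling (suc i) m * (z + u * + suc i) * coeff c u v i (suc i) z + v ^ suc i * c (suc i)
        ≡⟨ cong₂ (λ w y → w + falling (suc i) m * (z + u * + suc i) * y + v ^ suc i * c (suc i))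
             (cong₂ _*_ (sym eq) (coeff-value {m} {z} {x} eq i)) (coeff-zero {i} {suc i} z ℕ.≤-refl) ⟩
      v * x * (v ^ i * horner c i x) + falling (suc i) m * (z + u * + suc i) * 0ℤ + v * v ^ i * c (suc i)
        ≡⟨ alg v x (v ^ i) (horner c i x) (falling (suc i) m * (z + u * + suc i)) (c (suc i)) ⟩
      v * v ^ i * (x * horner c i x + c (suc i)) ∎
      where
      open ≡-Reasoning
      alg : ∀ v x w h f k → v * x * (w * h) + f * 0ℤ + v * w * k ≡ v * w * (x * h + k)
      alg = solve-∀

  quotient₁-eq : ∀ l Y m → + m * quotient₁ l Y m - quotient₁ l Y (suc m) ≡ falling l (+ m) * Y m - Y (l ℕ.+ m)
  quotient₁-eq zero Y m = alg (+ m) (Y m)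
    where
    alg : ∀ m y → m * 0ℤ - 0ℤ ≡ 1ℤ * y - y
    alg = solve-∀
  quotient₁-eq (suc l) Y m = begin
    + m * (F * Y m + q) - (falling l (+ suc m - 1ℤ) * Y (suc m) + q′)
      ≡⟨ cong (λ x → + m * (F * Y m + q) - (falling l x * Y (suc m) + q′)) (pred (+ m)) ⟩
    + m * (F * Y m + q) - (falling l (+ m) * Y (suc m) + q′)
      ≡⟨ alg₁ (+ m) F (Y m) q (falling l (+ m) * Y (suc m)) q′ ⟩
    + m * F * Y m + ((+ m * q - q′) - falling l (+ m) * Y (suc m))
      ≡⟨ cong (λ w → + m * F * Y m + (w - falling l (+ m) * Y (suc m))) (quotient₁-eq l (Y ∘ suc) m) ⟩
    + m * F * Y m + ((falling l (+ m) * Y (suc m) - Y (suc (l ℕ.+ m))) - falling l (+ m) * Y (suc m))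
      ≡⟨ alg₂ (+ m * F * Y m) (falling l (+ m) * Y (suc m)) (Y (suc (l ℕ.+ m))) ⟩
    + m * F * Y m - Y (suc (l ℕ.+ m)) ∎
    where
    open ≡-Reasoning
    F = falling l (+ m - 1ℤ)
    q = quotient₁ l (Y ∘ suc) m
    q′ = quotient₁ l (Y ∘ suc) (suc m)
    pred : ∀ m → 1ℤ + m - 1ℤ ≡ m
    pred = solve-∀
    alg₁ : ∀ m F y q w q′ → m * (F * y + q) - (w + q′) ≡ m * F * y + ((m * q - q′) - w)
    alg₁ = solve-∀
    alg₂ : ∀ a w y → a + ((w - y) - w) ≡ a - y
    alg₂ = solve-∀

  quotient-eq : ∀ d Y m → + m * quotient d Y m - quotient d Y (suc m) ≡
                sumTo (λ l → falling l (+ m) * Y l m) d - remainder d Y m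
  quotient-eq zero Y m = alg (+ m)
    where
    alg : ∀ m → m * 0ℤ - 0ℤ ≡ 0ℤ - 0ℤ
    alg = solve-∀
  quotient-eq (suc d) Y m = begin
    + m * (quotient d Y m + q) - (quotient d Y (suc m) + q′)       ≡⟨ alg₁ (+ m) (quotient d Y m) q (quotient d Y (suc m)) q′ ⟩
    (+ m * quotient d Y m - quotient d Y (suc m)) + (+ m * q - q′) ≡⟨ cong₂ _+_ (quotient-eq d Y m) (quotient₁-eq d (Y d) m) ⟩
    (A - B) + (falling d (+ m) * Y d m - Y d (d ℕ.+ m))            ≡⟨ alg₂ A B (falling d (+ m) * Y d m) (Y d (d ℕ.+ m)) ⟩
    (A + falling d (+ m) * Y d m) - (B + Y d (d ℕ.+ m))            ∎
    where
    open ≡-Reasoning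
    q = quotient₁ d (Y d) m
    q′ = quotient₁ d (Y d) (suc m)
    A = sumTo (λ l → falling l (+ m) * Y l m) d
    B = remainder d Y m
    alg₁ : ∀ m a q b q′ → m * (a + q) - (b + q′) ≡ (m * a - b) + (m * q - q′)
    alg₁ = solve-∀
    alg₂ : ∀ a b x y → (a - b) + (x - y) ≡ (a + x) - (b + y)
    alg₂ = solve-∀

  module Peel (c : ℕ → ℤ) (d : ℕ) (g : ℕ → ℕ) (T : ℕ → ℤ) (u v : ℤ) where

    Z : ℕ → ℤ
    Z m = v * + g m - u * + m

    Y : ℕ → ℕ → ℤ
    Y l m = coeff c u v d l (Z m)

    P s R : ℕ → ℤ
    P = quotient (suc d) Y
    s = remainder (suc d) Y
    R m = v ^ d * T m - P m

    R-eq : ∀ {m} → + m * T m - T (suc m) ≡ horner c d (+ g m) → + m * R m - R (suc m) ≡ s m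
    R-eq {m} T-eq = begin
      + m * (v ^ d * T m - P m) - (v ^ d * T (suc m) - P (suc m)) ≡⟨ alg₁ (+ m) (v ^ d) (T m) (P m) (T (suc m)) (P (suc m)) ⟩
      v ^ d * (+ m * T m - T (suc m)) - (+ m * P m - P (suc m))   ≡⟨ cong₂ (λ a b → v ^ d * a - b) T-eq (quotient-eq (suc d) Y m) ⟩
      v ^ d * horner c d (+ g m) - (sumTo (λ l → falling l (+ m) * Y l m) (suc d) - s m)
        ≡⟨ cong (λ a → v ^ d * horner c d (+ g m) - (a - s m)) (coeff-value c u v (vx (v * + g m) (u * + m)) d) ⟩
      v ^ d * horner c d (+ g m) - (v ^ d * horner c d (+ g m) - s m) ≡⟨ alg₂ (v ^ d * horner c d (+ g m)) (s m) ⟩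
      s m ∎
      where
      open ≡-Reasoning
      alg₁ : ∀ m w t p t′ p′ → m * (w * t - p) - (w * t′ - p′) ≡ w * (m * t - t′) - (m * p - p′)
      alg₁ = solve-∀
      alg₂ : ∀ a s → a - (a - s) ≡ s
      alg₂ = solve-∀
      vx : ∀ a b → a ≡ b + (a - b)
      vx = solve-∀

  -- Differences along the edges of a cube

  Box : ℕ → Set
  Box k = Vec (ℕ × ℕ) k

  OnVertices : ∀ {k} → Box k → ℕ → (ℕ → Set) → Set
  OnVertices [] n Q = Q n
  OnVertices ((Δ , _) ∷ vs) n Q = OnVertices vs n Q × OnVertices vs (n ℕ.+ Δ) Q

  onVertices-map : ∀ {k Q Q′} (vs : Box k) {n} → (∀ m → Q m → Q′ m) → OnVertices vs n Q → OnVertices vs n Q′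
  onVertices-map [] f q = f _ q
  onVertices-map (_ ∷ vs) f (q , q′) = onVertices-map vs f q , onVertices-map vs f q′

  onVertices-zip : ∀ {k Q Q′} (vs : Box k) {n} → OnVertices vs n Q → OnVertices vs n Q′ →
                   OnVertices vs n (λ m → Q m × Q′ m)
  onVertices-zip [] q r = q , r
  onVertices-zip (_ ∷ vs) (q , q′) (r , r′) = onVertices-zip vs q r , onVertices-zip vs q′ r′

  onVertices-all : ∀ {k Q} (vs : Box k) {n} → (∀ m → Q m) → OnVertices vs n Q
  onVertices-all [] q = q _
  onVertices-all (_ ∷ vs) q = onVertices-all vs q , onVertices-all vs q

  +-swap : ∀ n Δ Δ′ → n ℕ.+ Δ ℕ.+ Δ′ ≡ n ℕ.+ Δ′ ℕ.+ Δ
  +-swap n Δ Δ′ = trans (ℕ.+-assoc n Δ Δ′) (trans (cong (n ℕ.+_) (ℕ.+-comm Δ Δ′)) (sym (ℕ.+-assoc n Δ′ Δ)))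

  onVertices-translate : ∀ {k Q} (vs : Box k) {n Δ} → OnVertices vs (n ℕ.+ Δ) Q → OnVertices vs n (λ m → Q (m ℕ.+ Δ))
  onVertices-translate [] q = q
  onVertices-translate {Q = Q} ((Δ′ , _) ∷ vs) {n} {Δ} (q , q′) =
    onVertices-translate vs q , onVertices-translate vs (subst (λ z → OnVertices vs z Q) (+-swap n Δ Δ′) q′)

  diff : ℕ → (ℕ → ℤ) → ℕ → ℤ
  diff Δ G m = G (m ℕ.+ Δ) - G m

  alt : ∀ {k} → Box k → (ℕ → ℤ) → ℕ → ℤ
  alt [] G n = G n
  alt ((Δ , _) ∷ vs) G n = alt vs (diff Δ G) n

  -- Low k vs n G says that G has degree less than k on the cube.
  data Low (n : ℕ) : ∀ {j} → ℕ → Box j → (ℕ → ℤ) → Set where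
    zeros : ∀ {j G} {vs : Box j} → OnVertices vs n (λ m → G m ≡ 0ℤ) → Low n 0 vs G
    point : ∀ {k G} → Low n (suc k) [] G
    edge  : ∀ {j k Δ η G} {vs : Box j} → Low n k vs (diff Δ G) → Low n (suc k) vs G → Low n (suc k) ((Δ , η) ∷ vs) G

  module _ {n : ℕ} where

    low-suc : ∀ {k j} {vs : Box j} {G} → Low n k vs G → Low n (suc k) vs G
    low-suc {vs = []} (zeros z) = point
    low-suc {vs = (Δ , η) ∷ vs} (zeros (z , z′)) = edge
      (zeros (onVertices-map vs (λ m (e , e′) → cong₂ _-_ e e′) (onVertices-zip vs (onVertices-translate vs z′) z)))
      (low-suc (zeros z))
    low-suc point = point
    low-suc (edge l l′) = edge (low-suc l) (low-suc l′)

    low-mono : ∀ {k k′ j} {vs : Box j} {G} → k ℕ.≤ k′ → Low n k vs G → Low n k′ vs G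
    low-mono {k} {vs = vs} {G} k≤k′ l = go (ℕ.≤⇒≤′ k≤k′)
      where
      go : ∀ {k′} → k ℕ.≤′ k′ → Low n k′ vs G
      go ℕ.≤′-refl = l
      go (ℕ.≤′-step le) = low-suc (go le)

    low-cong₀ : ∀ {k j} {vs : Box j} {G H} → OnVertices vs n (λ m → G m ≡ H m) → Low n k vs G → Low n k vs H
    low-cong₀ {vs = vs} e (zeros z) = zeros (onVertices-map vs (λ m (e , e′) → trans (sym e) e′) (onVertices-zip vs e z))
    low-cong₀ e point = point
    low-cong₀ {vs = _ ∷ vs} (e , e′) (edge l l′) = edge
      (low-cong₀ (onVertices-map vs (λ m (e , e′) → cong₂ _-_ e e′) (onVertices-zip vs (onVertices-translate vs e′) e)) l)
      (low-cong₀ e l′)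

    low-cong : ∀ {k j} {vs : Box j} {G H} → (∀ m → G m ≡ H m) → Low n k vs G → Low n k vs H
    low-cong {vs = vs} e = low-cong₀ (onVertices-all vs e)

    low-0 : ∀ k {j} (vs : Box j) → Low n k vs (λ _ → 0ℤ)
    low-0 zero vs = zeros (onVertices-all vs (λ _ → refl))
    low-0 (suc k) [] = point
    low-0 (suc k) (_ ∷ vs) = edge (low-0 k vs) (low-0 (suc k) vs)

    low-const : ∀ {j} (vs : Box j) x → Low n 1 vs (λ _ → x)
    low-const [] x = point
    low-const (_ ∷ vs) x = edge (zeros (onVertices-all vs (λ _ → +-inverseʳ x))) (low-const vs x)

    low-+ : ∀ {k j} {vs : Box j} {G H} → Low n k vs G → Low n k vs H → Low n k vs (λ m → G m + H m)
    low-+ {vs = vs} (zeros z) (zeros z′) = zeros (onVertices-map vs (λ m (e , e′) → cong₂ _+_ e e′) (onVertices-zip vs z z′))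
    low-+ point point = point
    low-+ {G = G} {H} (edge {Δ = Δ} l₁ l₂) (edge l₁′ l₂′) = edge
      (low-cong (λ m → alg (G (m ℕ.+ Δ)) (G m) (H (m ℕ.+ Δ)) (H m)) (low-+ l₁ l₁′)) (low-+ l₂ l₂′)
      where
      alg : ∀ a b c d → (a - b) + (c - d) ≡ (a + c) - (b + d)
      alg = solve-∀

    low-*₀ : ∀ {j} {vs : Box j} {G} (H : ℕ → ℤ) → Low n 0 vs G → Low n 0 vs (λ m → G m * H m)
    low-*₀ {vs = vs} {G} H (zeros z) = zeros (onVertices-map vs zero-factor z)
      where
      zero-factor : ∀ m → G m ≡ 0ℤ → G m * H m ≡ 0ℤ
      zero-factor m e = trans (cong (_* H m) e) (*-zeroˡ (H m))

    -- Discrete Leibniz rule for degrees at most a and at most b. A difference of degree below 0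
    -- vanishes on the cube, whence the separate cases with `low-*₀`.
    low-* : ∀ {a b j} {vs : Box j} {G H} → Low n (suc a) vs G → Low n (suc b) vs H →
            Low n (suc (a ℕ.+ b)) vs (λ m → G m * H m)
    low-* point point = point
    low-* {a} {b} {vs = (Δ , η) ∷ vs} {G} {H} (edge l₁ l₂) (edge l₁′ l₂′) = edge
      (low-cong (λ m → alg (G (m ℕ.+ Δ)) (G m) (H (m ℕ.+ Δ)) (H m)) (low-+ (left l₁) (right l₁′)))
      (low-* l₂ l₂′)
      where
      alg : ∀ a b c d → (a - b) * (d + (c - d)) + b * (c - d) ≡ a * c - b * d
      alg = solve-∀
      left : ∀ {a} → Low n a vs (diff Δ G) → Low n (a ℕ.+ b) vs (λ m → diff Δ G m * (H m + diff Δ H m))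
      left {zero} l = low-mono z≤n (low-*₀ (λ m → H m + diff Δ H m) l)
      left {suc a} l = low-* l (low-+ l₂′ (low-suc l₁′))
      right : ∀ {b} → Low n b vs (diff Δ H) → Low n (a ℕ.+ b) vs (λ m → G m * diff Δ H m)
      right {zero} l = low-mono z≤n (low-cong (λ m → *-comm (diff Δ H m) (G m)) (low-*₀ G l))
      right {suc b} l = subst (λ k → Low n k vs (λ m → G m * diff Δ H m)) (sym (ℕ.+-suc a b)) (low-* l₂ l)

    low-*′ : ∀ {a b j} {vs : Box j} {G H} → Low n (suc a) vs G → Low n b vs H → Low n (a ℕ.+ b) vs (λ m → G m * H m)
    low-*′ {a} {zero} {G = G} {H} l l′ = low-mono z≤n (low-cong (λ m → *-comm (H m) (G m)) (low-*₀ G l′))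
    low-*′ {a} {suc b} {vs = vs} {G} {H} l l′ = subst (λ k → Low n k vs (λ m → G m * H m)) (sym (ℕ.+-suc a b)) (low-* l l′)

    low-scale : ∀ {k j} {vs : Box j} x {G} → Low n k vs G → Low n k vs (λ m → x * G m)
    low-scale {vs = vs} x l = low-*′ (low-const vs x) l

    -- `alt` takes one difference along each of the k edges, and each of them lowers the degree.
    alt-low : ∀ {k} {vs : Box k} {G} → Low n k vs G → alt vs G n ≡ 0ℤ
    alt-low {vs = []} (zeros z) = z
    alt-low (edge l _) = alt-low l

    alt-cong : ∀ {k} (vs : Box k) {G H} → OnVertices vs n (λ m → G m ≡ H m) → alt vs G n ≡ alt vs H n
    alt-cong [] e = e
    alt-cong (_ ∷ vs) (e , e′) = alt-cong vs
      (onVertices-map vs (λ m (e , e′) → cong₂ _-_ e e′) (onVertices-zip vs (onVertices-translate vs e′) e))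

    alt-+ : ∀ {k} (vs : Box k) G H → alt vs (λ m → G m + H m) n ≡ alt vs G n + alt vs H n
    alt-+ [] G H = refl
    alt-+ ((Δ , _) ∷ vs) G H = trans
      (alt-cong vs (onVertices-all vs λ m → alg (G (m ℕ.+ Δ)) (G m) (H (m ℕ.+ Δ)) (H m))) (alt-+ vs (diff Δ G) (diff Δ H))
      where
      alg : ∀ a b c d → (a + c) - (b + d) ≡ (a - b) + (c - d)
      alg = solve-∀

    alt-scale : ∀ {k} (vs : Box k) x G → alt vs (λ m → x * G m) n ≡ x * alt vs G n
    alt-scale [] x G = refl
    alt-scale ((Δ , _) ∷ vs) x G = trans
      (alt-cong vs (onVertices-all vs λ m → alg x (G (m ℕ.+ Δ)) (G m))) (alt-scale vs x (diff Δ G))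
      where
      alg : ∀ x a b → x * a - x * b ≡ x * (a - b)
      alg = solve-∀

    Affine : ∀ {k} → Box k → (ℕ → ℤ) → (ℕ × ℕ → ℤ) → Set
    Affine [] G slope = ⊤
    Affine ((Δ , η) ∷ vs) G slope =
      OnVertices vs n (λ m → G (m ℕ.+ Δ) ≡ G m + slope (Δ , η)) × Affine vs G slope

    low-affine : ∀ {k} (vs : Box k) {G slope} → Affine vs G slope → Low n 2 vs G
    low-affine [] _ = point
    low-affine ((Δ , η) ∷ vs) {G} {slope} (e , a) = edge
      (low-cong₀ (onVertices-map vs (λ m e → sym (trans (cong (_- G m) e) (alg (G m) (slope (Δ , η))))) e)
        (low-const vs (slope (Δ , η)))) (low-affine vs a)
      where
      alg : ∀ a b → a + b - a ≡ b
      alg = solve-∀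

    low-*-affine : ∀ {k j} (vs : Box j) {G H slope} → Affine vs G slope → Low n k vs H → Low n (suc k) vs (λ m → G m * H m)
    low-*-affine vs a l = low-*′ (low-affine vs a) l

    low-^ : ∀ k {j} (vs : Box j) {G slope} → Affine vs G slope → Low n (suc k) vs (λ m → G m ^ k)
    low-^ zero vs a = low-const vs 1ℤ
    low-^ (suc k) vs a = low-*-affine vs a (low-^ k vs a)

    product : ∀ {k} → Box k → (ℕ × ℕ → ℤ) → ℤ
    product [] slope = 1ℤ
    product (v ∷ vs) slope = slope v * product vs slope

    -- The terms of (x + a)^(k + 1) - x^(k + 1) beyond the one linear in a. The recursion shows the
    -- degree in x to be below k without binomial coefficients.
    power-error : ℤ → ℕ → ℤ → ℤ
    power-error a zero x = 0ℤ
    power-error a (suc k) x = (x + a) * power-error a k x + + suc k * (a * a) * x ^ k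

    power-error-eq : ∀ a k x → (x + a) ^ suc k - x ^ suc k ≡ + suc k * a * x ^ k + power-error a k x
    power-error-eq a zero x = alg x a
      where
      alg : ∀ x a → (x + a) * 1ℤ - x * 1ℤ ≡ 1ℤ * a * 1ℤ + 0ℤ
      alg = solve-∀
    power-error-eq a (suc k) x = begin
      (x + a) * (x + a) ^ suc k - x * x ^ suc k
        ≡⟨ alg₁ x a ((x + a) ^ suc k) (x ^ suc k) ⟩
      (x + a) * ((x + a) ^ suc k - x ^ suc k) + a * x ^ suc k
        ≡⟨ cong (λ w → (x + a) * w + a * x ^ suc k) (power-error-eq a k x) ⟩
      (x + a) * (+ suc k * a * x ^ k + power-error a k x) + a * (x * x ^ k)
        ≡⟨ alg₂ x a (+ suc k) (x ^ k) (power-error a k x) ⟩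
      (1ℤ + + suc k) * a * (x * x ^ k) + ((x + a) * power-error a k x + + suc k * (a * a) * x ^ k) ∎
      where
      open ≡-Reasoning
      alg₁ : ∀ x a w y → (x + a) * w - x * y ≡ (x + a) * (w - y) + a * y
      alg₁ = solve-∀
      alg₂ : ∀ x a k y e → (x + a) * (k * a * y + e) + a * (x * y) ≡ (1ℤ + k) * a * (x * y) + ((x + a) * e + k * (a * a) * y)
      alg₂ = solve-∀

    low-power-error : ∀ a k {j} (vs : Box j) {G slope} → Affine vs G slope → Low n k vs (λ m → power-error a k (G m))
    low-power-error a zero vs _ = low-0 0 vs
    low-power-error a (suc k) vs {G} aff = low-+
      (low-*′ (low-+ (low-affine vs aff) (low-suc (low-const vs a))) (low-power-error a k vs aff))
      (low-scale (+ suc k * (a * a)) (low-^ k vs aff))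

    -- Along the first edge the power k + 1 of G becomes (k + 1) a Gᵏ plus terms of degree below k,
    -- which the other k edges annihilate.
    alt-^ : ∀ {k} (vs : Box k) {G slope} → Affine vs G slope → alt vs (λ m → G m ^ k) n ≡ + (k !) * product vs slope
    alt-^ [] _ = refl
    alt-^ {suc k} ((Δ , η) ∷ vs) {G} {slope} (e , aff) = begin
      alt vs (λ m → G (m ℕ.+ Δ) ^ suc k - G m ^ suc k) n
        ≡⟨ alt-cong vs (onVertices-map vs (λ m e → trans (cong (λ w → w ^ suc k - G m ^ suc k) e) (power-error-eq a k (G m))) e) ⟩
      alt vs (λ m → + suc k * a * G m ^ k + power-error a k (G m)) n
        ≡⟨ alt-+ vs (λ m → + suc k * a * G m ^ k) (λ m → power-error a k (G m)) ⟩
      alt vs (λ m → + suc k * a * G m ^ k) n + alt vs (λ m → power-error a k (G m)) n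
        ≡⟨ cong₂ _+_ (trans (alt-scale vs (+ suc k * a) (λ m → G m ^ k)) (cong (+ suc k * a *_) (alt-^ vs aff)))
             (alt-low (low-power-error a k vs aff)) ⟩
      + suc k * a * (+ (k !) * product vs slope) + 0ℤ
        ≡⟨ alg (+ suc k) a (+ (k !)) (product vs slope) ⟩
      + suc k * + (k !) * (a * product vs slope)
        ≡⟨ cong (_* (a * product vs slope)) (sym (pos-* (suc k) (k !))) ⟩
      + (suc k !) * (a * product vs slope) ∎
      where
      open ≡-Reasoning
      a = slope (Δ , η)
      alg : ∀ k a f p → k * a * (f * p) + 0ℤ ≡ k * f * (a * p)
      alg = solve-∀

    affine-position : ∀ {k} (vs : Box k) x → Affine vs (λ m → + m - x) (λ v → + proj₁ v)
    affine-position [] x = tt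
    affine-position ((Δ , η) ∷ vs) x = onVertices-all vs (λ m → alg (+ m) (+ Δ) x) , affine-position vs x
      where
      alg : ∀ m Δ x → m + Δ - x ≡ m - x + Δ
      alg = solve-∀

    low-falling : ∀ l {k} (vs : Box k) x → Low n (suc l) vs (λ m → falling l (+ m - x))
    low-falling zero vs x = low-const vs 1ℤ
    low-falling (suc l) vs x = low-cong (λ m → cong (λ w → (+ m - x) * falling l w) (alg (+ m) x))
      (low-*-affine vs (affine-position vs x) (low-falling l vs (x + 1ℤ)))
      where
      alg : ∀ m x → m - (x + 1ℤ) ≡ m - x - 1ℤ
      alg = solve-∀

    module _ (c : ℕ → ℤ) (u v : ℤ) where

      -- `coeff c u v i l` has degree at most i - l in z; the inequality states i - l < k without
      -- subtraction.
      low-coeff : ∀ i l k {j} (vs : Box j) {G slope} → Affine vs G slope → suc i ℕ.≤ k ℕ.+ l →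
                  Low n k vs (λ m → coeff c u v i l (G m))
      low-coeff i l zero vs {G} aff i<l = low-cong (λ m → sym (coeff-zero c u v (G m) i<l)) (low-0 0 vs)
      low-coeff zero zero (suc k) vs aff _ = low-mono (s≤s z≤n) (low-const vs (c 0))
      low-coeff zero (suc l) (suc k) vs aff _ = low-0 (suc k) vs
      low-coeff (suc i) zero (suc k) vs aff (s≤s i<k) = low-+
        (low-*-affine vs aff (low-coeff i 0 k vs aff i<k))
        (low-mono (s≤s z≤n) (low-const vs (v ^ suc i * c (suc i))))
      low-coeff (suc i) (suc l) (suc k) vs {G} aff (s≤s i<k) = low-+
        (low-*-affine vs aff (low-coeff i (suc l) k vs aff i<k))
        (low-scale u (low-+ (low-coeff i l (suc k) vs aff (subst (suc i ℕ.≤_) (ℕ.+-suc k l) i<k))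
          (low-scale (+ suc l) (low-coeff i (suc l) (suc k) vs aff (ℕ.m≤n⇒m≤1+n i<k)))))

      low-coeff-top : ∀ i {j} (vs : Box j) {G slope} → Affine vs G slope →
                      Low n i vs (λ m → coeff c u v i 0 (G m) - c 0 * G m ^ i)
      low-coeff-top zero vs aff = low-cong (λ m → sym (alg (c 0))) (low-0 0 vs)
        where
        alg : ∀ x → x - x * 1ℤ ≡ 0ℤ
        alg = solve-∀
      low-coeff-top (suc i) vs {G} aff = low-cong
        (λ m → alg (G m) (coeff c u v i 0 (G m)) (c 0) (G m ^ i) (v ^ suc i * c (suc i)))
        (low-+ (low-*-affine vs aff (low-coeff-top i vs aff))
          (low-mono (s≤s z≤n) (low-const vs (v ^ suc i * c (suc i)))))
        where
        alg : ∀ z y k w x → z * (y - k * w) + x ≡ z * y + x - k * (z * w)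
        alg = solve-∀

    low-quotient₁ : ∀ l κ d {j} (vs : Box j) {W} → (∀ i → i ℕ.< l → Low n κ vs (λ m → W (i ℕ.+ m))) → l ℕ.+ κ ℕ.≤ suc d →
                    Low n d vs (quotient₁ l W)
    low-quotient₁ zero κ d vs _ _ = low-0 d vs
    low-quotient₁ (suc l) κ d vs low l+κ≤ = low-+
      (low-mono (ℕ.≤-pred l+κ≤) (low-*′ (low-falling l vs 1ℤ) (low 0 (s≤s z≤n))))
      (low-quotient₁ l κ d vs (λ i i<l → low (suc i) (s≤s i<l)) (ℕ.m≤n⇒m≤1+n (ℕ.≤-pred l+κ≤)))

    low-sumTo : ∀ k {j} (vs : Box j) {F : ℕ → ℕ → ℤ} N → (∀ l → l ℕ.< N → Low n k vs (F l)) → Low n k vs (λ m → sumTo (λ l → F l m) N)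
    low-sumTo k vs zero _ = low-0 k vs
    low-sumTo k vs (suc N) low = low-+ (low-sumTo k vs N λ l l<N → low l (ℕ.m≤n⇒m≤1+n l<N)) (low N ℕ.≤-refl)

    module _ (c : ℕ → ℤ) (d : ℕ) (g : ℕ → ℕ) (T : ℕ → ℤ) (u v : ℤ) {k} (vs : Box k) {slope : ℕ × ℕ → ℤ} where
      open Peel c d g T u v

      -- Z and the position both count as degree one. Each term falling l m · Y l m has total degree
      -- at most d, and peeling takes one factor m away.
      low-P : (∀ i → i ℕ.≤ d → Affine vs (λ m → Z (i ℕ.+ m)) slope) → Low n d vs P
      low-P aff = low-sumTo d vs (suc d) λ l l≤d → low-quotient₁ l (suc d ℕ.∸ l) d vs
        (λ i i<l → low-coeff c u v d l (suc d ℕ.∸ l) vs (aff i (ℕ.≤-trans (ℕ.<⇒≤ i<l) (ℕ.≤-pred l≤d)))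
                     (ℕ.≤-reflexive (sym (ℕ.m∸n+n≡m (ℕ.<⇒≤ l≤d)))))
        (ℕ.≤-reflexive (ℕ.m+[n∸m]≡n (ℕ.<⇒≤ l≤d)))

      -- Among the summands of s only Y 0 reaches degree d, and only through its leading term.
      low-s : (∀ i → i ℕ.≤ d → Affine vs (λ m → Z (i ℕ.+ m)) slope) → Low n d vs (λ m → s m - c 0 * Z m ^ d)
      low-s aff = go d ℕ.≤-refl
        where
        go : ∀ N → N ℕ.≤ d → Low n d vs (λ m → sumTo (λ l → Y l (l ℕ.+ m)) (suc N) - c 0 * Z m ^ d)
        go zero _ = low-cong (λ m → sym (cong (_- c 0 * Z m ^ d) (+-identityˡ (Y 0 m)))) (low-coeff-top c u v d vs (aff 0 z≤n))
        go (suc N) N<d = low-cong (λ m → alg (sumTo (λ l → Y l (l ℕ.+ m)) (suc N)) (c 0 * Z m ^ d) (Y (suc N) (suc N ℕ.+ m)))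
          (low-+ (go N (ℕ.<⇒≤ N<d)) (low-coeff c u v d (suc N) d vs (aff (suc N) N<d)
            (subst (suc d ℕ.≤_) (sym (ℕ.+-suc d N)) (s≤s (ℕ.m≤m+n d N)))))
          where
          alg : ∀ a b y → a - b + y ≡ a + y - b
          alg = solve-∀

      alt-s : k ≡ d → (∀ i → i ℕ.≤ d → Affine vs (λ m → Z (i ℕ.+ m)) slope) →
              alt vs s n ≡ c 0 * (+ (d !) * product vs slope)
      alt-s refl aff = begin
        alt vs s n                                                          ≡⟨ alt-cong vs (onVertices-all vs λ m → alg (s m) (c 0 * Z m ^ d)) ⟩
        alt vs (λ m → (s m - c 0 * Z m ^ d) + c 0 * Z m ^ d) n              ≡⟨ alt-+ vs (λ m → s m - c 0 * Z m ^ d) (λ m → c 0 * Z m ^ d) ⟩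
        alt vs (λ m → s m - c 0 * Z m ^ d) n + alt vs (λ m → c 0 * Z m ^ d) n
          ≡⟨ cong₂ _+_ (alt-low (low-s aff)) (trans (alt-scale vs (c 0) (λ m → Z m ^ d)) (cong (c 0 *_) (alt-^ vs (aff 0 z≤n)))) ⟩
        0ℤ + c 0 * (+ (d !) * product vs slope)                             ≡⟨ +-identityˡ _ ⟩
        c 0 * (+ (d !) * product vs slope)                                  ∎
        where
        open ≡-Reasoning
        alg : ∀ a b → a ≡ (a - b) + b
        alg = solve-∀

  -- Faces of a cube

  data _⊑_ {A : Set} : ∀ {k n} → Vec A k → Vec A n → Set where
    []   : [] ⊑ []
    skip : ∀ {k n x} {xs : Vec A k} {ys : Vec A n} → xs ⊑ ys → xs ⊑ (x ∷ ys)
    keep : ∀ {k n x} {xs : Vec A k} {ys : Vec A n} → xs ⊑ ys → (x ∷ xs) ⊑ (x ∷ ys)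

  []⊑ : ∀ {A : Set} {n} (xs : Vec A n) → [] ⊑ xs
  []⊑ [] = []
  []⊑ (x ∷ xs) = skip ([]⊑ xs)

  all-⊑ : ∀ {A : Set} {Q : A → Set} {k n} {xs : Vec A k} {ys : Vec A n} → xs ⊑ ys → All Q ys → All Q xs
  all-⊑ [] [] = []
  all-⊑ (skip sub) (_ ∷ qs) = all-⊑ sub qs
  all-⊑ (keep sub) (q ∷ qs) = q ∷ all-⊑ sub qs

  split-⊑ : ∀ {A : Set} {Q Q′ : A → Set} → (∀ x → Q x ⊎ Q′ x) → ∀ i j {n} (xs : Vec A n) → i ℕ.+ j ℕ.≤ suc n →
            (∃ λ (ys : Vec A i) → ys ⊑ xs × All Q ys) ⊎ (∃ λ (ys : Vec A j) → ys ⊑ xs × All Q′ ys)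
  split-⊑ Q? zero j xs _ = inj₁ ([] , []⊑ xs , [])
  split-⊑ Q? (suc i) zero xs _ = inj₂ ([] , []⊑ xs , [])
  split-⊑ Q? (suc i) (suc j) [] (s≤s le) with () ← subst (ℕ._≤ 0) (ℕ.+-suc i j) le
  split-⊑ Q? (suc i) (suc j) (x ∷ xs) (s≤s le) with Q? x
  ... | inj₁ q with split-⊑ Q? i (suc j) xs le
  ...   | inj₁ (ys , sub , qs) = inj₁ (x ∷ ys , keep sub , q ∷ qs)
  ...   | inj₂ (ys , sub , qs) = inj₂ (ys , skip sub , qs)
  split-⊑ Q? (suc i) (suc j) (x ∷ xs) (s≤s le) | inj₂ q with split-⊑ Q? (suc i) j xs (ℕ.≤-trans (ℕ.≤-reflexive (sym (ℕ.+-suc i j))) le)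
  ...   | inj₁ (ys , sub , qs) = inj₁ (ys , skip sub , qs)
  ...   | inj₂ (ys , sub , qs) = inj₂ (x ∷ ys , keep sub , q ∷ qs)

  module CubeFaces (g : ℕ → ℕ) (g-< : ∀ n → g n ℕ.< g (suc n)) where
    open Cubes g g-<

    cube-⊑ : ∀ {M k j} {ws : Box k} {vs : Box j} {n} → ws ⊑ vs → Cube M vs n → Cube M ws n
    cube-⊑ [] _ = tt
    cube-⊑ (skip sub) (cube , _) = cube-⊑ sub cube
    cube-⊑ (keep sub) (cube , cube′ , shift) = cube-⊑ sub cube , cube-⊑ sub cube′ , shift

    -- `Cube` records the shift along the first edge at the base vertex only; it reaches the other
    -- vertices because opposite faces have the same edges.
    cube-shift : ∀ {M k} (vs : Box k) {n Δ η} → Cube M ((Δ , η) ∷ vs) n →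
                 OnVertices vs n (λ m → ∀ j → j ℕ.≤ M → g (m ℕ.+ Δ ℕ.+ j) ≡ g (m ℕ.+ j) ℕ.+ η)
    cube-shift [] (_ , _ , shift) = shift
    cube-shift {M} ((Δ′ , η′) ∷ vs) {n} {Δ} {η} ((c , c′ , sh) , (d , d′ , sh′) , shift) =
      cube-shift vs (c , d , shift) , cube-shift vs (c′ , subst (Cube M vs) (+-swap n Δ Δ′) d′ , shift′)
      where
      shift′ : ∀ j → j ℕ.≤ M → g (n ℕ.+ Δ′ ℕ.+ Δ ℕ.+ j) ≡ g (n ℕ.+ Δ′ ℕ.+ j) ℕ.+ η
      shift′ j j≤M = begin
        g (n ℕ.+ Δ′ ℕ.+ Δ ℕ.+ j)      ≡⟨ cong (λ z → g (z ℕ.+ j)) (+-swap n Δ′ Δ) ⟩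
        g (n ℕ.+ Δ ℕ.+ Δ′ ℕ.+ j)      ≡⟨ sh′ j j≤M ⟩
        g (n ℕ.+ Δ ℕ.+ j) ℕ.+ η′      ≡⟨ cong (ℕ._+ η′) (shift j j≤M) ⟩
        g (n ℕ.+ j) ℕ.+ η ℕ.+ η′      ≡⟨ +-swap (g (n ℕ.+ j)) η η′ ⟩
        g (n ℕ.+ j) ℕ.+ η′ ℕ.+ η      ≡⟨ cong (ℕ._+ η) (sym (sh j j≤M)) ⟩
        g (n ℕ.+ Δ′ ℕ.+ j) ℕ.+ η      ∎
        where open ≡-Reasoning

    slope : ℤ → ℤ → ℕ × ℕ → ℤ
    slope u v (Δ , η) = v * + η - u * + Δ

    affine-Z : ∀ {M k} (vs : Box k) {n} → Cube M vs n → ∀ u v i → i ℕ.≤ M →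
               Affine {n} vs (λ m → v * + g (i ℕ.+ m) - u * + (i ℕ.+ m)) (slope u v)
    affine-Z [] _ u v i _ = tt
    affine-Z {M} ((Δ , η) ∷ vs) {n} cube u v i i≤M =
      onVertices-map vs step (cube-shift vs cube) , affine-Z vs (proj₁ cube) u v i i≤M
      where
      step : ∀ m → (∀ j → j ℕ.≤ M → g (m ℕ.+ Δ ℕ.+ j) ≡ g (m ℕ.+ j) ℕ.+ η) →
        v * + g (i ℕ.+ (m ℕ.+ Δ)) - u * + (i ℕ.+ (m ℕ.+ Δ)) ≡ v * + g (i ℕ.+ m) - u * + (i ℕ.+ m) + (v * + η - u * + Δ)
      step m shift = begin
        v * + g (i ℕ.+ (m ℕ.+ Δ)) - u * + (i ℕ.+ (m ℕ.+ Δ))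
          ≡⟨ cong₂ (λ a b → v * + a - u * + b)
               (trans (cong g (ℕ.+-comm i (m ℕ.+ Δ))) (trans (shift i i≤M) (cong (λ z → g z ℕ.+ η) (ℕ.+-comm m i))))
               (sym (ℕ.+-assoc i m Δ)) ⟩
        v * + (g (i ℕ.+ m) ℕ.+ η) - u * + (i ℕ.+ m ℕ.+ Δ)
          ≡⟨ cong₂ (λ a b → v * a - u * b) (pos-+ (g (i ℕ.+ m)) η) (pos-+ (i ℕ.+ m) Δ) ⟩
        v * (+ g (i ℕ.+ m) + + η) - u * (+ (i ℕ.+ m) + + Δ)
          ≡⟨ alg u v (+ g (i ℕ.+ m)) (+ η) (+ (i ℕ.+ m)) (+ Δ) ⟩
        v * + g (i ℕ.+ m) - u * + (i ℕ.+ m) + (v * + η - u * + Δ) ∎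
        where
        open ≡-Reasoning
        alg : ∀ u v a b m Δ → v * (a + b) - u * (m + Δ) ≡ v * a - u * m + (v * b - u * Δ)
        alg = solve-∀

-- Sizes, backward recurrences and divided differences

module Recurrences where

  open import Data.Integer.Base hiding (suc; pred; _≤_; _<_; _≥_; _>_; NonZero; >-nonZero; ≢-nonZero)
  import Data.Integer.Properties as ℤ
  open import Data.Integer.Tactic.RingSolver using (solve-∀)
  open import Data.Nat.Base as ℕ using (_≤_; _<_; NonZero; >-nonZero; ≢-nonZero)
  open import Data.Nat.Properties as ℕ using
    (≤-trans; ≤-refl; ≤-reflexive; ≤-pred; <⇒≤; ≰⇒>; n≤1+n; m≤m+n; m≤n+m; m≤n⇒m≤1+n; +-assoc; +-comm; +-mono-≤; +-monoˡ-≤;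
     +-monoʳ-≤; *-mono-≤; *-monoˡ-≤; *-monoʳ-≤; ^-monoˡ-≤; ^-monoʳ-≤; m^n≢0)
  import Data.Nat.Tactic.RingSolver as ℕSolver
  open import Data.Vec.Membership.Propositional using (_∈_)
  open import Data.Vec.Relation.Unary.All as All using (All; []; _∷_)
  open import Data.Vec.Relation.Unary.Any using (here; there)
  open Primes using (n<q^n; ^-distribʳ-*)
  open GraphCubes
  open Polynomials

  -- Orders of magnitude

  -- A fixed power of a counts as small, whereas N will exceed any prescribed power of a.
  record Bd (a N e i : ℕ) (x : ℤ) : Set where
    constructor bd
    field bound : ∣ x ∣ ≤ a ℕ.^ e ℕ.* N ℕ.^ i

  open Bd public

  reach : ∀ {k} → Box k → ℕ
  reach [] = 0
  reach ((Δ , _) ∷ vs) = reach vs ℕ.+ Δ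

  module Sizes {a N : ℕ} (2≤a : 2 ≤ a) (1≤N : 1 ≤ N) where

    instance
      a≢0 : NonZero a
      a≢0 = >-nonZero (ℕ.<-trans z<s 2≤a)
      N≢0 : NonZero N
      N≢0 = >-nonZero 1≤N

    size-mono : ∀ {e e′ i i′} → e ≤ e′ → i ≤ i′ → a ℕ.^ e ℕ.* N ℕ.^ i ≤ a ℕ.^ e′ ℕ.* N ℕ.^ i′
    size-mono e≤ i≤ = *-mono-≤ (^-monoʳ-≤ a e≤) (^-monoʳ-≤ N i≤)

    Bd-mono : ∀ {e e′ i i′ x} → e ≤ e′ → i ≤ i′ → Bd a N e i x → Bd a N e′ i′ x
    Bd-mono e≤ i≤ (bd b) = bd (≤-trans b (size-mono e≤ i≤))

    Bd-≤ : ∀ {e i x y} → ∣ y ∣ ≤ ∣ x ∣ → Bd a N e i x → Bd a N e i y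
    Bd-≤ le (bd b) = bd (≤-trans le b)

    Bd-neg : ∀ {e i x} → Bd a N e i x → Bd a N e i (- x)
    Bd-neg {x = x} (bd b) = bd (≤-trans (≤-reflexive (ℤ.∣-i∣≡∣i∣ x)) b)

    double : ∀ e i → a ℕ.^ e ℕ.* N ℕ.^ i ℕ.+ a ℕ.^ e ℕ.* N ℕ.^ i ≤ a ℕ.^ suc e ℕ.* N ℕ.^ i
    double e i = begin
      A ℕ.+ A             ≡⟨ cong (A ℕ.+_) (sym (ℕ.+-identityʳ A)) ⟩
      2 ℕ.* A             ≤⟨ *-monoˡ-≤ A 2≤a ⟩
      a ℕ.* A             ≡⟨ ℕ.*-assoc a (a ℕ.^ e) (N ℕ.^ i) ⟨
      a ℕ.^ suc e ℕ.* N ℕ.^ i ∎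
      where
      open ℕ.≤-Reasoning
      A = a ℕ.^ e ℕ.* N ℕ.^ i

    Bd-+ : ∀ {e e′ i x y} → Bd a N e i x → Bd a N e′ i y → Bd a N (suc (e ℕ.+ e′)) i (x + y)
    Bd-+ {e} {e′} {i} {x} {y} (bd b) (bd b′) = bd (≤-trans (ℤ.∣i+j∣≤∣i∣+∣j∣ x y)
      (≤-trans (+-mono-≤ (≤-trans b (size-mono {i = i} {i} (m≤m+n e e′) ≤-refl)) (≤-trans b′ (size-mono {i = i} {i} (m≤n+m e′ e) ≤-refl)))
        (double (e ℕ.+ e′) i)))

    Bd-minus : ∀ {e e′ i x y} → Bd a N e i x → Bd a N e′ i y → Bd a N (suc (e ℕ.+ e′)) i (x - y)
    Bd-minus b b′ = Bd-+ b (Bd-neg b′)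

    Bd-* : ∀ {e e′ i i′ x y} → Bd a N e i x → Bd a N e′ i′ y → Bd a N (e ℕ.+ e′) (i ℕ.+ i′) (x * y)
    Bd-* {e} {e′} {i} {i′} {x} {y} (bd b) (bd b′) = bd (begin
      ∣ x * y ∣                                               ≡⟨ ℤ.abs-* x y ⟩
      ∣ x ∣ ℕ.* ∣ y ∣                                         ≤⟨ *-mono-≤ b b′ ⟩
      (a ℕ.^ e ℕ.* N ℕ.^ i) ℕ.* (a ℕ.^ e′ ℕ.* N ℕ.^ i′)       ≡⟨ swap (a ℕ.^ e) (N ℕ.^ i) (a ℕ.^ e′) (N ℕ.^ i′) ⟩
      (a ℕ.^ e ℕ.* a ℕ.^ e′) ℕ.* (N ℕ.^ i ℕ.* N ℕ.^ i′)       ≡⟨ cong₂ ℕ._*_ (ℕ.^-distribˡ-+-* a e e′) (ℕ.^-distribˡ-+-* N i i′) ⟨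
      a ℕ.^ (e ℕ.+ e′) ℕ.* N ℕ.^ (i ℕ.+ i′)                   ∎)
      where
      open ℕ.≤-Reasoning
      swap : ∀ p q r s → (p ℕ.* q) ℕ.* (r ℕ.* s) ≡ (p ℕ.* r) ℕ.* (q ℕ.* s)
      swap = ℕSolver.solve-∀

    Bd-0 : ∀ {e i} → Bd a N e i 0ℤ
    Bd-0 = bd z≤n

    Bd-1 : Bd a N 0 0 1ℤ
    Bd-1 = bd ≤-refl

    Bd-^ : ∀ {e i x} k → Bd a N e i x → Bd a N (k ℕ.* e) (k ℕ.* i) (x ^ k)
    Bd-^ zero b = Bd-1
    Bd-^ (suc k) b = Bd-* b (Bd-^ k b)

    Bd-ℕ : ∀ n → Bd a N n 0 (+ n)
    Bd-ℕ n = bd (≤-trans (<⇒≤ (n<q^n 2≤a n)) (≤-reflexive (sym (ℕ.*-identityʳ _))))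

    Bd-sumTo : ∀ {e i G} n → (∀ l → l < n → Bd a N e i (G l)) → Bd a N (n ℕ.+ e) i (sumTo G n)
    Bd-sumTo zero _ = Bd-0
    Bd-sumTo {e} {i} {G} (suc n) b = bd (≤-trans (ℤ.∣i+j∣≤∣i∣+∣j∣ (sumTo G n) (G n))
      (≤-trans (+-mono-≤ (bound (Bd-sumTo n λ l l<n → b l (m≤n⇒m≤1+n l<n)))
                             (≤-trans (bound (b n ≤-refl)) (size-mono {i = i} {i} (m≤n+m e n) ≤-refl)))
        (double (n ℕ.+ e) i)))

    Bd-alt : ∀ {e i k} (vs : Box k) {G n} → (∀ m → n ≤ m → m ≤ n ℕ.+ reach vs → Bd a N e i (G m)) →
             Bd a N (k ℕ.+ e) i (alt vs G n)
    Bd-alt {e} {i} [] b = b _ ≤-refl (m≤m+n _ 0)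
    Bd-alt {e} {i} {suc k} ((Δ , _) ∷ vs) {G} {n} b = subst (λ e → Bd a N e i (alt vs (diff Δ G) n)) (ℕ.+-suc k e)
      (Bd-alt {suc e} vs λ m n≤m m≤ → bd (≤-trans (ℤ.∣i-j∣≤∣i∣+∣j∣ (G (m ℕ.+ Δ)) (G m))
        (≤-trans (+-mono-≤
          (bound (b (m ℕ.+ Δ) (≤-trans n≤m (m≤m+n m Δ)) (≤-trans (+-monoˡ-≤ Δ m≤) (≤-reflexive (+-assoc n (reach vs) Δ)))))
          (bound (b m n≤m (≤-trans m≤ (+-monoʳ-≤ n (m≤m+n (reach vs) Δ)))))) (double e i))))

    Bd-divide : ∀ {e i m r x} → N ≤ m → + m * r ≡ x → Bd a N e (suc i) x → Bd a N e i r
    Bd-divide {e} {i} {m} {r} {x} N≤m eq (bd b) = bd (ℕ.*-cancelˡ-≤ N (begin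
      N ℕ.* ∣ r ∣                        ≤⟨ *-monoˡ-≤ ∣ r ∣ N≤m ⟩
      m ℕ.* ∣ r ∣                        ≡⟨ ℤ.abs-* (+ m) r ⟨
      ∣ + m * r ∣                        ≡⟨ cong ∣_∣ eq ⟩
      ∣ x ∣                              ≤⟨ b ⟩
      a ℕ.^ e ℕ.* (N ℕ.* N ℕ.^ i)        ≡⟨ swap (a ℕ.^ e) N (N ℕ.^ i) ⟩
      N ℕ.* (a ℕ.^ e ℕ.* N ℕ.^ i)        ∎))
      where
      open ℕ.≤-Reasoning
      swap : ∀ p q r → p ℕ.* (q ℕ.* r) ≡ q ℕ.* (p ℕ.* r)
      swap = ℕSolver.solve-∀

    -- Integrality: a nonzero r would give |x| ≥ m ≥ N.
    multiple-small⇒0 : ∀ {e m r x} → a ℕ.^ e < N → N ≤ m → + m * r ≡ x → Bd a N e 0 x → r ≡ 0ℤ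
    multiple-small⇒0 {e} {m} {r} {x} small N≤m eq (bd b) with ∣ r ∣ ℕ.≟ 0
    ... | yes ∣r∣≡0 = ℤ.∣i∣≡0⇒i≡0 ∣r∣≡0
    ... | no ∣r∣≢0 = contradiction (begin-strict
      ∣ x ∣                ≤⟨ b ⟩
      a ℕ.^ e ℕ.* 1        ≡⟨ ℕ.*-identityʳ (a ℕ.^ e) ⟩
      a ℕ.^ e              <⟨ small ⟩
      N                    ≤⟨ N≤m ⟩
      m                    ≤⟨ ℕ.m≤m*n m ∣ r ∣ {{≢-nonZero ∣r∣≢0}} ⟩
      m ℕ.* ∣ r ∣          ≡⟨ ℤ.abs-* (+ m) r ⟨
      ∣ + m * r ∣          ≡⟨ cong ∣_∣ eq ⟩
      ∣ x ∣                ∎) (ℕ.<-irrefl refl)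
      where open ℕ.≤-Reasoning

    solve-step : ∀ {m r r′ s} → + m * r - r′ ≡ s → + m * r ≡ s + r′
    solve-step {m} {r} {r′} eq = trans (alg (+ m * r) r′) (cong (_+ r′) eq)
      where
      alg : ∀ x y → x ≡ x - y + y
      alg = solve-∀

  -- In R m = (s m + R (m + 1)) / m every backward step divides the far value by at least N, until
  -- the contribution of s dominates. Thus a crude bound far out suffices, and E depends neither on
  -- a nor on N.
  descend : ∀ J i e → ∃ λ E → ∀ {a N} → 2 ≤ a → 1 ≤ N → ∀ {R s : ℕ → ℤ} {m} →
    (∀ m′ → m ≤ m′ → m′ ≤ m ℕ.+ J → N ≤ m′ × + m′ * R m′ - R (suc m′) ≡ s m′ × Bd a N e (suc i) (s m′)) →
    Bd a N e (i ℕ.+ suc J) (R (suc (m ℕ.+ J))) → Bd a N E i (R m)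
  descend zero i e = _ , λ {a} {N} 2≤a 1≤N {R} {s} {m} hyp b →
    let open Sizes 2≤a 1≤N
        N≤m , eq , bs = hyp m ≤-refl (m≤m+n m 0)
    in Bd-divide N≤m (solve-step {m} {R m} eq) (Bd-+ bs (subst₂ (λ j m → Bd a N e j (R (suc m))) (+-comm i 1) (ℕ.+-identityʳ m) b))
  descend (suc J) i e with descend J (suc i) e
  ... | E , rec = _ , λ {a} {N} 2≤a 1≤N {R} {s} {m} hyp b →
    let open Sizes 2≤a 1≤N
        N≤m , eq , bs = hyp m ≤-refl (m≤m+n m (suc J))
        b′ = rec 2≤a 1≤N {R} {s} {suc m}
          (λ m′ m< m′≤ → let N≤m′ , eq′ , bs′ = hyp m′ (<⇒≤ m<) (≤-trans m′≤ (≤-reflexive (sym (ℕ.+-suc m J)))) in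
             N≤m′ , eq′ , Bd-mono ≤-refl (n≤1+n (suc i)) bs′)
          (subst₂ (λ j m → Bd a N e j (R (suc m))) (ℕ.+-suc i (suc J)) (ℕ.+-suc m J) b)
    in Bd-divide N≤m (solve-step {m} {R m} eq) (Bd-+ bs b′)

  Nodes : ∀ {k} → ℕ → Vec ℕ k → Set
  Nodes x₀ [] = ℕ
  Nodes x₀ (x ∷ xs) = x₀ < x × Nodes x xs

  -- Divided differences of x ↦ F j x gain a factor 1/N each, and can be computed
  -- without division by letting the weights w absorb the denominators.
  module Interpolation {a N : ℕ} (2≤a : 2 ≤ a) (1≤N : 1 ≤ N) where
    open Sizes 2≤a 1≤N

    -- F j x stands for R, or an iterated difference of it over the nodes, at offset j from the node
    -- x. The right-hand side splits into a weight of the node and a factor of the offset.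
    record System (e i J : ℕ) (X : ℕ → Set) (F : ℕ → ℕ → ℤ) (s : ℕ → ℤ) (w : ℕ → ℤ) : Set where
      field
        large    : ∀ {x} → X x → N ≤ x
        weight≢0 : ∀ {x} → X x → w x ≢ 0ℤ
        weight   : ∀ {x} → X x → Bd a N e 0 (w x)
        gaps     : ∀ {x y} → X x → X y → Bd a N e 0 (+ x - + y)
        equation : ∀ {x} → X x → ∀ j → j < J → + (j ℕ.+ x) * F j x - F (suc j) x ≡ w x * s j
        size     : ∀ {x} → X x → ∀ j → j ≤ J → Bd a N e i (F j x)

  -- This and the other exponents ending in `-exp` are what the size lemmas yield; all are fixed
  -- before a and N.
  elim-exp : ℕ → ℕ
  elim-exp e = suc (((e ℕ.+ e) ℕ.+ e) ℕ.+ suc ((e ℕ.+ e) ℕ.+ (e ℕ.+ e)))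

  open Interpolation

  module Eliminate {a N e i J : ℕ} (2≤a : 2 ≤ a) (1≤N : 1 ≤ N) {X X′ : ℕ → Set} {F s w} (sys : System 2≤a 1≤N e i J X F s w)
                   {x₀} (Xx₀ : X x₀) (X′⊆X : ∀ {x} → X′ x → X x) (distinct : ∀ {x} → X′ x → x ≢ x₀) where
    open Sizes 2≤a 1≤N
    open System sys

    G : ℕ → ℕ → ℤ
    G j x = w x₀ * F j x - w x * F j x₀

    s′ w′ : ℕ → ℤ
    s′ j = - F j x₀
    w′ x = w x * (+ x - + x₀)

    -- Combining the equations at x and x₀ crosswise cancels s j. The multipliers j + x and j + x₀
    -- differ by x - x₀, so F j x₀ itself becomes the new source.
    equation′ : ∀ {x} → X x → ∀ j → j < J → + (j ℕ.+ x) * G j x - G (suc j) x ≡ w′ x * s′ j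
    equation′ {x} Xx j j<J = begin
      + (j ℕ.+ x) * G j x - G (suc j) x
        ≡⟨ cong (λ z → z * G j x - G (suc j) x) (ℤ.pos-+ j x) ⟩
      (+ j + + x) * (w x₀ * F j x - w x * F j x₀) - (w x₀ * F (suc j) x - w x * F (suc j) x₀)
        ≡⟨ alg₁ (+ j) (+ x) (+ x₀) (w x₀) (w x) (F j x) (F j x₀) (F (suc j) x) (F (suc j) x₀) ⟩
      w x₀ * ((+ j + + x) * F j x - F (suc j) x) - w x * ((+ j + + x₀) * F j x₀ - F (suc j) x₀) + w x * (+ x - + x₀) * - F j x₀
        ≡⟨ cong₂ (λ p q → w x₀ * p - w x * q + w′ x * s′ j) (lemma Xx) (lemma Xx₀) ⟩
      w x₀ * (w x * s j) - w x * (w x₀ * s j) + w′ x * s′ j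
        ≡⟨ alg₂ (w x₀) (w x) (s j) (w′ x * s′ j) ⟩
      w′ x * s′ j ∎
      where
      open ≡-Reasoning
      lemma : ∀ {y} → X y → (+ j + + y) * F j y - F (suc j) y ≡ w y * s j
      lemma {y} Xy = trans (cong (λ z → z * F j y - F (suc j) y) (sym (ℤ.pos-+ j y))) (equation Xy j j<J)
      alg₁ : ∀ j x y u v f g f′ g′ → (j + x) * (u * f - v * g) - (u * f′ - v * g′) ≡
             u * ((j + x) * f - f′) - v * ((j + y) * g - g′) + v * (x - y) * - g
      alg₁ = solve-∀
      alg₂ : ∀ u v s t → u * (v * s) - v * (u * s) + t ≡ t
      alg₂ = solve-∀

    size-G : ∀ {x} → X x → ∀ j → j ≤ J → Bd a N (suc ((e ℕ.+ e) ℕ.+ (e ℕ.+ e))) i (G j x)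
    size-G Xx j j≤J = Bd-minus (Bd-* (weight Xx₀) (size Xx j j≤J)) (Bd-* (weight Xx) (size Xx₀ j j≤J))

    e′ = elim-exp e

    w′≢0 : ∀ {x} → X′ x → w′ x ≢ 0ℤ
    w′≢0 {x} X′x eq with ℤ.i*j≡0⇒i≡0∨j≡0 (w x) eq
    ... | inj₁ wx≡0 = weight≢0 (X′⊆X X′x) wx≡0
    ... | inj₂ x≡x₀ = distinct X′x (ℤ.+-injective (ℤ.i-j≡0⇒i≡j (+ x) (+ x₀) x≡x₀))

    product≡ : ∀ {x} → X x → ∀ j → j < J → + (j ℕ.+ x) * G j x ≡ w′ x * s′ j + G (suc j) x
    product≡ {x} Xx j j<J = solve-step {j ℕ.+ x} {G j x} (equation′ Xx j j<J)

    size-product : ∀ {x} → X x → ∀ j → j < J → Bd a N e′ i (w′ x * s′ j + G (suc j) x)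
    size-product Xx j j<J = Bd-+ (Bd-* (Bd-* (weight Xx) (gaps Xx Xx₀)) (Bd-neg (size Xx₀ j (<⇒≤ j<J)))) (size-G Xx (suc j) j<J)

    vanish : i ≡ 0 → a ℕ.^ e′ < N → ∀ {x} → X x → ∀ j → j < J → G j x ≡ 0ℤ
    vanish refl a^e′<N Xx j j<J =
      multiple-small⇒0 a^e′<N (≤-trans (large Xx) (m≤n+m _ j)) (product≡ Xx j j<J) (size-product Xx j j<J)

    -- The way back: once G vanishes at two successive offsets, so does its source w′ x · s′ j, a
    -- nonzero multiple of F j x₀.
    F₀≡0 : ∀ {x} → X′ x → ∀ j → j < J → G j x ≡ 0ℤ → G (suc j) x ≡ 0ℤ → F j x₀ ≡ 0ℤ
    F₀≡0 {x} X′x j j<J G≡0 G′≡0 with ℤ.i*j≡0⇒i≡0∨j≡0 (w′ x) (trans (sym (equation′ (X′⊆X X′x) j j<J))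
        (trans (cong₂ (λ p q → + (j ℕ.+ x) * p - q) G≡0 G′≡0) (alg (+ (j ℕ.+ x)))))
      where
      alg : ∀ x → x * 0ℤ - 0ℤ ≡ 0ℤ
      alg = solve-∀
    ... | inj₁ w≡0 = contradiction w≡0 (w′≢0 X′x)
    ... | inj₂ -F≡0 = ℤ.neg-injective -F≡0

  -- Solving the equation of G for G j x divides by j + x ≥ N: the exponent i drops by one at the
  -- cost of one offset.
  reduced : ∀ {a N e i J} (2≤a : 2 ≤ a) (1≤N : 1 ≤ N) {X X′ : ℕ → Set} {F s w} (sys : System 2≤a 1≤N e (suc i) (suc J) X F s w)
            {x₀} (Xx₀ : X x₀) (X′⊆X : ∀ {x} → X′ x → X x) (distinct : ∀ {x} → X′ x → x ≢ x₀) →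
            let open Eliminate 2≤a 1≤N sys Xx₀ X′⊆X distinct in System 2≤a 1≤N e′ i J X′ G s′ w′
  reduced {e = e} 2≤a 1≤N {X} {X′} sys {x₀} Xx₀ X′⊆X distinct = record
    { large = large ∘ X′⊆X
    ; weight≢0 = w′≢0
    ; weight = λ X′x → Bd-mono (≤-trans (+-monoˡ-≤ e (m≤m+n e e)) (≤-trans (m≤m+n _ _) (n≤1+n _))) ≤-refl
                 (Bd-* (weight (X′⊆X X′x)) (gaps (X′⊆X X′x) Xx₀))
    ; gaps = λ X′x X′y → Bd-mono (≤-trans (m≤n+m e (e ℕ.+ e)) (≤-trans (m≤m+n _ _) (n≤1+n _))) ≤-refl
               (gaps (X′⊆X X′x) (X′⊆X X′y))
    ; equation = λ X′x j j<J → equation′ (X′⊆X X′x) j (m≤n⇒m≤1+n j<J)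
    ; size = λ X′x j j≤J → Bd-divide (≤-trans (large (X′⊆X X′x)) (m≤n+m _ j)) (product≡ (X′⊆X X′x) j (s≤s j≤J))
               (size-product (X′⊆X X′x) j (s≤s j≤J))
    }
    where
    open Sizes 2≤a 1≤N
    open System sys
    open Eliminate 2≤a 1≤N sys Xx₀ X′⊆X distinct

  -- i eliminations bring the size from Nⁱ to N⁰, and one more gives zero; hence i + 2 nodes. Each
  -- of the i eliminations costs one offset on the way down and one on the way back, and t + 2 are
  -- left for the last.
  interpolation : ∀ i t e → ∃ λ E → ∀ {a N} (2≤a : 2 ≤ a) (1≤N : 1 ≤ N) → a ℕ.^ E < N →
    ∀ {X : ℕ → Set} {F s w} x₀ (xs : Vec ℕ (suc i)) → X x₀ → (∀ {x} → x ∈ xs → X x) → Nodes x₀ xs →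
    System 2≤a 1≤N e i (suc (suc (t ℕ.+ (i ℕ.+ i)))) X F s w → ∀ j → j ≤ t → F j x₀ ≡ 0ℤ
  interpolation zero t e = elim-exp e , λ { 2≤a 1≤N small {X} x₀ (x₁ ∷ []) Xx₀ Xxs (x₀<x₁ , _) sys j j≤t →
    let included : ∀ {x} → x ≡ x₁ → X x
        included = λ x≡x₁ → subst X (sym x≡x₁) (Xxs (here refl))
        distinct : ∀ {x} → x ≡ x₁ → x ≢ x₀
        distinct = λ x≡x₁ x≡x₀ → ℕ.>⇒≢ x₀<x₁ (trans (sym x≡x₁) x≡x₀)
        open Eliminate 2≤a 1≤N {X′ = _≡ x₁} sys {x₀} Xx₀ included distinct
        j<J = s≤s (≤-trans j≤t (≤-trans (≤-reflexive (sym (ℕ.+-identityʳ t))) (n≤1+n _)))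
    in F₀≡0 refl j j<J (vanish refl small (Xxs (here refl)) j j<J)
        (vanish refl small (Xxs (here refl)) (suc j) (s≤s (s≤s (≤-trans j≤t (≤-reflexive (sym (ℕ.+-identityʳ t))))))) }
  interpolation (suc i) t e with interpolation i (suc t) (elim-exp e)
  ... | E , rec = E , λ { 2≤a 1≤N small {X} {F} {s} {w} x₀ (x₁ ∷ xs) Xx₀ Xxs (x₀<x₁ , nodes) sys j j≤t →
    let X′⊆X : ∀ {x} → X x × x₀ < x → X x
        X′⊆X = proj₁
        distinct : ∀ {x} → X x × x₀ < x → x ≢ x₀
        distinct = λ (_ , x₀<x) → ℕ.>⇒≢ x₀<x
        sys′ = subst (λ J → System 2≤a 1≤N e (suc i) (suc (suc J)) X F s w) (trans (cong (t ℕ.+_) (cong suc (ℕ.+-suc i i))) (trans (ℕ.+-suc t (suc (i ℕ.+ i))) (cong suc (ℕ.+-suc t (i ℕ.+ i))))) sys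
        open Eliminate 2≤a 1≤N {X′ = λ x → X x × x₀ < x} sys′ {x₀} Xx₀ X′⊆X distinct
        G≡0 = rec 2≤a 1≤N small {X = λ x → X x × x₀ < x} x₁ xs (Xxs (here refl) , x₀<x₁)
                (λ x∈ → Xxs (there x∈) , ℕ.<-trans x₀<x₁ (above x₁ xs nodes x∈)) nodes (reduced 2≤a 1≤N sys′ Xx₀ X′⊆X distinct)
    in F₀≡0 (Xxs (here refl) , x₀<x₁) j (s≤s (m≤n⇒m≤1+n (m≤n⇒m≤1+n (m≤n⇒m≤1+n (≤-trans j≤t (m≤m+n t (i ℕ.+ i))))))) (G≡0 j (m≤n⇒m≤1+n j≤t)) (G≡0 (suc j) (s≤s j≤t)) }
    where
    above : ∀ {k} x₁ (xs : Vec ℕ k) → Nodes x₁ xs → ∀ {x} → x ∈ xs → x₁ < x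
    above x₁ (y ∷ ys) (x₁<y , _) (here refl) = x₁<y
    above x₁ (y ∷ ys) (x₁<y , nodes) (there x∈) = ℕ.<-trans x₁<y (above y ys nodes x∈)

  -- Sizes of the peeled sequences

  coeff-exp : ℕ → ℕ → ℕ → ℕ
  coeff-exp e zero l = e
  coeff-exp e (suc i) zero = suc ((e ℕ.+ coeff-exp e i zero) ℕ.+ (suc i ℕ.* e ℕ.+ e))
  coeff-exp e (suc i) (suc l) = suc ((e ℕ.+ coeff-exp e i (suc l)) ℕ.+
    (e ℕ.+ suc (coeff-exp e i l ℕ.+ (suc l ℕ.+ coeff-exp e i (suc l)))))

  coeff-exp′ : ℕ → ℕ → ℕ → ℕ
  coeff-exp′ e zero l = suc (e ℕ.+ 0 ℕ.+ (e ℕ.+ suc (coeff-exp e 0 l ℕ.+ (suc l ℕ.+ coeff-exp e 0 (suc l)))))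
  coeff-exp′ e (suc i) l = suc ((e ℕ.+ coeff-exp′ e i l) ℕ.+ (e ℕ.+ suc (coeff-exp e (suc i) l ℕ.+ (suc l ℕ.+ coeff-exp e (suc i) (suc l)))))

  top-exp : ℕ → ℕ → ℕ
  top-exp e zero = suc (1 ℕ.* e ℕ.+ e)
  top-exp e (suc i) = suc ((e ℕ.+ top-exp e i) ℕ.+ (suc (suc i) ℕ.* e ℕ.+ e))

  module Coefficients {a N : ℕ} (2≤a : 2 ≤ a) (1≤N : 1 ≤ N) {e : ℕ} {c : ℕ → ℤ} {u v : ℤ} (small-c : ∀ i → Bd a N e 0 (c i)) where
    open Sizes 2≤a 1≤N

    Bd-coeff : Bd a N e 1 u → Bd a N e 1 v → ∀ i l {z} → Bd a N e 1 z → Bd a N (coeff-exp e i l) i (coeff c u v i l z)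
    Bd-coeff bu bv zero zero bz = small-c 0
    Bd-coeff bu bv zero (suc l) bz = Bd-0
    Bd-coeff bu bv (suc i) zero bz = Bd-+ (Bd-* bz (Bd-coeff bu bv i zero bz))
      (subst (λ j → Bd a N (suc i ℕ.* e ℕ.+ e) j (v ^ suc i * c (suc i))) (trans (ℕ.+-identityʳ (suc i ℕ.* 1)) (ℕ.*-identityʳ (suc i)))
        (Bd-* (Bd-^ (suc i) bv) (small-c (suc i))))
    Bd-coeff bu bv (suc i) (suc l) bz = Bd-+ (Bd-* bz (Bd-coeff bu bv i (suc l) bz))
      (Bd-* bu (Bd-+ (Bd-coeff bu bv i l bz) (Bd-* (Bd-ℕ (suc l)) (Bd-coeff bu bv i (suc l) bz))))

    private
      weaken : ∀ {x} → Bd a N e 0 x → Bd a N e 1 x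
      weaken = Bd-mono ≤-refl z≤n

    -- For u and v of size N⁰ only z carries a power of N, and above l = 0 the degree in z is at
    -- least one below the maximum. This sets the top term apart in `root-size`.
    Bd-coeff-suc : Bd a N e 0 u → Bd a N e 0 v → ∀ i l {z} → Bd a N e 1 z → Bd a N (coeff-exp′ e i l) i (coeff c u v (suc i) (suc l) z)
    Bd-coeff-suc bu bv zero l {z} bz = Bd-+ {x = z * 0ℤ} (subst (Bd a N (e ℕ.+ 0) 0) (sym (ℤ.*-zeroʳ z)) Bd-0)
      (Bd-* bu (Bd-+ (Bd-coeff (weaken bu) (weaken bv) 0 l bz) (Bd-* (Bd-ℕ (suc l)) (Bd-coeff (weaken bu) (weaken bv) 0 (suc l) bz))))
    Bd-coeff-suc bu bv (suc i) l bz = Bd-+ (Bd-* bz (Bd-coeff-suc bu bv i l bz))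
      (Bd-* bu (Bd-+ (Bd-coeff (weaken bu) (weaken bv) (suc i) l bz) (Bd-* (Bd-ℕ (suc l)) (Bd-coeff (weaken bu) (weaken bv) (suc i) (suc l) bz))))

    Bd-coeff-top : Bd a N e 0 v → ∀ i {z} → Bd a N e 1 z → Bd a N (top-exp e i) i (coeff c u v (suc i) 0 z - c 0 * z ^ suc i)
    Bd-coeff-top bv zero {z} bz = subst (Bd a N (top-exp e 0) 0) (alg z (c 0) (v ^ 1 * c 1))
      (Bd-mono (n≤1+n _) ≤-refl (Bd-* (Bd-^ 1 bv) (small-c 1)))
      where
      alg : ∀ z k x → x ≡ z * k + x - k * (z * 1ℤ)
      alg = solve-∀
    Bd-coeff-top bv (suc i) {z} bz = subst (Bd a N (top-exp e (suc i)) (suc i))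
      (alg z (coeff c u v (suc i) 0 z) (c 0) (z ^ suc i) (v ^ suc (suc i) * c (suc (suc i))))
      (Bd-+ (Bd-* bz (Bd-coeff-top bv i bz)) (Bd-mono ≤-refl z≤n
        (subst (λ j → Bd a N (suc (suc i) ℕ.* e ℕ.+ e) j (v ^ suc (suc i) * c (suc (suc i)))) (trans (ℕ.+-identityʳ (i ℕ.* 0)) (ℕ.*-zeroʳ i)) (Bd-* (Bd-^ (suc (suc i)) bv) (small-c (suc (suc i)))))))
      where
      alg : ∀ z y k w x → z * (y - k * w) + x ≡ z * y + x - k * (z * w)
      alg = solve-∀

  falling-exp : ℕ → ℕ → ℕ
  falling-exp e zero = 0
  falling-exp e (suc l) = e ℕ.+ falling-exp (suc (e ℕ.+ 0)) l

  quotient-exp : ℕ → ℕ → ℕ → ℕ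
  quotient-exp e e′ zero = 0
  quotient-exp e e′ (suc l) = suc ((falling-exp (suc (e ℕ.+ 0)) l ℕ.+ e′) ℕ.+ quotient-exp e e′ l)

  total : (ℕ → ℕ) → ℕ → ℕ
  total f zero = 0
  total f (suc n) = total f n ℕ.+ f n

  ≤total : ∀ f n {l} → l < n → f l ≤ total f n
  ≤total f (suc n) {l} (s≤s l≤n) with l ℕ.≟ n
  ... | yes refl = m≤n+m (f n) (total f n)
  ... | no l≢n = ≤-trans (≤total f n (ℕ.≤∧≢⇒< l≤n l≢n)) (m≤m+n (total f n) (f n))

  remainder-exp : ℕ → ℕ → ℕ
  remainder-exp e d = suc d ℕ.+ total (coeff-exp e d) (suc d)

  peel-exp : ℕ → ℕ → ℕ
  peel-exp e d = suc ((d ℕ.* e ℕ.+ e) ℕ.+ (suc d ℕ.+ total (λ l → quotient-exp e (coeff-exp e d l) l) (suc d)))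

  abs-^ : ∀ x k → ∣ x ^ k ∣ ≡ ∣ x ∣ ℕ.^ k
  abs-^ x zero = refl
  abs-^ x (suc k) = trans (ℤ.abs-* x (x ^ k)) (cong (∣ x ∣ ℕ.*_) (abs-^ x k))

  module Parts {a N : ℕ} (2≤a : 2 ≤ a) (1≤N : 1 ≤ N) where
    open Sizes 2≤a 1≤N

    Bd-pred : ∀ {e x} → Bd a N e 1 x → Bd a N (suc (e ℕ.+ 0)) 1 (x - 1ℤ)
    Bd-pred b = Bd-minus b (Bd-mono ≤-refl z≤n Bd-1)

    Bd-falling : ∀ l {e x} → Bd a N e 1 x → Bd a N (falling-exp e l) l (falling l x)
    Bd-falling zero b = Bd-1
    Bd-falling (suc l) b = Bd-* b (Bd-falling l (Bd-pred b))

    Bd-quotient₁ : ∀ l {e e′ i W m} → Bd a N e 1 (+ m) → (∀ j → j < l → Bd a N e′ i (W (j ℕ.+ m))) →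
                   Bd a N (quotient-exp e e′ l) (l ℕ.+ i) (quotient₁ l W m)
    Bd-quotient₁ zero bm bW = Bd-0
    Bd-quotient₁ (suc l) {W = W} bm bW = Bd-+ (Bd-mono ≤-refl (n≤1+n _) (Bd-* (Bd-falling l (Bd-pred bm)) (bW 0 z<s)))
      (Bd-mono ≤-refl (n≤1+n _) (Bd-quotient₁ l {W = W ∘ suc} bm λ j j<l → bW (suc j) (s≤s j<l)))

    module _ {e d : ℕ} {c : ℕ → ℤ} {g : ℕ → ℕ} {T : ℕ → ℤ} {u v : ℤ} (small-c : ∀ i → Bd a N e 0 (c i))
             (bu : Bd a N e 1 u) (bv : Bd a N e 1 v) where
      open Peel c d g T u v
      open Coefficients 2≤a 1≤N {e} {c} {u} {v} small-c

      Bd-s : ∀ {m} → (∀ l → l ≤ d → Bd a N e 1 (Z (l ℕ.+ m))) → Bd a N (remainder-exp e d) d (s m)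
      Bd-s bZ = Bd-sumTo (suc d) λ { l l<@(s≤s l≤d) → Bd-mono (≤total (coeff-exp e d) (suc d) l<) ≤-refl (Bd-coeff bu bv d l (bZ l l≤d)) }

      Bd-R : ∀ {m} → Bd a N e 1 (+ m) → (∀ l → l ≤ d → Bd a N e 1 (Z (l ℕ.+ m))) → Bd a N e d (T m) →
             Bd a N (peel-exp e d) (d ℕ.+ d) (R m)
      Bd-R {m} bm bZ bT = Bd-minus (Bd-* (subst (λ j → Bd a N (d ℕ.* e) j (v ^ d)) (ℕ.*-identityʳ d) (Bd-^ d bv)) bT)
        (Bd-sumTo (suc d) λ { l l<@(s≤s l≤d) → Bd-mono (≤total (λ l → quotient-exp e (coeff-exp e d l) l) (suc d) l<) (+-monoˡ-≤ d l≤d)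
          (Bd-quotient₁ l {W = Y l} bm λ j j<l → Bd-coeff bu bv d l (bZ j (≤-trans (<⇒≤ j<l) l≤d))) })

    power-small⇒0 : ∀ {e d m t} → a ℕ.^ e < N → N ≤ m → Bd a N e d ((+ m) ^ suc d * t) → t ≡ 0ℤ
    power-small⇒0 {e} {d} {m} {t} small N≤m (bd b) with ∣ t ∣ ℕ.≟ 0
    ... | yes ∣t∣≡0 = ℤ.∣i∣≡0⇒i≡0 ∣t∣≡0
    ... | no ∣t∣≢0 = contradiction (begin-strict
      ∣ (+ m) ^ suc d * t ∣             ≤⟨ b ⟩
      a ℕ.^ e ℕ.* N ℕ.^ d               <⟨ ℕ.*-monoˡ-< (N ℕ.^ d) {{m^n≢0 N d}} small ⟩
      N ℕ.^ suc d                       ≤⟨ ^-monoˡ-≤ (suc d) N≤m ⟩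
      m ℕ.^ suc d                       ≤⟨ ℕ.m≤m*n (m ℕ.^ suc d) ∣ t ∣ {{≢-nonZero ∣t∣≢0}} ⟩
      m ℕ.^ suc d ℕ.* ∣ t ∣             ≡⟨ cong (ℕ._* ∣ t ∣) (abs-^ (+ m) (suc d)) ⟨
      ∣ (+ m) ^ suc d ∣ ℕ.* ∣ t ∣       ≡⟨ ℤ.abs-* ((+ m) ^ suc d) t ⟨
      ∣ (+ m) ^ suc d * t ∣             ∎) (ℕ.<-irrefl refl)
      where
      open ℕ.≤-Reasoning

  onVertices-range : ∀ {k Q} (ws : Box k) {n} →
    (∀ m → n ≤ m → m ≤ n ℕ.+ reach ws → Q m) → OnVertices ws n Q
  onVertices-range [] q = q _ ≤-refl (m≤m+n _ 0)
  onVertices-range ((Δ , _) ∷ ws) {n} q =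
    onVertices-range ws (λ m n≤m m≤ → q m n≤m (≤-trans m≤ (+-monoʳ-≤ n (m≤m+n _ Δ)))) ,
    onVertices-range ws (λ m n≤m m≤ → q m (≤-trans (m≤m+n n Δ) n≤m)
      (≤-trans m≤ (≤-reflexive (trans (+-assoc n Δ _) (cong (n ℕ.+_) (+-comm Δ _))))))

  alt-suc : ∀ {k} (ws : Box k) G n → alt ws (G ∘ suc) n ≡ alt ws G (suc n)
  alt-suc [] G n = refl
  alt-suc ((Δ , _) ∷ ws) G n = alt-suc ws (diff Δ G) n


  onVertices-base : ∀ {k Q} (ws : Box k) {n} → OnVertices ws n Q → Q n
  onVertices-base [] q = q
  onVertices-base (_ ∷ ws) (q , _) = onVertices-base ws q

  large-product : ∀ {n k} B i {σ : ℕ × ℕ → ℤ} {ws : Box k} → All (λ v → B < ∣ σ v ∣ ℕ.^ i) ws →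
                  suc B ℕ.^ k ≤ ∣ product {n} ws σ ∣ ℕ.^ i
  large-product B i [] = ≤-reflexive (sym (ℕ.^-zeroˡ i))
  large-product {n} B i {σ} {v ∷ ws} (big ∷ bigs) = ≤-trans (*-mono-≤ big (large-product {n} B i bigs))
    (≤-reflexive (trans (sym (^-distribʳ-* i ∣ σ v ∣ ∣ product {n} ws σ ∣)) (cong (ℕ._^ i) (sym (ℤ.abs-* (σ v) (product {n} ws σ))))))

  ^-cancel-< : ∀ d {m n} → m ℕ.^ d < n ℕ.^ d → m < n
  ^-cancel-< d lt = ≰⇒> λ n≤m → ℕ.<⇒≱ lt (^-monoˡ-≤ d n≤m)


  -- The vertices met on the path that runs through the edges one after another, without its
  -- starting point.
  nodes : ∀ {k} → Box k → ℕ → Vec ℕ k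
  nodes [] n = []
  nodes ((Δ , _) ∷ ws) n = n ℕ.+ Δ ∷ nodes ws (n ℕ.+ Δ)

  sumTo-cong : ∀ {G H} n → (∀ l → l < n → G l ≡ H l) → sumTo G n ≡ sumTo H n
  sumTo-cong zero _ = refl
  sumTo-cong (suc n) eq = cong₂ _+_ (sumTo-cong n λ l l<n → eq l (m≤n⇒m≤1+n l<n)) (eq n ≤-refl)


  root-exp : ℕ → ℕ → ℕ → ℕ
  root-exp e d′ zero = top-exp e d′
  root-exp e d′ (suc n) = suc (root-exp e d′ n ℕ.+ coeff-exp′ e d′ n)

  -- If s vanishes then its top term c₀ zᵈ is as small as the terms of lower degree.
  root-size : ∀ d′ e e′ {a N} → 2 ≤ a → 1 ≤ N → ∀ {c u v} {z : ℕ → ℤ} → c 0 ≢ 0ℤ → (∀ i → Bd a N e 0 (c i)) → Bd a N e 0 u → Bd a N e 0 v →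
    (∀ l → l ≤ suc d′ → Bd a N e′ 0 (z l - z 0)) → sumTo (λ l → coeff c u v (suc d′) l (z l)) (suc (suc d′)) ≡ 0ℤ →
    Bd a N (root-exp e d′ (suc d′) ℕ.+ d′ ℕ.+ e′) 0 (z 0)
  root-size d′ e e′ {a} {N} 2≤a 1≤N {c} {u} {v} {z} c₀≢0 bc bu bv near sum≡0 = conclude (∣ z 0 ∣ ℕ.≤? a ℕ.^ e′)
    where
    d = suc d′
    A = root-exp e d′ d
    -- X takes the place of N in the size lemmas: every z l is at most X, while c, u and v are of
    -- size X⁰.
    X = ∣ z 0 ∣ ℕ.+ a ℕ.^ e′
    instance
      a≢0 : NonZero a
      a≢0 = >-nonZero (ℕ.<-trans z<s 2≤a)
    1≤X : 1 ≤ X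
    1≤X = ≤-trans (ℕ.m^n>0 a e′) (m≤n+m _ ∣ z 0 ∣)
    open Sizes 2≤a 1≤X
    constant : ∀ {e x} → Bd a N e 0 x → Bd a X e 0 x
    constant (bd b) = bd b
    bz : ∀ l → l ≤ d → Bd a X e 1 (z l)
    bz l l≤d = Bd-mono {e = 0} z≤n ≤-refl (bd (begin
      ∣ z l ∣                       ≡⟨ cong ∣_∣ (alg (z l) (z 0)) ⟩
      ∣ z 0 + (z l - z 0) ∣         ≤⟨ ℤ.∣i+j∣≤∣i∣+∣j∣ (z 0) (z l - z 0) ⟩
      ∣ z 0 ∣ ℕ.+ ∣ z l - z 0 ∣     ≤⟨ +-monoʳ-≤ ∣ z 0 ∣ (≤-trans (bound (near l l≤d)) (≤-reflexive (ℕ.*-identityʳ (a ℕ.^ e′)))) ⟩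
      X                             ≡⟨ trans (sym (ℕ.*-identityʳ X)) (sym (ℕ.*-identityˡ (X ℕ.* 1))) ⟩
      1 ℕ.* (X ℕ.* 1)               ∎))
      where
      open ℕ.≤-Reasoning
      alg : ∀ x y → x ≡ y + (x - y)
      alg = solve-∀
    open Coefficients 2≤a 1≤X {e} {c} {u} {v} (constant ∘ bc)
    partial : ∀ n → n ≤ d → Bd a X (root-exp e d′ n) d′ (sumTo (λ l → coeff c u v d l (z l)) (suc n) - c 0 * z 0 ^ d)
    partial zero _ = subst (λ x → Bd a X (top-exp e d′) d′ (x - c 0 * z 0 ^ d)) (sym (ℤ.+-identityˡ (coeff c u v d 0 (z 0)))) (Bd-coeff-top (constant bv) d′ (bz 0 z≤n))
    partial (suc n) n<d = subst (Bd a X (root-exp e d′ (suc n)) d′)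
      (alg (sumTo (λ l → coeff c u v d l (z l)) (suc n)) (c 0 * z 0 ^ d) (coeff c u v d (suc n) (z (suc n))))
      (Bd-+ (partial n (<⇒≤ n<d)) (Bd-coeff-suc (constant bu) (constant bv) d′ n (bz (suc n) n<d)))
      where
      alg : ∀ a b y → a - b + y ≡ a + y - b
      alg = solve-∀
    top : ∣ z 0 ∣ ℕ.^ d ≤ a ℕ.^ A ℕ.* X ℕ.^ d′
    top = begin
      ∣ z 0 ∣ ℕ.^ d                ≡⟨ abs-^ (z 0) d ⟨
      ∣ z 0 ^ d ∣                  ≤⟨ ℕ.m≤n*m _ ∣ c 0 ∣ {{≢-nonZero (c₀≢0 ∘ ℤ.∣i∣≡0⇒i≡0)}} ⟩
      ∣ c 0 ∣ ℕ.* ∣ z 0 ^ d ∣      ≡⟨ ℤ.abs-* (c 0) (z 0 ^ d) ⟨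
      ∣ c 0 * z 0 ^ d ∣            ≡⟨ ℤ.∣-i∣≡∣i∣ (c 0 * z 0 ^ d) ⟨
      ∣ - (c 0 * z 0 ^ d) ∣        ≡⟨ cong ∣_∣ (trans (sym (ℤ.+-identityˡ (- (c 0 * z 0 ^ d)))) (cong (_- c 0 * z 0 ^ d) (sym sum≡0))) ⟩
      ∣ sumTo (λ l → coeff c u v d l (z l)) (suc d) - c 0 * z 0 ^ d ∣ ≤⟨ bound (partial d ≤-refl) ⟩
      a ℕ.^ A ℕ.* X ℕ.^ d′         ∎
      where open ℕ.≤-Reasoning
    conclude : _ → Bd a N (A ℕ.+ d′ ℕ.+ e′) 0 (z 0)
    conclude (yes small) = bd (≤-trans small (≤-trans (^-monoʳ-≤ a (m≤n+m e′ (A ℕ.+ d′))) (≤-reflexive (sym (ℕ.*-identityʳ _)))))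
    conclude (no large) = bd (≤-trans z≤ (≤-trans (^-monoʳ-≤ a (m≤m+n (A ℕ.+ d′) e′)) (≤-reflexive (sym (ℕ.*-identityʳ _)))))
      where
      instance
        z≢0 : NonZero ∣ z 0 ∣
        z≢0 = >-nonZero (ℕ.≤-<-trans z≤n (≰⇒> large))
      -- Beyond a^e′ the quantities X and |z 0| agree up to a factor `a`, so that |z 0|^d′ can be
      -- cancelled from `top`.
      X≤ : X ≤ a ℕ.* ∣ z 0 ∣
      X≤ = ≤-trans (+-monoʳ-≤ ∣ z 0 ∣ (<⇒≤ (≰⇒> large)))
        (≤-trans (≤-reflexive (cong (∣ z 0 ∣ ℕ.+_) (sym (ℕ.+-identityʳ ∣ z 0 ∣)))) (*-monoˡ-≤ ∣ z 0 ∣ 2≤a))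
      z≤ : ∣ z 0 ∣ ≤ a ℕ.^ (A ℕ.+ d′)
      z≤ = ℕ.*-cancelʳ-≤ ∣ z 0 ∣ (a ℕ.^ (A ℕ.+ d′)) (∣ z 0 ∣ ℕ.^ d′) {{m^n≢0 ∣ z 0 ∣ d′}} (begin
        ∣ z 0 ∣ ℕ.* ∣ z 0 ∣ ℕ.^ d′                       ≤⟨ top ⟩
        a ℕ.^ A ℕ.* X ℕ.^ d′                             ≤⟨ *-monoʳ-≤ (a ℕ.^ A) (^-monoˡ-≤ d′ X≤) ⟩
        a ℕ.^ A ℕ.* (a ℕ.* ∣ z 0 ∣) ℕ.^ d′               ≡⟨ cong (a ℕ.^ A ℕ.*_) (^-distribʳ-* d′ a ∣ z 0 ∣) ⟩
        a ℕ.^ A ℕ.* (a ℕ.^ d′ ℕ.* ∣ z 0 ∣ ℕ.^ d′)        ≡⟨ sym (ℕ.*-assoc (a ℕ.^ A) (a ℕ.^ d′) _) ⟩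
        a ℕ.^ A ℕ.* a ℕ.^ d′ ℕ.* ∣ z 0 ∣ ℕ.^ d′          ≡⟨ cong (ℕ._* ∣ z 0 ∣ ℕ.^ d′) (sym (ℕ.^-distribˡ-+-* a A d′)) ⟩
        a ℕ.^ (A ℕ.+ d′) ℕ.* ∣ z 0 ∣ ℕ.^ d′              ∎)
        where open ℕ.≤-Reasoning

  module _ (c : ℕ → ℤ) (u v : ℤ) where

    coeff-diagonal : ∀ i z → coeff c u v i i z ≡ c 0 * u ^ i
    coeff-diagonal zero z = sym (ℤ.*-identityʳ (c 0))
    coeff-diagonal (suc i) z = trans
      (cong₂ (λ x y → z * x + u * (y + + suc i * x)) (coeff-zero c u v {i} {suc i} z ≤-refl) (coeff-diagonal i z)) (alg z u (c 0) (u ^ i) (+ suc i))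
      where
      alg : ∀ z u k w i → z * 0ℤ + u * (k * w + i * 0ℤ) ≡ k * (u * w)
      alg = solve-∀

    -- By degree this coefficient is linear in z; every stage of the recursion adds the diagonal
    -- coefficient to its slope. The slope being nonzero is what lets s = 0 determine Z.
    coeff-subdiagonal : ∀ i z z′ → coeff c u v (suc i) i z - coeff c u v (suc i) i z′ ≡ + suc i * (c 0 * u ^ i) * (z - z′)
    coeff-subdiagonal zero z z′ = alg z z′ (c 0) (v ^ 1 * c 1)
      where
      alg : ∀ z z′ k x → (z * k + x) - (z′ * k + x) ≡ 1ℤ * (k * 1ℤ) * (z - z′)
      alg = solve-∀
    coeff-subdiagonal (suc i) z z′ = begin
      (z * D z + u * (coeff c u v (suc i) i z + + suc i * D z)) - (z′ * D z′ + u * (coeff c u v (suc i) i z′ + + suc i * D z′))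
        ≡⟨ cong₂ (λ x y → (z * x + u * (off z + + suc i * x)) - (z′ * y + u * (off z′ + + suc i * y))) (coeff-diagonal (suc i) z) (coeff-diagonal (suc i) z′) ⟩
      (z * K + u * (off z + + suc i * K)) - (z′ * K + u * (off z′ + + suc i * K))
        ≡⟨ alg₁ z z′ u K (off z) (off z′) (+ suc i) ⟩
      K * (z - z′) + u * (off z - off z′)
        ≡⟨ cong (λ x → K * (z - z′) + u * x) (coeff-subdiagonal i z z′) ⟩
      c 0 * (u * u ^ i) * (z - z′) + u * (+ suc i * (c 0 * u ^ i) * (z - z′))
        ≡⟨ alg₂ z z′ u (c 0) (u ^ i) (+ suc i) ⟩
      (1ℤ + + suc i) * (c 0 * (u * u ^ i)) * (z - z′) ∎
      where
      open ≡-Reasoning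
      D = coeff c u v (suc i) (suc i)
      off = coeff c u v (suc i) i
      K = c 0 * u ^ suc i
      alg₁ : ∀ z z′ u k s s′ i → (z * k + u * (s + i * k)) - (z′ * k + u * (s′ + i * k)) ≡ k * (z - z′) + u * (s - s′)
      alg₁ = solve-∀
      alg₂ : ∀ z z′ u k w i → k * (u * w) * (z - z′) + u * (i * (k * w) * (z - z′)) ≡ (1ℤ + i) * (k * (u * w)) * (z - z′)
      alg₂ = solve-∀

    coeff-injective : c 0 ≢ 0ℤ → u ≢ 0ℤ → ∀ i {z z′} → coeff c u v (suc i) i z ≡ coeff c u v (suc i) i z′ → z ≡ z′
    coeff-injective c₀≢0 u≢0 i {z} {z′} eq with ℤ.i*j≡0⇒i≡0∨j≡0 (+ suc i * (c 0 * u ^ i))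
        (trans (sym (coeff-subdiagonal i z z′)) (ℤ.i≡j⇒i-j≡0 eq))
    ... | inj₂ z-z′≡0 = ℤ.i-j≡0⇒i≡j z z′ z-z′≡0
    ... | inj₁ K≡0 with ℤ.i*j≡0⇒i≡0∨j≡0 (+ suc i) K≡0
    ...   | inj₂ K≡0′ with ℤ.i*j≡0⇒i≡0∨j≡0 (c 0) K≡0′
    ...     | inj₁ c₀≡0 = contradiction c₀≡0 c₀≢0
    ...     | inj₂ u^i≡0 = contradiction u^i≡0 (u^i≢0 i)
      where
      u^i≢0 : ∀ i → u ^ i ≢ 0ℤ
      u^i≢0 zero ()
      u^i≢0 (suc i) eq with ℤ.i*j≡0⇒i≡0∨j≡0 u eq
      ... | inj₁ u≡0 = u≢0 u≡0
      ... | inj₂ eq′ = u^i≢0 i eq′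

  -- Locally regular primes are periodic

  module Core (d′ : ℕ) (c : ℕ → ℤ) (c₀≢0 : c 0 ≢ 0ℤ) (g : ℕ → ℕ) (g-< : ∀ n → g n < g (suc n)) (T : ℕ → ℤ) where

    open Cubes g g-<
    open CubeFaces g g-<

    -- Of K = 3 d edges fewer than d fail to be thin, which leaves 2 d + 1. The pattern length M = 5
    -- d + 6 covers the 5 d + 3 consecutive values of Z that the interpolation compares.
    d K M : ℕ
    d = suc d′
    K = d ℕ.+ (d ℕ.+ d)
    M = suc (5 ℕ.+ (5 ℕ.* d))

    cube-suc : ∀ {k M} (ws : Box k) {n} → Cube (suc M) ws n → Cube M ws (suc n)
    cube-suc [] _ = tt
    cube-suc ((Δ , η) ∷ ws) {n} (cube , cube′ , shift) = cube-suc ws cube , cube-suc ws cube′ , λ j j≤M →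
      trans (cong g (sym (ℕ.+-suc (n ℕ.+ Δ) j))) (trans (shift (suc j) (s≤s j≤M)) (cong (λ z → g z ℕ.+ η) (ℕ.+-suc n j)))

    cube-mono : ∀ {k M} (ws : Box k) {n} → Cube (suc M) ws n → Cube M ws n
    cube-mono [] _ = tt
    cube-mono (_ ∷ ws) (cube , cube′ , shift) = cube-mono ws cube , cube-mono ws cube′ , λ j j≤M → shift j (m≤n⇒m≤1+n j≤M)

    slack : ℕ
    slack = M ℕ.+ (5 ℕ.+ 5 ℕ.* d)

    -- One exponent e governs all sizes. `rooms` leaves space for η + 2 terms with index step Δ, and
    -- `reach≤` for running the recurrences beyond the last vertex of the cube.
    record Window (e : ℕ) : Set where
      field
        a N n₀ len : ℕ
        vs : Box K
        2≤a : 2 ≤ a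
        1≤N : 1 ≤ N
      In : ℕ → Set
      In m = n₀ ≤ m × m ≤ n₀ ℕ.+ len
      field
        small-c  : ∀ i → Bd a N e 0 (c i)
        N≤n₀     : N ≤ n₀
        position : ∀ {m} → In m → Bd a N e 1 (+ m)
        value    : ∀ {m} → In m → Bd a N e 1 (+ g m)
        T-size   : ∀ {m} → In m → Bd a N e d (T m)
        T-eq     : ∀ {m} → In m → + m * T m - T (suc m) ≡ horner c d (+ g m)
        width    : Bd a N e 0 (+ len)
        growth   : ∀ {m} → In m → Bd a N e 0 (+ g m - + g n₀)
        cube     : Cube M vs n₀
        edges    : All (λ (Δ , η) → (0 < Δ × Bd a N e 0 (+ Δ)) × (0 < η × Bd a N e 0 (+ η))) vs
        rooms    : All (λ (Δ , η) → (2 ℕ.+ η) ℕ.* Δ ℕ.+ slack ≤ len) vs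
        reach≤   : reach vs ℕ.+ slack ≤ len

      open Sizes 2≤a 1≤N using (Bd-≤)

      ∣-∣≡∸ : ∀ {m n} → n ≤ m → ∣ + m - + n ∣ ≡ m ℕ.∸ n
      ∣-∣≡∸ {m} {n} n≤m = cong ∣_∣ (trans (ℤ.m-n≡m⊖n m n) (ℤ.⊖-≥ n≤m))

      offset : ∀ {m} → In m → Bd a N e 0 (+ m - + n₀)
      offset {m} (n₀≤m , m≤) = Bd-≤ (subst (_≤ len) (sym (∣-∣≡∸ n₀≤m)) (ℕ.m≤n+o⇒m∸n≤o m n₀ m≤)) width

      In-≤ : ∀ {m m′} → In m → n₀ ≤ m′ → m′ ≤ m → In m′
      In-≤ (_ , m≤) n₀≤m′ m′≤m = n₀≤m′ , ≤-trans m′≤m m≤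

      In-near : ∀ {m i} → n₀ ≤ m → m ≤ n₀ ℕ.+ reach vs → i ≤ slack → In (m ℕ.+ i)
      In-near {m} {i} n₀≤m m≤ i≤ = ≤-trans n₀≤m (m≤m+n m i) ,
        ≤-trans (+-mono-≤ m≤ i≤) (≤-trans (≤-reflexive (+-assoc n₀ (reach vs) slack)) (+-monoʳ-≤ n₀ reach≤))

    reach-⊑ : ∀ {k j} {ws : Box k} {vs : Box j} → ws ⊑ vs → reach ws ≤ reach vs
    reach-⊑ [] = z≤n
    reach-⊑ (skip sub) = ≤-trans (reach-⊑ sub) (m≤m+n _ _)
    reach-⊑ (keep sub) = +-monoˡ-≤ _ (reach-⊑ sub)

    -- u = g n₀ and v = n₀, so that Z n₀ = 0

    Z-exp R-exp R-exp′ alt-exp product-exp : ℕ → ℕ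
    Z-exp e = suc ((e ℕ.+ e) ℕ.+ (e ℕ.+ e))
    R-exp e = peel-exp (Z-exp e) d ℕ.+ remainder-exp (Z-exp e) d
    R-exp′ e = proj₁ (descend d d′ (R-exp e))
    alt-exp e = d ℕ.+ R-exp′ e
    product-exp e = d ℕ.+ (e ℕ.+ R-exp′ e)

    e≤Z-exp : ∀ e → e ≤ Z-exp e
    e≤Z-exp e = ≤-trans (m≤m+n e e) (≤-trans (m≤m+n _ _) (n≤1+n _))

    module Sized {e : ℕ} (w : Window e) (u v : ℤ)
                 (bu : Bd (Window.a w) (Window.N w) (Z-exp e) 1 u) (bv : Bd (Window.a w) (Window.N w) (Z-exp e) 1 v)
                 (Z-size : ∀ {m} → Window.In w m → Bd (Window.a w) (Window.N w) (Z-exp e) 1 (Peel.Z c d g T u v m)) where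
      open Window w
      open Peel c d g T u v
      open Sizes 2≤a 1≤N
      open Parts 2≤a 1≤N

      private
        small-c′ : ∀ i → Bd a N (Z-exp e) 0 (c i)
        small-c′ i = Bd-mono (e≤Z-exp e) ≤-refl (small-c i)

      Z-sizes : ∀ {m} → n₀ ≤ m → In (m ℕ.+ d) → ∀ l → l ≤ d → Bd a N (Z-exp e) 1 (Z (l ℕ.+ m))
      Z-sizes {m} n₀≤m inm l l≤d = Z-size (In-≤ inm (≤-trans n₀≤m (m≤n+m m l))
        (≤-trans (+-monoˡ-≤ m l≤d) (≤-reflexive (+-comm d m))))

      s-size : ∀ {m} → n₀ ≤ m → In (m ℕ.+ d) → Bd a N (R-exp e) d (s m)
      s-size n₀≤m inm = Bd-mono (m≤n+m (remainder-exp (Z-exp e) d) (peel-exp (Z-exp e) d)) ≤-refl (Bd-s {g = g} {T = T} small-c′ bu bv (Z-sizes n₀≤m inm))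

      R-size : ∀ {m} → n₀ ≤ m → In (m ℕ.+ d) → Bd a N (R-exp e) (d ℕ.+ d) (R m)
      R-size {m} n₀≤m inm = Bd-mono (m≤m+n (peel-exp (Z-exp e) d) (remainder-exp (Z-exp e) d)) ≤-refl
        (Bd-R {g = g} {T = T} small-c′ bu bv (Bd-mono (e≤Z-exp e) ≤-refl (position inm′)) (Z-sizes n₀≤m inm) (Bd-mono (e≤Z-exp e) ≤-refl (T-size inm′)))
        where
        inm′ : In m
        inm′ = In-≤ inm n₀≤m (m≤m+n m d)

    -- Alternating sums along the secant direction

    module Secant {e : ℕ} (w : Window e) where
      open Window w
      open Sizes 2≤a 1≤N
      open Parts 2≤a 1≤N

      open Peel c d g T (+ g n₀) (+ n₀)

      n₀-In : In n₀
      n₀-In = ≤-refl , m≤m+n n₀ len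

      -- Since Z n₀ = 0, Z m is n₀ (g m - g n₀) - g n₀ (m - n₀), of size N instead of N².
      Z-size : ∀ {m} → In m → Bd a N (Z-exp e) 1 (Z m)
      Z-size {m} inm = subst (Bd a N (Z-exp e) 1) (alg (+ n₀) (+ g m) (+ g n₀) (+ m))
        (Bd-minus (Bd-* (position n₀-In) (growth inm)) (Bd-* (value n₀-In) (offset inm)))
        where
        alg : ∀ n x y m → n * (x - y) - y * (m - n) ≡ n * x - y * m
        alg = solve-∀

      open Sized w (+ g n₀) (+ n₀) (Bd-mono (e≤Z-exp e) ≤-refl (value n₀-In)) (Bd-mono (e≤Z-exp e) ≤-refl (position n₀-In)) Z-size

      -- The a priori size of R is N^(2 d). Since s has size Nᵈ, d + 1 backward steps bring R down
      -- to N^(d - 1).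
      R-size′ : ∀ {m} → n₀ ≤ m → In (suc (m ℕ.+ d) ℕ.+ d) → Bd a N (R-exp′ e) d′ (R m)
      R-size′ {m} n₀≤m inm = proj₂ (descend d d′ (R-exp e)) 2≤a 1≤N {R} {s} {m}
        (λ m′ m≤m′ m′≤ → ≤-trans N≤n₀ (≤-trans n₀≤m m≤m′) ,
           R-eq (T-eq (In-≤ inm (≤-trans n₀≤m m≤m′) (≤-trans m′≤ (≤-trans (n≤1+n _) (m≤m+n _ d))))) ,
           s-size (≤-trans n₀≤m m≤m′) (In-≤ inm (≤-trans n₀≤m (≤-trans m≤m′ (m≤m+n m′ d)))
             (+-monoˡ-≤ d (m≤n⇒m≤1+n m′≤))))
        (subst (λ j → Bd a N (R-exp e) j (R (suc (m ℕ.+ d)))) (sym (ℕ.+-suc d′ d))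
          (R-size (≤-trans n₀≤m (≤-trans (m≤m+n m d) (n≤1+n _))) inm))

      module _ {ws : Box d} (sub : ws ⊑ vs) where

        near : ∀ {m} i → n₀ ≤ m → m ≤ n₀ ℕ.+ reach ws → i ≤ slack → In (m ℕ.+ i)
        near i n₀≤m m≤ i≤ = In-near n₀≤m (≤-trans m≤ (+-monoʳ-≤ n₀ (reach-⊑ sub))) i≤

        cube-ws : Cube M ws n₀
        cube-ws = cube-⊑ sub cube

        d≤5+5d : d ≤ 5 ℕ.+ 5 ℕ.* d
        d≤5+5d = ≤-trans (ℕ.m≤n*m d 5) (m≤n+m (5 ℕ.* d) 5)

        R-near : ∀ i → i ≤ 1 → ∀ m → n₀ ≤ m → m ≤ n₀ ℕ.+ reach ws → Bd a N (R-exp′ e) d′ (R (i ℕ.+ m))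
        R-near i i≤1 m n₀≤m m≤ = R-size′ (≤-trans n₀≤m (m≤n+m m i))
          (subst In (rearrange m i d) (near (suc i ℕ.+ (d ℕ.+ d)) n₀≤m m≤
            (+-mono-≤ {suc i} {M} (≤-trans (s≤s i≤1) (s≤s (s≤s z≤n))) (≤-trans two-d (m≤n+m (5 ℕ.* d) 5)))))
          where
          rearrange : ∀ m i d → m ℕ.+ (suc i ℕ.+ (d ℕ.+ d)) ≡ suc (i ℕ.+ m ℕ.+ d) ℕ.+ d
          rearrange = ℕSolver.solve-∀
          two-d : d ℕ.+ d ≤ 5 ℕ.* d
          two-d = +-monoʳ-≤ d (m≤m+n d _)

        alt-R : ∀ n → Cube (5 ℕ.+ 5 ℕ.* d) ws n → alt ws R n ≡ (+ n₀) ^ d * alt ws T n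
        alt-R n cube = begin
          alt ws R n                                   ≡⟨ sym (ℤ.+-identityʳ _) ⟩
          alt ws R n + 0ℤ                              ≡⟨ cong (λ z → alt ws R n + z) (sym (alt-low (low-P c d g T (+ g n₀) (+ n₀) ws
                                                            λ i i≤d → affine-Z ws cube (+ g n₀) (+ n₀) i (≤-trans i≤d d≤5+5d)))) ⟩
          alt ws R n + alt ws P n                      ≡⟨ sym (alt-+ ws R P) ⟩
          alt ws (λ m → R m + P m) n                   ≡⟨ alt-cong ws (onVertices-all ws λ m → alg ((+ n₀) ^ d * T m) (P m)) ⟩
          alt ws (λ m → (+ n₀) ^ d * T m) n            ≡⟨ alt-scale ws ((+ n₀) ^ d) T ⟩
          (+ n₀) ^ d * alt ws T n                      ∎
          where
          open ≡-Reasoning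
          alg : ∀ x y → x - y + y ≡ x
          alg = solve-∀

        -- The alternating sum of R is n₀ᵈ times an integer, yet only of size N^(d - 1). A spare
        -- position of the pattern gives the same at n₀ + 1.
        alt-T≡0 : a ℕ.^ alt-exp e < N → alt ws T n₀ ≡ 0ℤ × alt ws T (suc n₀) ≡ 0ℤ
        alt-T≡0 small =
          power-small⇒0 {d = d′} small N≤n₀ (subst (Bd a N (alt-exp e) d′) (alt-R n₀ (cube-mono ws cube-ws)) (Bd-alt ws (R-near 0 z≤n))) ,
          power-small⇒0 {d = d′} small N≤n₀ (subst (Bd a N (alt-exp e) d′) (trans (alt-suc ws R n₀) (alt-R (suc n₀) (cube-suc ws cube-ws)))
            (Bd-alt ws (R-near 1 ≤-refl)))

        -- In s m = m R m - R (m + 1) the alternating sums of R m and R (m + 1) vanish, so m may be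
        -- replaced by m - n₀, which gains a factor N.
        alt-s-≡ : a ℕ.^ alt-exp e < N → alt ws s n₀ ≡ alt ws (λ m → (+ m - + n₀) * R m) n₀
        alt-s-≡ small = begin
          alt ws s n₀                                   ≡⟨ sym (ℤ.+-identityʳ _) ⟩
          alt ws s n₀ + 0ℤ                              ≡⟨ cong (λ z → alt ws s n₀ + z) (sym alt-R∘suc) ⟩
          alt ws s n₀ + alt ws (R ∘ suc) n₀             ≡⟨ sym (alt-+ ws s (R ∘ suc)) ⟩
          alt ws (λ m → s m + R (suc m)) n₀             ≡⟨ alt-cong ws (onVertices-range ws step) ⟩
          alt ws (λ m → + n₀ * R m + (+ m - + n₀) * R m) n₀
            ≡⟨ alt-+ ws (λ m → + n₀ * R m) (λ m → (+ m - + n₀) * R m) ⟩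
          alt ws (λ m → + n₀ * R m) n₀ + alt ws (λ m → (+ m - + n₀) * R m) n₀
            ≡⟨ cong (_+ alt ws (λ m → (+ m - + n₀) * R m) n₀) (trans (alt-scale ws (+ n₀) R) (trans (cong (+ n₀ *_) alt-R≡0) (ℤ.*-zeroʳ (+ n₀)))) ⟩
          0ℤ + alt ws (λ m → (+ m - + n₀) * R m) n₀     ≡⟨ ℤ.+-identityˡ _ ⟩
          alt ws (λ m → (+ m - + n₀) * R m) n₀          ∎
          where
          open ≡-Reasoning
          alt-R≡0 : alt ws R n₀ ≡ 0ℤ
          alt-R≡0 = trans (alt-R n₀ (cube-mono ws cube-ws)) (trans (cong ((+ n₀) ^ d *_) (proj₁ (alt-T≡0 small))) (ℤ.*-zeroʳ ((+ n₀) ^ d)))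
          alt-R∘suc : alt ws (R ∘ suc) n₀ ≡ 0ℤ
          alt-R∘suc = trans (alt-suc ws R n₀) (trans (alt-R (suc n₀) (cube-suc ws cube-ws))
            (trans (cong ((+ n₀) ^ d *_) (proj₂ (alt-T≡0 small))) (ℤ.*-zeroʳ ((+ n₀) ^ d))))
          alg : ∀ m n r r′ s → m * r - r′ ≡ s → s + r′ ≡ n * r + (m - n) * r
          alg m n r r′ s refl = alg′ m n r r′
            where
            alg′ : ∀ m n r r′ → m * r - r′ + r′ ≡ n * r + (m - n) * r
            alg′ = solve-∀
          step : ∀ m → n₀ ≤ m → m ≤ n₀ ℕ.+ reach ws → s m + R (suc m) ≡ + n₀ * R m + (+ m - + n₀) * R m
          step m n₀≤m m≤ = alg (+ m) (+ n₀) (R m) (R (suc m)) (s m) (R-eq (T-eq (subst In (ℕ.+-identityʳ m) (near 0 n₀≤m m≤ z≤n))))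

        -- By `alt-s` the left side of `alt-s-≡` is c 0 · d! times this product, and the right side
        -- has size N^(d - 1).
        product-small : a ℕ.^ alt-exp e < N → Bd a N (product-exp e) d′ (product {n₀} ws (slope (+ g n₀) (+ n₀)))
        product-small small = Bd-≤ le (subst (Bd a N (product-exp e) d′)
            (trans (sym (alt-s-≡ small)) (alt-s c d g T (+ g n₀) (+ n₀) ws refl λ i i≤d → affine-Z ws cube-ws (+ g n₀) (+ n₀) i (≤-trans i≤d (m≤n⇒m≤1+n d≤5+5d))))
            (Bd-alt ws λ m n₀≤m m≤ → Bd-* (offset (subst In (ℕ.+-identityʳ m) (near 0 n₀≤m m≤ z≤n))) (R-near 0 z≤n m n₀≤m m≤)))
          where
          π = product {n₀} ws (slope (+ g n₀) (+ n₀))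
          le : ∣ π ∣ ≤ ∣ c 0 * (+ (d ℕ.!) * π) ∣
          le = begin
            ∣ π ∣                                  ≤⟨ ℕ.m≤n*m ∣ π ∣ (d ℕ.!) {{d ℕ.!≢0}} ⟩
            d ℕ.! ℕ.* ∣ π ∣                        ≡⟨ ℤ.abs-* (+ (d ℕ.!)) π ⟨
            ∣ + (d ℕ.!) * π ∣                      ≤⟨ ℕ.m≤n*m _ ∣ c 0 ∣ {{≢-nonZero (c₀≢0 ∘ ℤ.∣i∣≡0⇒i≡0)}} ⟩
            ∣ c 0 ∣ ℕ.* ∣ + (d ℕ.!) * π ∣          ≡⟨ ℤ.abs-* (c 0) (+ (d ℕ.!) * π) ⟨
            ∣ c 0 * (+ (d ℕ.!) * π) ∣              ∎
            where open ℕ.≤-Reasoning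

    thin-exp : ℕ → ℕ
    thin-exp e = d ℕ.+ (product-exp e ℕ.+ d ℕ.* e)

    module Thin {e : ℕ} (w : Window e) where
      open Window w
      open Sizes 2≤a 1≤N
      open Secant w using (product-small)

      σ : ℕ × ℕ → ℤ
      σ = slope (+ g n₀) (+ n₀)

      -- Comparing d-th powers with B expresses |σ v| ≤ N^((d - 1) / d), up to a power of `a`,
      -- without roots.
      B : ℕ
      B = a ℕ.^ product-exp e ℕ.* N ℕ.^ d′

      thin-or-not : ∀ v → B < ∣ σ v ∣ ℕ.^ d ⊎ ∣ σ v ∣ ℕ.^ d ≤ B
      thin-or-not v with ∣ σ v ∣ ℕ.^ d ℕ.≤? B
      ... | yes le = inj₂ le
      ... | no nle = inj₁ (≰⇒> nle)

      -- d edges beyond the threshold would span a face whose product of slopes exceeds the bound of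
      -- `product-small`.
      thin-face : a ℕ.^ alt-exp e < N → ∃ λ (ws : Box (suc (d ℕ.+ d))) → ws ⊑ vs × All (λ v → ∣ σ v ∣ ℕ.^ d ≤ B) ws
      thin-face small with split-⊑ thin-or-not d (suc (d ℕ.+ d)) vs (≤-reflexive (ℕ.+-suc d (d ℕ.+ d)))
      ... | inj₂ face = face
      ... | inj₁ (ws , sub , bigs) = contradiction (large-product {n₀} B d bigs)
        (ℕ.<⇒≱ (ℕ.≤-<-trans (^-monoˡ-≤ d (bound (product-small sub small))) (ℕ.^-monoˡ-< d (ℕ.n<1+n B))))

      thin-small : a ℕ.^ thin-exp e < N → ∀ v → ∣ σ v ∣ ℕ.^ d ≤ B → ∀ {Δ} → Bd a N e 0 (+ Δ) → 2 ℕ.* (∣ σ v ∣ ℕ.* Δ) < N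
      thin-small small v thin {Δ} (bd Δ≤) = ^-cancel-< d (begin-strict
        (2 ℕ.* (∣ σ v ∣ ℕ.* Δ)) ℕ.^ d                     ≡⟨ trans (^-distribʳ-* d 2 (∣ σ v ∣ ℕ.* Δ)) (cong (2 ℕ.^ d ℕ.*_) (^-distribʳ-* d ∣ σ v ∣ Δ)) ⟩
        2 ℕ.^ d ℕ.* (∣ σ v ∣ ℕ.^ d ℕ.* Δ ℕ.^ d)           ≤⟨ *-mono-≤ (^-monoˡ-≤ d 2≤a) (*-mono-≤ thin (^-monoˡ-≤ d (≤-trans Δ≤ (≤-reflexive (ℕ.*-identityʳ (a ℕ.^ e)))))) ⟩
        a ℕ.^ d ℕ.* (B ℕ.* (a ℕ.^ e) ℕ.^ d)               ≡⟨ cong (λ z → a ℕ.^ d ℕ.* (B ℕ.* z)) (trans (ℕ.^-*-assoc a e d) (cong (a ℕ.^_) (ℕ.*-comm e d))) ⟩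
        a ℕ.^ d ℕ.* (B ℕ.* a ℕ.^ (d ℕ.* e))               ≡⟨ regroup (a ℕ.^ d) (a ℕ.^ product-exp e) (N ℕ.^ d′) (a ℕ.^ (d ℕ.* e)) ⟩
        a ℕ.^ d ℕ.* (a ℕ.^ product-exp e ℕ.* a ℕ.^ (d ℕ.* e)) ℕ.* N ℕ.^ d′
          ≡⟨ cong (ℕ._* N ℕ.^ d′) (trans (cong (a ℕ.^ d ℕ.*_) (sym (ℕ.^-distribˡ-+-* a (product-exp e) (d ℕ.* e)))) (sym (ℕ.^-distribˡ-+-* a d (product-exp e ℕ.+ d ℕ.* e)))) ⟩
        a ℕ.^ thin-exp e ℕ.* N ℕ.^ d′                     <⟨ ℕ.*-monoˡ-< (N ℕ.^ d′) {{m^n≢0 N d′}} small ⟩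
        N ℕ.^ d                                           ∎)
        where
        open ℕ.≤-Reasoning
        regroup : ∀ x y z w → x ℕ.* (y ℕ.* z ℕ.* w) ≡ x ℕ.* (y ℕ.* w) ℕ.* z
        regroup = ℕSolver.solve-∀

      -- Eliminating g n₀ from two values of σ gives n₀ (Δ η′ - η Δ′) = σ′ Δ - σ Δ′, and for thin
      -- edges the right side is below N.
      parallel : a ℕ.^ thin-exp e < N → ∀ {Δ η Δ′ η′} → ∣ σ (Δ , η) ∣ ℕ.^ d ≤ B → ∣ σ (Δ′ , η′) ∣ ℕ.^ d ≤ B →
                 Bd a N e 0 (+ Δ) → Bd a N e 0 (+ Δ′) → slope (+ η) (+ Δ) (Δ′ , η′) ≡ 0ℤ
      parallel small {Δ} {η} {Δ′} {η′} thin thin′ bΔ bΔ′ with ∣ κ ∣ ℕ.≟ 0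
        where
        κ = slope (+ η) (+ Δ) (Δ′ , η′)
      ... | yes ∣κ∣≡0 = ℤ.∣i∣≡0⇒i≡0 ∣κ∣≡0
      ... | no ∣κ∣≢0 = contradiction (begin-strict
        2 ℕ.* N                                                ≤⟨ *-monoʳ-≤ 2 N≤n₀ ⟩
        2 ℕ.* n₀                                               ≤⟨ *-monoʳ-≤ 2 (ℕ.m≤m*n n₀ ∣ κ ∣ {{≢-nonZero ∣κ∣≢0}}) ⟩
        2 ℕ.* (n₀ ℕ.* ∣ κ ∣)                                   ≡⟨ cong (2 ℕ.*_) (trans (sym (ℤ.abs-* (+ n₀) κ)) (cong ∣_∣ (alg (+ n₀) (+ g n₀) (+ Δ) (+ η) (+ Δ′) (+ η′)))) ⟩
        2 ℕ.* ∣ σ′ * + Δ - σ₁ * + Δ′ ∣                         ≤⟨ *-monoʳ-≤ 2 (ℤ.∣i-j∣≤∣i∣+∣j∣ (σ′ * + Δ) (σ₁ * + Δ′)) ⟩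
        2 ℕ.* (∣ σ′ * + Δ ∣ ℕ.+ ∣ σ₁ * + Δ′ ∣)                 ≡⟨ cong₂ (λ x y → 2 ℕ.* (x ℕ.+ y)) (ℤ.abs-* σ′ (+ Δ)) (ℤ.abs-* σ₁ (+ Δ′)) ⟩
        2 ℕ.* (∣ σ′ ∣ ℕ.* Δ ℕ.+ ∣ σ₁ ∣ ℕ.* Δ′)                 ≡⟨ ℕ.*-distribˡ-+ 2 (∣ σ′ ∣ ℕ.* Δ) (∣ σ₁ ∣ ℕ.* Δ′) ⟩
        2 ℕ.* (∣ σ′ ∣ ℕ.* Δ) ℕ.+ 2 ℕ.* (∣ σ₁ ∣ ℕ.* Δ′)         <⟨ ℕ.+-mono-< (thin-small small (Δ′ , η′) thin′ bΔ) (thin-small small (Δ , η) thin bΔ′) ⟩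
        N ℕ.+ N                                                ≡⟨ cong (N ℕ.+_) (sym (ℕ.+-identityʳ N)) ⟩
        2 ℕ.* N                                                ∎) (ℕ.<-irrefl refl)
        where
        open ℕ.≤-Reasoning
        κ = slope (+ η) (+ Δ) (Δ′ , η′)
        σ₁ = σ (Δ , η)
        σ′ = σ (Δ′ , η′)
        alg : ∀ n p Δ η Δ′ η′ → n * (Δ * η′ - η * Δ′) ≡ (n * η′ - p * Δ′) * Δ - (n * η - p * Δ) * Δ′
        alg = solve-∀

    record ParallelFace {e : ℕ} (w : Window e) : Set where
      open Window w
      field
        Δ η      : ℕ
        ws       : Box (d ℕ.+ d)
        face     : ((Δ , η) ∷ ws) ⊑ vs
        parallel : All (λ v → slope (+ η) (+ Δ) v ≡ 0ℤ) ((Δ , η) ∷ ws)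

    parallelFace : ∀ {e} (w : Window e) (let open Window w) → a ℕ.^ alt-exp e < N → a ℕ.^ thin-exp e < N → ParallelFace w
    parallelFace w small small′ with Thin.thin-face w small
    ... | (Δ , η) ∷ ws , sub , thin ∷ thins = record
      { face = sub
      ; parallel = All.map (λ { (thin′ , ((_ , bΔ′) , _)) → Thin.parallel w small′ thin thin′ (proj₂ (proj₁ (All.head edges′))) bΔ′ })
                     (All.zip (thin ∷ thins , edges′))
      }
      where
      edges′ = all-⊑ sub (Window.edges w)

    node-exp : ℕ → ℕ
    node-exp e = R-exp e ℕ.+ suc (e ℕ.+ e)

    interpolation-exp : ℕ → ℕ
    interpolation-exp e = proj₁ (interpolation (d ℕ.+ d) 1 (node-exp e))

    -- Interpolation along the direction of an edge

    module Chord {e : ℕ} (w : Window e) (pf : ParallelFace w) where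
      open Window w
      open Sizes 2≤a 1≤N
      open ParallelFace pf
      -- u = η and v = Δ, so that Z is constant along the face
      open Peel c d g T (+ η) (+ Δ) public

      -- The number of offsets that `interpolation` asks for with i = 2 d and t = 1.
      depth : ℕ
      depth = suc (suc (1 ℕ.+ ((d ℕ.+ d) ℕ.+ (d ℕ.+ d))))

      depth+d≤M : depth ℕ.+ d ≤ M
      depth+d≤M = ≤-trans (≤-reflexive (count d)) (m≤n+m (3 ℕ.+ 5 ℕ.* d) 3)
        where
        count : ∀ d → suc (suc (1 ℕ.+ ((d ℕ.+ d) ℕ.+ (d ℕ.+ d)))) ℕ.+ d ≡ 3 ℕ.+ 5 ℕ.* d
        count = ℕSolver.solve-∀

      M≤slack : M ≤ slack
      M≤slack = m≤m+n M _

      all-edges : All (λ (Δ , η) → (0 < Δ × Bd a N e 0 (+ Δ)) × (0 < η × Bd a N e 0 (+ η))) ((Δ , η) ∷ ws)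
      all-edges = all-⊑ face edges

      cube-face : Cube M ((Δ , η) ∷ ws) n₀
      cube-face = cube-⊑ face cube

      bΔ : Bd a N e 0 (+ Δ)
      bΔ = proj₂ (proj₁ (All.head all-edges))

      bη : Bd a N e 0 (+ η)
      bη = proj₂ (proj₂ (All.head all-edges))

      Δ>0 : 0 < Δ
      Δ>0 = proj₁ (proj₁ (All.head all-edges))

      η>0 : 0 < η
      η>0 = proj₁ (proj₂ (All.head all-edges))

      Z-drift : ∀ {m} → In m → Bd a N (Z-exp e) 0 (Z m - Z n₀)
      Z-drift {m} inm = subst (Bd a N (Z-exp e) 0) (alg (+ Δ) (+ η) (+ g m) (+ g n₀) (+ m) (+ n₀))
        (Bd-minus (Bd-* bΔ (growth inm)) (Bd-* bη (offset inm)))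
        where
        alg : ∀ v u x y m n → v * (x - y) - u * (m - n) ≡ (v * x - u * m) - (v * y - u * n)
        alg = solve-∀

      Z-size : ∀ {m} → In m → Bd a N (Z-exp e) 1 (Z m)
      Z-size inm = Bd-minus (Bd-* bΔ (value inm)) (Bd-* bη (position inm))

      open Sized w (+ η) (+ Δ) (Bd-mono (e≤Z-exp e) z≤n bη) (Bd-mono (e≤Z-exp e) z≤n bΔ) Z-size public
        using (R-size)

      IsNode : ℕ → Set
      IsNode x = (n₀ ≤ x × x ≤ n₀ ℕ.+ reach vs) × (∀ i → i ≤ M → Z (i ℕ.+ x) ≡ Z (i ℕ.+ n₀))

      node-step : ∀ {k} (ws : Box k) {n Δ′ η′} → Cube M ((Δ′ , η′) ∷ ws) n → slope (+ η) (+ Δ) (Δ′ , η′) ≡ 0ℤ →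
                  ∀ i → i ≤ M → Z (i ℕ.+ (n ℕ.+ Δ′)) ≡ Z (i ℕ.+ n)
      node-step ws {n} {Δ′} {η′} cube slope≡0 i i≤M = trans
        (onVertices-base ws (proj₁ (affine-Z ((Δ′ , η′) ∷ ws) cube (+ η) (+ Δ) i i≤M)))
        (trans (cong (λ z → Z (i ℕ.+ n) + z) slope≡0) (ℤ.+-identityʳ _))

      all-nodes : ∀ {k} (ws : Box k) {n} → Cube M ws n → All (λ v → slope (+ η) (+ Δ) v ≡ 0ℤ) ws →
                  n₀ ≤ n → n ℕ.+ reach ws ≤ n₀ ℕ.+ reach vs → (∀ i → i ≤ M → Z (i ℕ.+ n) ≡ Z (i ℕ.+ n₀)) →
                  ∀ {x} → x ∈ nodes ws n → IsNode x
      all-nodes ((Δ′ , η′) ∷ ws) {n} cube (slope≡0 ∷ slopes≡0) n₀≤n ≤end same = go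
        where
        n₀≤ : n₀ ≤ n ℕ.+ Δ′
        n₀≤ = ≤-trans n₀≤n (m≤m+n n Δ′)
        ≤end′ : n ℕ.+ Δ′ ℕ.+ reach ws ≤ n₀ ℕ.+ reach vs
        ≤end′ = ≤-trans (≤-reflexive (trans (+-assoc n Δ′ _) (cong (n ℕ.+_) (+-comm Δ′ (reach ws))))) ≤end
        same′ : ∀ i → i ≤ M → Z (i ℕ.+ (n ℕ.+ Δ′)) ≡ Z (i ℕ.+ n₀)
        same′ i i≤M = trans (node-step ws cube slope≡0 i i≤M) (same i i≤M)
        go : ∀ {x} → x ∈ (n ℕ.+ Δ′ ∷ nodes ws (n ℕ.+ Δ′)) → IsNode x
        go (here refl) = (n₀≤ , ≤-trans (m≤m+n _ (reach ws)) ≤end′) , same′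
        go (there x∈) = all-nodes ws (proj₁ (proj₂ cube)) slopes≡0 n₀≤ ≤end′ same′ x∈

      nodes-increase : ∀ {k} (ws : Box k) n → All (λ (Δ , _) → 0 < Δ) ws → Nodes n (nodes ws n)
      nodes-increase [] n [] = n
      nodes-increase ((Δ′ , _) ∷ ws) n (Δ′>0 ∷ pos) = ℕ.m<m+n n Δ′>0 , nodes-increase ws (n ℕ.+ Δ′) pos

      s-same : ∀ {x} → IsNode x → ∀ j → j < depth → s (j ℕ.+ x) ≡ s (j ℕ.+ n₀)
      s-same {x} (_ , same) j j<depth = sumTo-cong (suc d) λ { l (s≤s l≤d) → cong (coeff c (+ η) (+ Δ) d l)
        (trans (cong Z (sym (+-assoc l j x))) (trans (same (l ℕ.+ j) (≤-trans (+-mono-≤ l≤d (<⇒≤ j<depth)) (≤-trans (≤-reflexive (+-comm d depth)) depth+d≤M)))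
          (cong Z (+-assoc l j n₀)))) }

      node-In : ∀ {x} → IsNode x → ∀ i → i ≤ slack → In (i ℕ.+ x)
      node-In {x} ((n₀≤x , x≤) , _) i i≤ = subst In (+-comm x i) (In-near n₀≤x x≤ i≤)

      system : Interpolation.System 2≤a 1≤N (node-exp e) (d ℕ.+ d) depth IsNode (λ j x → R (j ℕ.+ x)) (λ j → s (j ℕ.+ n₀)) (λ _ → 1ℤ)
      system = record
        { large = λ ((n₀≤x , _) , _) → ≤-trans N≤n₀ n₀≤x
        ; weight≢0 = λ _ ()
        ; weight = λ _ → Bd-mono z≤n z≤n Bd-1
        ; gaps = λ {x} {y} nx ny → Bd-mono (m≤n+m (suc (e ℕ.+ e)) (R-exp e)) ≤-refl
            (subst (Bd a N (suc (e ℕ.+ e)) 0) (alg (+ x) (+ y) (+ n₀)) (Bd-minus (offset (node-In nx 0 z≤n)) (offset (node-In ny 0 z≤n))))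
        ; equation = λ {x} nx j j<depth → trans (R-eq (T-eq (node-In nx j (depth≤slack (<⇒≤ j<depth)))))
            (trans (s-same nx j j<depth) (sym (ℤ.*-identityˡ (s (j ℕ.+ n₀)))))
        ; size = λ {x} nx@((n₀≤x , _) , _) j j≤depth → Bd-mono (m≤m+n (R-exp e) (suc (e ℕ.+ e))) ≤-refl
            (R-size (≤-trans n₀≤x (m≤n+m x j)) (subst In (rearrange j d x) (node-In nx (j ℕ.+ d)
              (≤-trans (+-monoˡ-≤ d j≤depth) (≤-trans depth+d≤M M≤slack)))))
        }
        where
        alg : ∀ x y n → (x - n) - (y - n) ≡ x - y
        alg = solve-∀
        rearrange : ∀ j d x → j ℕ.+ d ℕ.+ x ≡ j ℕ.+ x ℕ.+ d
        rearrange = ℕSolver.solve-∀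
        depth≤slack : ∀ {j} → j ≤ depth → j ≤ slack
        depth≤slack j≤depth = ≤-trans j≤depth (≤-trans (m≤m+n depth d) (≤-trans depth+d≤M M≤slack))

      n₀-node : IsNode n₀
      n₀-node = (≤-refl , m≤m+n n₀ _) , λ _ _ → refl

      face-nodes : ∀ {x} → x ∈ nodes ((Δ , η) ∷ ws) n₀ → IsNode x
      face-nodes = all-nodes ((Δ , η) ∷ ws) cube-face parallel ≤-refl (+-monoʳ-≤ n₀ (reach-⊑ face)) (λ _ _ → refl)

      -- The size N^(2 d) of R calls for 2 d + 2 nodes: n₀ and the 2 d + 1 others on the path. Two
      -- offsets are kept, so that s n₀ = 0 follows as well.
      R₀≡0 : a ℕ.^ interpolation-exp e < N → ∀ j → j ≤ 1 → R (j ℕ.+ n₀) ≡ 0ℤ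
      R₀≡0 small = proj₂ (interpolation (d ℕ.+ d) 1 (node-exp e)) 2≤a 1≤N small n₀ (nodes ((Δ , η) ∷ ws) n₀)
        n₀-node face-nodes (nodes-increase ((Δ , η) ∷ ws) n₀ (All.map (proj₁ ∘ proj₁) all-edges)) system

      s₀≡0 : a ℕ.^ interpolation-exp e < N → s n₀ ≡ 0ℤ
      s₀≡0 small = trans (sym (R-eq (T-eq (node-In n₀-node 0 z≤n))))
        (trans (cong₂ (λ x y → + n₀ * x - y) (R₀≡0 small 0 z≤n) (R₀≡0 small 1 ≤-refl)) (alg (+ n₀)))
        where
        alg : ∀ n → n * 0ℤ - 0ℤ ≡ 0ℤ
        alg = solve-∀

      first-node : ∀ i → i ≤ M → Z (i ℕ.+ (n₀ ℕ.+ Δ)) ≡ Z (i ℕ.+ n₀)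
      first-node = node-step ws cube-face (All.head parallel)

    Z₀-exp W-exp s-exp tiny-exp vanish-exp : ℕ → ℕ
    Z₀-exp e = root-exp e d′ d ℕ.+ d′ ℕ.+ Z-exp e
    W-exp e = suc (Z₀-exp e ℕ.+ Z-exp e)
    s-exp e = remainder-exp (W-exp e ℕ.+ e) d
    tiny-exp e = proj₁ (descend (d′ ℕ.+ d) 0 (R-exp e ℕ.+ s-exp e))
    vanish-exp e = suc (s-exp e ℕ.+ tiny-exp e)

    -- Vanishing on the window and periodicity

    module Periodic {e : ℕ} (w : Window e) (pf : ParallelFace w) where
      open Window w
      open Sizes 2≤a 1≤N
      open ParallelFace pf
      open Chord w pf

      module _ (small : a ℕ.^ interpolation-exp e < N) where

        Z₀-size : Bd a N (Z₀-exp e) 0 (Z n₀)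
        Z₀-size = root-size d′ e (Z-exp e) 2≤a 1≤N {c} {+ η} {+ Δ} {λ l → Z (l ℕ.+ n₀)} c₀≢0 small-c bη bΔ
          (λ l l≤d → Z-drift (node-In n₀-node l (≤-trans l≤d (≤-trans (m≤n+m d depth) (≤-trans depth+d≤M M≤slack)))))
          (s₀≡0 small)

        W-size : ∀ {m} → In m → Bd a N (W-exp e) 0 (Z m)
        W-size {m} inm = subst (Bd a N (W-exp e) 0) (alg (Z n₀) (Z m)) (Bd-+ Z₀-size (Z-drift inm))
          where
          alg : ∀ x y → x + (y - x) ≡ y
          alg = solve-∀

        In-back : ∀ {m i j} → n₀ ≤ m → In (m ℕ.+ j) → i ≤ j → In (m ℕ.+ i)
        In-back {m} {i} {j} n₀≤m (_ , end) i≤j = ≤-trans n₀≤m (m≤m+n m i) , ≤-trans (+-monoʳ-≤ m i≤j) end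

        s-size : ∀ {m} → n₀ ≤ m → In (m ℕ.+ d) → Bd a N (s-exp e) 0 (s m)
        -- All entries are now bounded by powers of `a` alone, so the size lemma is applied with 1
        -- in place of N.
        s-size {m} n₀≤m inm = rescale (Parts.Bd-s 2≤a (≤-refl {1}) {W-exp e ℕ.+ e} {d} {c} {g} {T} {+ η} {+ Δ}
          (λ i → Bd₁-mono (m≤n+m e (W-exp e)) ≤-refl (constant (small-c i)))
          (Bd₁-mono (m≤n+m e (W-exp e)) z≤n (constant bη)) (Bd₁-mono (m≤n+m e (W-exp e)) z≤n (constant bΔ))
          λ l l≤d → Bd₁-mono (m≤m+n (W-exp e) e) z≤n (constant (W-size (subst In (+-comm m l) (In-back n₀≤m inm l≤d)))))
          where
          open Sizes 2≤a (≤-refl {1}) using () renaming (Bd-mono to Bd₁-mono)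
          constant : ∀ {e x} → Bd a N e 0 x → Bd a 1 e 0 x
          constant (bd b) = bd b
          rescale : ∀ {e i x} → Bd a 1 e i x → Bd a N e 0 x
          rescale {e} {i} (bd b) = bd (≤-trans b (≤-reflexive (cong (a ℕ.^ e ℕ.*_) (ℕ.^-zeroˡ i))))

        -- As s no longer contributes a power of N, 2 d backward steps use up the crude N^(2 d).
        tiny-R : ∀ {m} → n₀ ≤ m → In (suc (m ℕ.+ (d′ ℕ.+ d)) ℕ.+ d) → Bd a N (tiny-exp e) 0 (R m)
        tiny-R {m} n₀≤m inm = proj₂ (descend (d′ ℕ.+ d) 0 (R-exp e ℕ.+ s-exp e)) 2≤a 1≤N {R} {s} {m}
          (λ m′ m≤m′ m′≤ → ≤-trans N≤n₀ (≤-trans n₀≤m m≤m′) ,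
             R-eq (T-eq (In-≤ inm (≤-trans n₀≤m m≤m′) (≤-trans m′≤ (≤-trans (n≤1+n _) (m≤m+n _ d))))) ,
             Bd-mono (m≤n+m (s-exp e) (R-exp e)) z≤n (s-size (≤-trans n₀≤m m≤m′)
               (In-≤ inm (≤-trans n₀≤m (≤-trans m≤m′ (m≤m+n m′ d))) (+-monoˡ-≤ d (m≤n⇒m≤1+n m′≤)))))
          (Bd-mono (m≤m+n (R-exp e) (s-exp e)) ≤-refl (R-size (≤-trans n₀≤m (≤-trans (m≤m+n m _) (n≤1+n _))) inm))

        margin : ℕ
        margin = 3 ℕ.+ (d′ ℕ.+ d ℕ.+ d)

        margin≤slack : margin ≤ slack
        margin≤slack = ≤-trans (+-mono-≤ {3} {4} (n≤1+n 3) three-d) (≤-trans (m≤n+m (4 ℕ.+ 5 ℕ.* d) 2) M≤slack)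
          where
          three-d : d′ ℕ.+ d ℕ.+ d ≤ 5 ℕ.* d
          three-d = ≤-trans (+-monoˡ-≤ d (+-monoˡ-≤ d (n≤1+n d′)))
            (≤-trans (m≤m+n (d ℕ.+ d ℕ.+ d) (d ℕ.+ d)) (≤-reflexive (count d)))
            where
            count : ∀ d → d ℕ.+ d ℕ.+ d ℕ.+ (d ℕ.+ d) ≡ 5 ℕ.* d
            count = ℕSolver.solve-∀

        module _ (small′ : a ℕ.^ vanish-exp e < N) where

          R≡0 : ∀ {m} i → i ≤ 1 → n₀ ≤ m → In (m ℕ.+ margin) → R (i ℕ.+ m) ≡ 0ℤ
          R≡0 {m} i i≤1 n₀≤m inm = multiple-small⇒0 small′ (≤-trans N≤n₀ n₀≤im)
            (solve-step {i ℕ.+ m} {R (i ℕ.+ m)} (R-eq (T-eq (subst In (+-comm m i) (In-back n₀≤m inm (≤-trans i≤1 (s≤s z≤n)))))))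
            (Bd-+ (s-size n₀≤im (subst In (lemma₁ m i d) (In-back n₀≤m inm (+-mono-≤ {i} {3} (≤-trans i≤1 (s≤s z≤n)) (m≤n+m d (d′ ℕ.+ d))))))
                  (tiny-R (≤-trans n₀≤im (n≤1+n _)) (subst In (lemma₂ m i d′ d) (In-back n₀≤m inm (+-mono-≤ {suc (suc i)} {3} (s≤s (s≤s i≤1)) ≤-refl)))))
            where
            n₀≤im : n₀ ≤ i ℕ.+ m
            n₀≤im = ≤-trans n₀≤m (m≤n+m m i)
            lemma₁ : ∀ m i d → m ℕ.+ (i ℕ.+ d) ≡ i ℕ.+ m ℕ.+ d
            lemma₁ = ℕSolver.solve-∀
            lemma₂ : ∀ m i d′ d → m ℕ.+ (suc (suc i) ℕ.+ (d′ ℕ.+ d ℕ.+ d)) ≡ suc (suc (i ℕ.+ m) ℕ.+ (d′ ℕ.+ d)) ℕ.+ d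
            lemma₂ = ℕSolver.solve-∀

          s≡0 : ∀ {m} → n₀ ≤ m → In (m ℕ.+ margin) → s m ≡ 0ℤ
          s≡0 {m} n₀≤m inm = trans (sym (R-eq (T-eq (subst In (ℕ.+-identityʳ m) (In-back n₀≤m inm z≤n)))))
            (trans (cong₂ (λ x y → + m * x - y) (R≡0 0 z≤n n₀≤m inm) (R≡0 1 ≤-refl n₀≤m inm)) (alg (+ m)))
            where
            alg : ∀ n → n * 0ℤ - 0ℤ ≡ 0ℤ
            alg = solve-∀

          Eq : ℕ → Set
          Eq i = Z (i ℕ.+ (n₀ ℕ.+ Δ)) ≡ Z (i ℕ.+ n₀)

          -- s m involves Z (m + d - 1) only through a nonconstant linear term.
          Eq-step : ∀ k → k ℕ.+ Δ ℕ.+ slack ≤ len → (∀ l → l < d′ → Eq (l ℕ.+ k)) → Eq (d′ ℕ.+ k)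
          Eq-step k room below = trans (cong Z (+-assoc d′ k (n₀ ℕ.+ Δ)))
            (trans (coeff-injective c (+ η) (+ Δ) c₀≢0 (λ { eq → ℕ.<⇒≢ η>0 (sym (ℤ.+-injective eq)) }) d′ penultimate)
              (cong Z (sym (+-assoc d′ k n₀))))
            where
            x′ = k ℕ.+ (n₀ ℕ.+ Δ)
            x = k ℕ.+ n₀
            x≤x′ : x ≤ x′
            x≤x′ = +-monoʳ-≤ k (m≤m+n n₀ Δ)
            n₀≤x : n₀ ≤ x
            n₀≤x = m≤n+m n₀ k
            in′ : In (x′ ℕ.+ margin)
            in′ = ≤-trans n₀≤x (≤-trans x≤x′ (m≤m+n x′ margin)) ,
              ≤-trans (+-monoʳ-≤ x′ margin≤slack) (≤-trans (≤-reflexive (rearrange k n₀ Δ slack)) (+-monoʳ-≤ n₀ room))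
              where
              rearrange : ∀ k n Δ S → k ℕ.+ (n ℕ.+ Δ) ℕ.+ S ≡ n ℕ.+ (k ℕ.+ Δ ℕ.+ S)
              rearrange = ℕSolver.solve-∀
            in₀ : In (x ℕ.+ margin)
            in₀ = In-≤ in′ (≤-trans n₀≤x (m≤m+n x margin)) (+-monoˡ-≤ margin x≤x′)
            lower : sumTo (λ l → Y l (l ℕ.+ x′)) d′ ≡ sumTo (λ l → Y l (l ℕ.+ x)) d′
            lower = sumTo-cong d′ λ l l<d′ → cong (coeff c (+ η) (+ Δ) d l)
              (trans (cong Z (sym (+-assoc l k (n₀ ℕ.+ Δ)))) (trans (below l l<d′) (cong Z (+-assoc l k n₀))))
            -- The coefficient with l = d does not depend on Z, so the newest value entering s m is
            -- Z (m + d - 1).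
            last : Y d (d ℕ.+ x′) ≡ Y d (d ℕ.+ x)
            last = trans (coeff-diagonal c (+ η) (+ Δ) d (Z (d ℕ.+ x′))) (sym (coeff-diagonal c (+ η) (+ Δ) d (Z (d ℕ.+ x))))
            penultimate : Y d′ (d′ ℕ.+ x′) ≡ Y d′ (d′ ℕ.+ x)
            penultimate = cancel (sumTo (λ l → Y l (l ℕ.+ x)) d′) (Y d′ (d′ ℕ.+ x′)) (Y d′ (d′ ℕ.+ x)) (Y d (d ℕ.+ x))
              (sym totals)
              where
              totals : sumTo (λ l → Y l (l ℕ.+ x)) d′ + Y d′ (d′ ℕ.+ x′) + Y d (d ℕ.+ x) ≡
                       sumTo (λ l → Y l (l ℕ.+ x)) d′ + Y d′ (d′ ℕ.+ x) + Y d (d ℕ.+ x)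
              totals = trans (cong₂ (λ p q → p + Y d′ (d′ ℕ.+ x′) + q) (sym lower) (sym last))
                (trans (s≡0 (≤-trans n₀≤x x≤x′) in′) (sym (s≡0 n₀≤x in₀)))
              cancel : ∀ p y y′ q → p + y′ + q ≡ p + y + q → y ≡ y′
              cancel p y y′ q eq = trans (sym (alg p y q)) (trans (cong (λ z → z - q - p) (sym eq)) (alg p y′ q))
                where
                alg : ∀ p y q → p + y + q - q - p ≡ y
                alg = solve-∀

          periodic : ∀ b → b ℕ.+ Δ ℕ.+ slack ≤ len → ∀ i → i ≤ b → Eq i
          periodic zero room zero _ = first-node 0 z≤n
          periodic (suc b) room i i≤ with i ℕ.≤? b | i ℕ.≤? M
          ... | yes i≤b | _ = periodic b (≤-trans (n≤1+n _) room) i i≤b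
          ... | no _ | yes i≤M = first-node i i≤M
          ... | no i≰b | no i≰M = subst Eq k≡ (Eq-step k (≤-trans (+-monoˡ-≤ slack (+-monoˡ-≤ Δ (≤-trans (ℕ.m∸n≤m i d′) i≤))) room)
              λ l l<d′ → periodic b (≤-trans (n≤1+n _) room) (l ℕ.+ k) (≤-pred (≤-trans (+-monoˡ-≤ k l<d′) (≤-trans (≤-reflexive k≡) i≤))))
            where
            k = i ℕ.∸ d′
            d′≤i : d′ ≤ i
            d′≤i = ≤-trans (≤-trans (n≤1+n d′) (≤-trans (m≤n+m d depth) depth+d≤M)) (<⇒≤ (≰⇒> i≰M))
            k≡ : d′ ℕ.+ k ≡ i
            k≡ = ℕ.m+[n∸m]≡n d′≤i

          Eq⇒shift : ∀ i → Eq i → g (i ℕ.+ (n₀ ℕ.+ Δ)) ≡ g (i ℕ.+ n₀) ℕ.+ η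
          Eq⇒shift i eq with ℤ.i*j≡0⇒i≡0∨j≡0 (+ Δ) {+ g (i ℕ.+ (n₀ ℕ.+ Δ)) - + (g (i ℕ.+ n₀) ℕ.+ η)} difference≡0
            where
            alg : ∀ v u x y m → (v * x - u * (m + v)) - (v * y - u * m) ≡ v * (x - (y + u))
            alg = solve-∀
            difference≡0 : + Δ * (+ g (i ℕ.+ (n₀ ℕ.+ Δ)) - + (g (i ℕ.+ n₀) ℕ.+ η)) ≡ 0ℤ
            difference≡0 = begin
              + Δ * (+ g (i ℕ.+ (n₀ ℕ.+ Δ)) - + (g (i ℕ.+ n₀) ℕ.+ η))
                ≡⟨ cong (λ z → + Δ * (+ g (i ℕ.+ (n₀ ℕ.+ Δ)) - z)) (ℤ.pos-+ (g (i ℕ.+ n₀)) η) ⟩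
              + Δ * (+ g (i ℕ.+ (n₀ ℕ.+ Δ)) - (+ g (i ℕ.+ n₀) + + η))
                ≡⟨ sym (alg (+ Δ) (+ η) (+ g (i ℕ.+ (n₀ ℕ.+ Δ))) (+ g (i ℕ.+ n₀)) (+ (i ℕ.+ n₀))) ⟩
              (+ Δ * + g (i ℕ.+ (n₀ ℕ.+ Δ)) - + η * (+ (i ℕ.+ n₀) + + Δ)) - Z (i ℕ.+ n₀)
                ≡⟨ cong (λ z → (+ Δ * + g (i ℕ.+ (n₀ ℕ.+ Δ)) - + η * z) - Z (i ℕ.+ n₀)) (trans (sym (ℤ.pos-+ (i ℕ.+ n₀) Δ)) (cong +_ (+-assoc i n₀ Δ))) ⟩
              Z (i ℕ.+ (n₀ ℕ.+ Δ)) - Z (i ℕ.+ n₀)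
                ≡⟨ ℤ.i≡j⇒i-j≡0 eq ⟩
              0ℤ ∎
              where open ≡-Reasoning
          ... | inj₁ Δ≡0 = contradiction (sym (ℤ.+-injective Δ≡0)) (ℕ.<⇒≢ Δ>0)
          ... | inj₂ zero-diff = ℤ.+-injective (ℤ.i-j≡0⇒i≡j _ _ zero-diff)

          progression : ∀ k → k ≤ suc η → g (k ℕ.* Δ ℕ.+ n₀) ≡ g n₀ ℕ.+ k ℕ.* η
          progression zero _ = sym (ℕ.+-identityʳ (g n₀))
          progression (suc k) (s≤s k≤η) = begin
            g (Δ ℕ.+ k ℕ.* Δ ℕ.+ n₀)           ≡⟨ cong g (rearrange Δ (k ℕ.* Δ) n₀) ⟩
            g (k ℕ.* Δ ℕ.+ (n₀ ℕ.+ Δ))         ≡⟨ Eq⇒shift (k ℕ.* Δ) (periodic (k ℕ.* Δ) room (k ℕ.* Δ) ≤-refl) ⟩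
            g (k ℕ.* Δ ℕ.+ n₀) ℕ.+ η           ≡⟨ cong (ℕ._+ η) (progression k (m≤n⇒m≤1+n k≤η)) ⟩
            g n₀ ℕ.+ k ℕ.* η ℕ.+ η             ≡⟨ rearrange′ (g n₀) (k ℕ.* η) η ⟩
            g n₀ ℕ.+ (η ℕ.+ k ℕ.* η)           ∎
            where
            open ≡-Reasoning
            rearrange : ∀ Δ x n → Δ ℕ.+ x ℕ.+ n ≡ x ℕ.+ (n ℕ.+ Δ)
            rearrange = ℕSolver.solve-∀
            rearrange′ : ∀ x y z → x ℕ.+ y ℕ.+ z ≡ x ℕ.+ (z ℕ.+ y)
            rearrange′ = ℕSolver.solve-∀
            room : k ℕ.* Δ ℕ.+ Δ ℕ.+ slack ≤ len
            room = ≤-trans (+-monoˡ-≤ slack (≤-trans (≤-reflexive (+-comm (k ℕ.* Δ) Δ))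
              (≤-trans (*-monoˡ-≤ Δ (s≤s k≤η)) (*-monoˡ-≤ Δ (n≤1+n (suc η)))))) (All.head (all-⊑ face rooms))

    contradiction-exp : ℕ → ℕ
    contradiction-exp e = alt-exp e ℕ.+ (thin-exp e ℕ.+ (interpolation-exp e ℕ.+ vanish-exp e))

    arithmetic-progression : ∀ {e} (w : Window e) (let open Window w) → a ℕ.^ contradiction-exp e < N →
      ∃₂ λ Δ η → 0 < η × (∀ k → k ≤ suc η → g (k ℕ.* Δ ℕ.+ n₀) ≡ g n₀ ℕ.+ k ℕ.* η)
    arithmetic-progression {e} w small = ParallelFace.Δ pf , ParallelFace.η pf , Chord.η>0 w pf , Periodic.progression w pf
        (smaller (≤-trans (m≤m+n I V) (≤-trans (m≤n+m (I ℕ.+ V) B) (m≤n+m (B ℕ.+ (I ℕ.+ V)) A))))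
        (smaller (≤-trans (m≤n+m V I) (≤-trans (m≤n+m (I ℕ.+ V) B) (m≤n+m (B ℕ.+ (I ℕ.+ V)) A))))
      where
      open Window w
      A = alt-exp e
      B = thin-exp e
      I = interpolation-exp e
      V = vanish-exp e
      smaller : ∀ {E} → E ≤ contradiction-exp e → a ℕ.^ E < N
      smaller E≤ = ℕ.≤-<-trans (^-monoʳ-≤ a {{>-nonZero (ℕ.<-trans z<s 2≤a)}} E≤) small
      pf : ParallelFace w
      pf = parallelFace w (smaller (m≤m+n A _)) (smaller (≤-trans (m≤m+n B (I ℕ.+ V)) (m≤n+m (B ℕ.+ (I ℕ.+ V)) A)))

-- From a rational relation to an integer recurrence

module RationalRelations where

  open import Algebra.Bundles using (Monoid)
  open import Algebra.Module.Bundles using (LeftModule)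
  import Algebra.Properties.Monoid.Sum as MonoidSum
  open import Data.Integer.Base as ℤ using (ℤ; +_)
  import Data.Integer.Properties as ℤ
  import Data.Integer.Tactic.RingSolver as ℤSolver
  open import Data.Nat.Base as ℕ using (_!)
  import Data.Nat.Coprimality as Coprimality
  import Data.Nat.Properties as ℕ
  open import Data.Rational.Base
  open import Data.Rational.Properties
  import Data.Rational.Solver as ℚSolver
  import Data.Rational.Unnormalised.Base as ℚᵘ
  import Data.Rational.Unnormalised.Properties as ℚᵘ
  open import Data.Vec.Functional using (Vector)
  open Polynomials using (horner)

  ι : ℤ → ℚ
  ι z = mkℚ z 0 (Coprimality.sym (Coprimality.1-coprimeTo ℤ.∣ z ∣))

  ι-+ : ∀ x y → ι (x ℤ.+ y) ≡ ι x + ι y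
  ι-+ x y = toℚᵘ-injective (ℚᵘ.≃-trans (ℚᵘ.*≡* (alg x y)) (ℚᵘ.≃-sym (toℚᵘ-homo-+ (ι x) (ι y))))
    where
    alg : ∀ x y → (x ℤ.+ y) ℤ.* + 1 ≡ (x ℤ.* + 1 ℤ.+ y ℤ.* + 1) ℤ.* + 1
    alg = ℤSolver.solve-∀

  ι-* : ∀ x y → ι (x ℤ.* y) ≡ ι x * ι y
  ι-* x y = toℚᵘ-injective (ℚᵘ.≃-trans (ℚᵘ.*≡* refl) (ℚᵘ.≃-sym (toℚᵘ-homo-* (ι x) (ι y))))

  ι-↥ : ∀ q → ι (↧ q) * q ≡ ι (↥ q)
  ι-↥ q@(mkℚ n d _) = toℚᵘ-injective (ℚᵘ.≃-trans (toℚᵘ-homo-* (ι (↧ q)) q) (ℚᵘ.*≡* eq))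
    where
    alg : ∀ D n → D ℤ.* n ℤ.* + 1 ≡ n ℤ.* D
    alg = ℤSolver.solve-∀
    eq : + suc d ℤ.* n ℤ.* + 1 ≡ n ℤ.* + suc (d ℕ.+ 0)
    eq = trans (alg (+ suc d) n) (cong (λ m → n ℤ.* + suc m) (sym (ℕ.+-identityʳ d)))

  ι-/ : ∀ x d .{{_ : ℕ.NonZero d}} → ι (+ d) * (+ x / d) ≡ ι (+ x)
  ι-/ x (suc e) = toℚᵘ-injective (ℚᵘ.≃-trans (toℚᵘ-homo-* (ι (+ suc e)) (+ x / suc e))
    (ℚᵘ.≃-trans (ℚᵘ.*-congˡ (toℚᵘ-fromℚᵘ (ℚᵘ.mkℚᵘ (+ x) e))) (ℚᵘ.*≡* eq)))
    where
    alg : ∀ D n → D ℤ.* n ℤ.* + 1 ≡ n ℤ.* D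
    alg = ℤSolver.solve-∀
    eq : + suc e ℤ.* + x ℤ.* + 1 ≡ + x ℤ.* + suc (e ℕ.+ 0)
    eq = trans (alg (+ suc e) (+ x)) (cong (λ m → + x ℤ.* + suc m) (sym (ℕ.+-identityʳ e)))

  ι-<⁻¹ : ∀ {m n} → ι (+ m) < ι (+ n) → m ℕ.< n
  ι-<⁻¹ {m} {n} lt = ℤ.drop‿+<+ (subst₂ ℤ._<_ (ℤ.*-identityʳ (+ m)) (ℤ.*-identityʳ (+ n)) (drop-*<* lt))

  clear : ∀ n (c : ℕ → ℚ) → ∃₂ λ D (a : ℕ → ℤ) → ℕ.NonZero D × (∀ i → i ℕ.< n → ι (+ D) * c i ≡ ι (a i))
  clear zero c = 1 , (λ _ → + 0) , _ , λ _ ()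
  clear (suc n) c with clear n c
  ... | D , a , D≢0 , eq = D ℕ.* ↧ₙ (c n) , a′ , ℕ.m*n≢0 D (↧ₙ (c n)) {{D≢0}} , eq′
    where
    a′ : ℕ → ℤ
    a′ i with i ℕ.≟ n
    ... | yes _ = + D ℤ.* ↥ (c n)
    ... | no _ = ↧ (c n) ℤ.* a i
    D′≡ : ι (+ (D ℕ.* ↧ₙ (c n))) ≡ ι (+ D) * ι (↧ (c n))
    D′≡ = trans (cong ι (ℤ.pos-* D (↧ₙ (c n)))) (ι-* (+ D) (↧ (c n)))
    eq′ : ∀ i → i ℕ.< suc n → ι (+ (D ℕ.* ↧ₙ (c n))) * c i ≡ ι (a′ i)
    eq′ i (s≤s i≤n) with i ℕ.≟ n
    ... | yes refl = begin
      ι (+ (D ℕ.* ↧ₙ (c n))) * c n        ≡⟨ cong (_* c n) D′≡ ⟩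
      ι (+ D) * ι (↧ (c n)) * c n         ≡⟨ *-assoc (ι (+ D)) (ι (↧ (c n))) (c n) ⟩
      ι (+ D) * (ι (↧ (c n)) * c n)       ≡⟨ cong (ι (+ D) *_) (ι-↥ (c n)) ⟩
      ι (+ D) * ι (↥ (c n))               ≡⟨ ι-* (+ D) (↥ (c n)) ⟨
      ι (+ D ℤ.* ↥ (c n))                 ∎
      where open ≡-Reasoning
    ... | no i≢n = begin
      ι (+ (D ℕ.* ↧ₙ (c n))) * c i        ≡⟨ cong (_* c i) (trans D′≡ (*-comm (ι (+ D)) (ι (↧ (c n))))) ⟩
      ι (↧ (c n)) * ι (+ D) * c i         ≡⟨ *-assoc (ι (↧ (c n))) (ι (+ D)) (c i) ⟩
      ι (↧ (c n)) * (ι (+ D) * c i)       ≡⟨ cong (ι (↧ (c n)) *_) (eq i (ℕ.≤∧≢⇒< i≤n i≢n)) ⟩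
      ι (↧ (c n)) * ι (a i)               ≡⟨ ι-* (↧ (c n)) (a i) ⟨
      ι (↧ (c n) ℤ.* a i)                 ∎
      where open ≡-Reasoning

  comb : (c w : ℕ → ℚ) → ℕ → ℚ
  comb c w zero = 0ℚ
  comb c w (suc n) = c 0 * w 0 + comb (c ∘ suc) (w ∘ suc) n

  comb-last : ∀ c w n → comb c w (suc n) ≡ comb c w n + c n * w n
  comb-last c w zero = +-comm (c 0 * w 0) 0ℚ
  comb-last c w (suc n) = trans (cong (λ z → c 0 * w 0 + z) (comb-last (c ∘ suc) (w ∘ suc) n))
    (sym (+-assoc (c 0 * w 0) (comb (c ∘ suc) (w ∘ suc) n) (c (suc n) * w (suc n))))

  comb-+ : ∀ c w w′ n → comb c (λ k → w k + w′ k) n ≡ comb c w n + comb c w′ n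
  comb-+ c w w′ zero = refl
  comb-+ c w w′ (suc n) = trans (cong (λ z → c 0 * (w 0 + w′ 0) + z) (comb-+ (c ∘ suc) (w ∘ suc) (w′ ∘ suc) n))
    (alg (c 0) (w 0) (w′ 0) (comb (c ∘ suc) (w ∘ suc) n) (comb (c ∘ suc) (w′ ∘ suc) n))
    where
    alg : ∀ c w w′ x y → c * (w + w′) + (x + y) ≡ c * w + x + (c * w′ + y)
    alg = solve 5 (λ c w w′ x y → c :* (w :+ w′) :+ (x :+ y) := c :* w :+ x :+ (c :* w′ :+ y)) refl
      where open ℚSolver.+-*-Solver

  comb-0 : ∀ c n → comb c (λ _ → 0ℚ) n ≡ 0ℚ
  comb-0 c zero = refl
  comb-0 c (suc n) = trans (cong₂ _+_ (*-zeroʳ (c 0)) (comb-0 (c ∘ suc) n)) refl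

  poly : (ℕ → ℤ) → ℕ → ℤ → ℤ
  poly b zero x = + 0
  poly b (suc n) x = b 0 ℤ.+ x ℤ.* poly (b ∘ suc) n x

  horner-cong : ∀ {c c′} d x → (∀ j → j ℕ.≤ d → c j ≡ c′ j) → horner c d x ≡ horner c′ d x
  horner-cong zero x eq = eq 0 z≤n
  horner-cong (suc d) x eq = cong₂ (λ h k → x ℤ.* h ℤ.+ k) (horner-cong d x λ j j≤d → eq j (ℕ.m≤n⇒m≤1+n j≤d)) (eq (suc d) ℕ.≤-refl)

  poly-horner : ∀ b d x → poly b (suc d) x ≡ horner (λ j → b (d ℕ.∸ j)) d x
  poly-horner b zero x = trans (cong (λ z → b 0 ℤ.+ z) (ℤ.*-zeroʳ x)) (ℤ.+-identityʳ (b 0))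
  poly-horner b (suc d) x = begin
    b 0 ℤ.+ x ℤ.* poly (b ∘ suc) (suc d) x
      ≡⟨ ℤ.+-comm (b 0) _ ⟩
    x ℤ.* poly (b ∘ suc) (suc d) x ℤ.+ b 0
      ≡⟨ cong (λ h → x ℤ.* h ℤ.+ b 0) (trans (poly-horner (b ∘ suc) d x)
           (horner-cong d x λ j j≤d → cong b (sym (ℕ.+-∸-assoc 1 j≤d)))) ⟩
    x ℤ.* horner (λ j → b (suc d ℕ.∸ j)) d x ℤ.+ b 0
      ≡⟨ cong (λ k → x ℤ.* horner (λ j → b (suc d ℕ.∸ j)) d x ℤ.+ b k) (sym (ℕ.n∸n≡0 (suc d))) ⟩
    horner (λ j → b (suc d ℕ.∸ j)) (suc d) x ∎
    where open ≡-Reasoning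

  module _ (D : ℕ) (F : ℚ) (x : ℤ) where

    scaled-comb : ∀ n (b : ℕ → ℤ) (c w : ℕ → ℚ) y → (∀ i → i ℕ.< n → ι (+ D) * c i ≡ ι (b i)) →
                  (∀ k → F * w k ≡ ι (y ℤ.* x ℤ.^ k)) → ι (+ D) * (F * comb c w n) ≡ ι (y ℤ.* poly b n x)
    scaled-comb zero b c w y _ _ = trans (trans (cong (ι (+ D) *_) (*-zeroʳ F)) (*-zeroʳ (ι (+ D)))) (cong ι (sym (ℤ.*-zeroʳ y)))
    scaled-comb (suc n) b c w y bs ws = begin
      ι (+ D) * (F * (c 0 * w 0 + comb (c ∘ suc) (w ∘ suc) n))
        ≡⟨ alg (ι (+ D)) F (c 0) (w 0) (comb (c ∘ suc) (w ∘ suc) n) ⟩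
      (ι (+ D) * c 0) * (F * w 0) + ι (+ D) * (F * comb (c ∘ suc) (w ∘ suc) n)
        ≡⟨ cong₂ _+_ (cong₂ _*_ (bs 0 z<s) (ws 0)) (scaled-comb n (b ∘ suc) (c ∘ suc) (w ∘ suc) (y ℤ.* x)
             (λ i i<n → bs (suc i) (s≤s i<n)) (λ k → trans (ws (suc k)) (cong ι (sym (ℤ.*-assoc y x (x ℤ.^ k)))))) ⟩
      ι (b 0) * ι (y ℤ.* + 1) + ι (y ℤ.* x ℤ.* poly (b ∘ suc) n x)
        ≡⟨ trans (cong (λ z → z + ι (y ℤ.* x ℤ.* poly (b ∘ suc) n x)) (sym (ι-* (b 0) (y ℤ.* + 1)))) (sym (ι-+ (b 0 ℤ.* (y ℤ.* + 1)) (y ℤ.* x ℤ.* poly (b ∘ suc) n x))) ⟩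
      ι (b 0 ℤ.* (y ℤ.* + 1) ℤ.+ y ℤ.* x ℤ.* poly (b ∘ suc) n x)
        ≡⟨ cong ι (alg′ (b 0) y x (poly (b ∘ suc) n x)) ⟩
      ι (y ℤ.* (b 0 ℤ.+ x ℤ.* poly (b ∘ suc) n x)) ∎
      where
      open ≡-Reasoning
      alg : ∀ D F c w z → D * (F * (c * w + z)) ≡ (D * c) * (F * w) + D * (F * z)
      alg = solve 5 (λ D F c w z → D :* (F :* (c :* w :+ z)) := (D :* c) :* (F :* w) :+ D :* (F :* z)) refl
        where open ℚSolver.+-*-Solver
      alg′ : ∀ b y x z → b ℤ.* (y ℤ.* + 1) ℤ.+ y ℤ.* x ℤ.* z ≡ y ℤ.* (b ℤ.+ x ℤ.* z)
      alg′ = ℤSolver.solve-∀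

  pos-^ : ∀ m k → + (m ℕ.^ k) ≡ (+ m) ℤ.^ k
  pos-^ m zero = refl
  pos-^ m (suc k) = trans (ℤ.pos-* m (m ℕ.^ k)) (cong (+ m ℤ.*_) (pos-^ m k))

  ι-positive : ∀ m .{{_ : ℕ.NonZero m}} → Positive (ι (+ m))
  ι-positive (suc m) = _

  ι-pos-* : ∀ m n → ι (+ (m ℕ.* n)) ≡ ι (+ m) * ι (+ n)
  ι-pos-* m n = trans (cong ι (ℤ.pos-* m n)) (ι-* (+ m) (+ n))

  positive-multiple-zero : ∀ q x → Positive q → q * x ≡ 0ℚ → x ≡ 0ℚ
  positive-multiple-zero q x q>0 qx≡0 = begin
    x                   ≡⟨ *-identityˡ x ⟨
    1ℚ * x              ≡⟨ cong (_* x) (*-inverseˡ q) ⟨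
    1/ q * q * x        ≡⟨ *-assoc (1/ q) q x ⟩
    1/ q * (q * x)      ≡⟨ cong (1/ q *_) qx≡0 ⟩
    1/ q * 0ℚ           ≡⟨ *-zeroʳ (1/ q) ⟩
    0ℚ                  ∎
    where
    open ≡-Reasoning
    instance
      q≢0 : NonZero q
      q≢0 = pos⇒nonZero q {{q>0}}

  unit-fraction : ∀ k .{{_ : ℕ.NonZero k}} → ∃ λ ε → 0ℚ < ε × ι (+ k) * ε ≡ 1ℚ
  unit-fraction (suc k) = ε , *<* (ℤ.+<+ z<s) , ι-↥ ε
    where
    ε = mkℚ (+ 1) k (Coprimality.1-coprimeTo (suc k))

  scaled-small : ∀ E D f u ε w → Positive f → Positive (E * D) → ∣ D ∣ ≡ D → w ≡ D * (f * u) → E * D * ε ≡ 1ℚ → ∣ u ∣ < ε →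
                 E * ∣ w ∣ < f
  scaled-small E D f u ε w f>0 ED>0 ∣D∣≡D w≡ EDε u< = begin-strict
    E * ∣ w ∣                       ≡⟨ cong (λ z → E * ∣ z ∣) w≡ ⟩
    E * ∣ D * (f * u) ∣             ≡⟨ cong (E *_) (trans (∣p*q∣≡∣p∣*∣q∣ D (f * u)) (cong₂ _*_ ∣D∣≡D (∣p*q∣≡∣p∣*∣q∣ f u))) ⟩
    E * (D * (∣ f ∣ * ∣ u ∣))       ≡⟨ cong (λ z → E * (D * (z * ∣ u ∣))) (0≤p⇒∣p∣≡p (<⇒≤ (positive⁻¹ f {{f>0}}))) ⟩
    E * (D * (f * ∣ u ∣))           ≡⟨ alg E D f ∣ u ∣ ⟩
    f * (E * D * ∣ u ∣)             <⟨ *-monoʳ-<-pos f {{f>0}} (*-monoʳ-<-pos (E * D) {{ED>0}} u<) ⟩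
    f * (E * D * ε)                 ≡⟨ trans (cong (f *_) EDε) (*-identityʳ f) ⟩
    f                               ∎
    where
    open ≤-Reasoning
    alg : ∀ E D f u → E * (D * (f * u)) ≡ f * (E * D * u)
    alg = solve 4 (λ E D f u → E :* (D :* (f :* u)) := f :* (E :* D :* u)) refl
      where open ℚSolver.+-*-Solver

  -- The factor `1ℚ` makes this agree by computation with the combination of the partial sums of
  -- `1,S`.
  partial : ℕ → (ℕ → ℚ) → ℕ → ℚ
  partial n c M = c 0 * 1ℚ + comb (c ∘ suc) (λ k → partialSum k M) n

  module Relation (n : ℕ) (c : ℕ → ℚ) (D : ℕ) (a : ℕ → ℤ) (D≢0 : ℕ.NonZero D)
                  (a-eq : ∀ i → i ℕ.< suc n → ι (+ D) * c i ≡ ι (a i)) where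

    U : ℕ → ℚ
    U = partial n c

    b : ℕ → ℤ
    b = a ∘ suc

    -- D · m! · U m, given by a recursion in ℤ so that its integrality needs no argument.
    W : ℕ → ℤ
    W zero = a 0
    W (suc m) = + suc m ℤ.* W m ℤ.+ poly b n (+ p (suc m))

    W-eq : ∀ m → ι (W m) ≡ ι (+ D) * (ι (+ (m !)) * U m)
    W-eq zero = begin
      ι (a 0)                                       ≡⟨ a-eq 0 z<s ⟨
      ι (+ D) * c 0                                 ≡⟨ cong (ι (+ D) *_) (sym (trans (*-identityˡ (U 0)) (trans (cong₂ _+_ (*-identityʳ (c 0)) (comb-0 (c ∘ suc) n)) (+-identityʳ (c 0))))) ⟩
      ι (+ D) * (ι (+ 1) * U 0)                     ∎
      where open ≡-Reasoning
    W-eq (suc m) = begin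
      ι (+ suc m ℤ.* W m ℤ.+ poly b n x)
        ≡⟨ trans (ι-+ (+ suc m ℤ.* W m) (poly b n x)) (cong₂ _+_ (ι-* (+ suc m) (W m)) (cong ι (sym (ℤ.*-identityˡ (poly b n x))))) ⟩
      ι (+ suc m) * ι (W m) + ι (+ 1 ℤ.* poly b n x)
        ≡⟨ cong₂ _+_ (cong (ι (+ suc m) *_) (W-eq m)) (sym (scaled-comb D (ι (+ (suc m !))) x n b (c ∘ suc) (λ k → term k (suc m)) (+ 1)
             (λ i i<n → a-eq (suc i) (s≤s i<n)) terms)) ⟩
      ι (+ suc m) * (ι (+ D) * (ι (+ (m !)) * U m)) + ι (+ D) * (ι (+ (suc m !)) * Θ)
        ≡⟨ cong (λ z → ι (+ suc m) * (ι (+ D) * (ι (+ (m !)) * U m)) + ι (+ D) * (z * Θ)) factorial ⟩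
      ι (+ suc m) * (ι (+ D) * (ι (+ (m !)) * U m)) + ι (+ D) * (ι (+ suc m) * ι (+ (m !)) * Θ)
        ≡⟨ alg (ι (+ suc m)) (ι (+ D)) (ι (+ (m !))) (c 0 * 1ℚ) (comb (c ∘ suc) (λ k → partialSum k m) n) Θ ⟩
      ι (+ D) * (ι (+ suc m) * ι (+ (m !)) * (c 0 * 1ℚ + (comb (c ∘ suc) (λ k → partialSum k m) n + Θ)))
        ≡⟨ cong₂ (λ z y → ι (+ D) * (z * (c 0 * 1ℚ + y))) (sym factorial) (sym (comb-+ (c ∘ suc) (λ k → partialSum k m) (λ k → term k (suc m)) n)) ⟩
      ι (+ D) * (ι (+ (suc m !)) * U (suc m)) ∎
      where
      open ≡-Reasoning
      x = + p (suc m)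
      Θ = comb (c ∘ suc) (λ k → term k (suc m)) n
      factorial : ι (+ (suc m !)) ≡ ι (+ suc m) * ι (+ (m !))
      factorial = trans (cong ι (ℤ.pos-* (suc m) (m !))) (ι-* (+ suc m) (+ (m !)))
      terms : ∀ k → ι (+ (suc m !)) * term k (suc m) ≡ ι (+ 1 ℤ.* x ℤ.^ k)
      terms k = trans (ι-/ (p (suc m) ℕ.^ k) (suc m !) {{suc m ℕ.!≢0}})
        (cong ι (trans (pos-^ (p (suc m)) k) (sym (ℤ.*-identityˡ (x ℤ.^ k)))))
      alg : ∀ s D f c v t → s * (D * (f * (c + v))) + D * (s * f * t) ≡ D * (s * f * (c + (v + t)))
      alg = solve 6 (λ s D f c v t → s :* (D :* (f :* (c :+ v))) :+ D :* (s :* f :* t) := D :* (s :* f :* (c :+ (v :+ t)))) refl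
        where open ℚSolver.+-*-Solver

    -- W M = D · M! · U M, and |U M| is eventually below 1 / (E D).
    W-small : Null U → ∀ E .{{_ : ℕ.NonZero E}} → ∃ λ M₀ → ∀ M → M₀ ℕ.≤ M → E ℕ.* ℤ.∣ W M ∣ ℕ.< M !
    W-small null E {{E≢0}} = conclude (unit-fraction (E ℕ.* D) {{ℕ.m*n≢0 E D {{E≢0}} {{D≢0}}}})
      where
      conclude : (∃ λ ε → 0ℚ < ε × ι (+ (E ℕ.* D)) * ε ≡ 1ℚ) → ∃ λ M₀ → ∀ M → M₀ ℕ.≤ M → E ℕ.* ℤ.∣ W M ∣ ℕ.< M !
      conclude (ε , ε>0 , EDε) = proj₁ (null ε>0) , small
        where
        small : ∀ M → proj₁ (null ε>0) ℕ.≤ M → E ℕ.* ℤ.∣ W M ∣ ℕ.< M !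
        small M M₀≤M = ι-<⁻¹ (subst (_< ι (+ (M !))) (sym (ι-pos-* E ℤ.∣ W M ∣))
          (scaled-small (ι (+ E)) (ι (+ D)) (ι (+ (M !))) (U M) ε (ι (W M)) (ι-positive (M !) {{M ℕ.!≢0}})
            (subst Positive (ι-pos-* E D) (ι-positive (E ℕ.* D) {{ℕ.m*n≢0 E D {{E≢0}} {{D≢0}}}})) refl (W-eq M)
            (trans (cong (_* ε) (sym (ι-pos-* E D))) EDε) (proj₂ (null ε>0) M₀≤M)))

  extend : ∀ {n} → Vector ℚ n → ℕ → ℚ
  extend {zero} c j = 0ℚ
  extend {suc n} c zero = c Fin.zero
  extend {suc n} c (suc j) = extend (c ∘ Fin.suc) j

  extend-toℕ : ∀ {n} (c : Vector ℚ n) i → extend c (toℕ i) ≡ c i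
  extend-toℕ c Fin.zero = refl
  extend-toℕ c (Fin.suc i) = extend-toℕ (c ∘ Fin.suc) i

  module _ {m ℓ} (M : Monoid m ℓ) (h : Monoid.Carrier M → ℚ)
           (h-ε : h (Monoid.ε M) ≡ 0ℚ) (h-∙ : ∀ x y → h (Monoid._∙_ M x y) ≡ h x + h y) where
    open Monoid M using (Carrier)
    open MonoidSum M using (sum)

    homo-sum : ∀ {n} (t : Vector Carrier n) (c : Vector ℚ n) (w : ℕ → ℚ) → (∀ i → h (t i) ≡ c i * w (toℕ i)) →
               h (sum t) ≡ comb (extend c) w n
    homo-sum {zero} t c w eq = h-ε
    homo-sum {suc n} t c w eq = trans (h-∙ (t Fin.zero) (sum (t ∘ Fin.suc)))
      (cong₂ _+_ (eq Fin.zero) (homo-sum (t ∘ Fin.suc) (c ∘ Fin.suc) (w ∘ suc) (eq ∘ Fin.suc)))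

  seq-sum : ∀ {n} (c : Vector ℚ n) (v : ℕ → ℝ) (M : ℕ) →
            seq (MonoidSum.sum (LeftModule.+ᴹ-monoid ℝ-leftModule) (λ i → c i ·ᴿ v (toℕ i))) M ≡ comb (extend c) (λ i → seq (v i) M) n
  seq-sum c v M = homo-sum (LeftModule.+ᴹ-monoid ℝ-leftModule) (λ x → seq x M) refl (λ _ _ → refl)
    (λ i → c i ·ᴿ v (toℕ i)) c (λ i → seq (v i) M) (λ _ → refl)

  null-cong : ∀ {x y : ℕ → ℚ} → (∀ n → x n ≡ y n) → Null x → Null y
  null-cong eq null ε>0 with null ε>0
  ... | N , small = N , λ {n} N≤n → subst (λ z → ∣ z ∣ < _) (eq n) (small N≤n)

  null-constant : ∀ q → Null (λ _ → q) → q ≡ 0ℚ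
  null-constant q null with q ≟ 0ℚ
  ... | yes q≡0 = q≡0
  ... | no q≢0 = contradiction (proj₂ (null ∣q∣>0) {proj₁ (null ∣q∣>0)} ℕ.≤-refl) (<-irrefl refl)
    where
    ∣q∣>0 : 0ℚ < ∣ q ∣
    ∣q∣>0 = ≰⇒> λ ∣q∣≤0 → q≢0 (∣p∣≡0⇒p≡0 q (≤-antisym ∣q∣≤0 (0≤∣p∣ q)))

  -- It is enough to treat the last coefficient: once it is 0, the relation becomes a shorter one. A
  -- relation of length one concerns a constant sequence.
  independence : (∀ d (c : ℕ → ℚ) → Null (λ M → partial (suc d) c M) → c (suc d) ≡ 0ℚ) →
                 ∀ n (c : ℕ → ℚ) → Null (λ M → comb c (λ i → seq (1,S i) M) n) → ∀ i → i ℕ.< n → c i ≡ 0ℚ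
  independence last≡0 (suc n) c null i (s≤s i≤n) = go (i ℕ.≟ n)
    where
    cₙ≡0 : ∀ n → Null (λ M → comb c (λ i → seq (1,S i) M) (suc n)) → c n ≡ 0ℚ
    cₙ≡0 zero null = null-constant (c 0) (null-cong (λ M → trans (+-identityʳ (c 0 * 1ℚ)) (*-identityʳ (c 0))) null)
    cₙ≡0 (suc d) null = last≡0 d c null
    eq : ∀ M → comb c (λ i → seq (1,S i) M) (suc n) ≡ comb c (λ i → seq (1,S i) M) n
    eq M = trans (comb-last c (λ i → seq (1,S i) M) n)
      (trans (cong (λ z → comb c (λ i → seq (1,S i) M) n + z) (trans (cong (_* seq (1,S n) M) (cₙ≡0 n null)) (*-zeroˡ (seq (1,S n) M))))
        (+-identityʳ (comb c (λ i → seq (1,S i) M) n)))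
    go : Dec (i ≡ n) → c i ≡ 0ℚ
    go (yes refl) = cₙ≡0 n null
    go (no i≢n) = independence last≡0 n c (null-cong eq null) i (ℕ.≤∧≢⇒< i≤n i≢n)

-- Growth of T and the choice of parameters

module LargeScale where

  open import Data.Integer.Base as ℤ using (ℤ; +_; ∣_∣; 0ℤ)
  import Data.Integer.Properties as ℤ
  import Data.Integer.Tactic.RingSolver as ℤSolver
  open import Data.Nat.Base
  open import Data.Nat.Primality using (Prime)
  open import Data.Nat.Properties
  open import Data.Nat.Tactic.RingSolver using (solve-∀)
  open import Data.Rational.Base using (ℚ; 0ℚ)
  open import Data.Vec.Relation.Unary.All as All using (All; []; _∷_)
  open import Relation.Nullary.Decidable using (decidable-stable)
  open Primes
  open GraphCubes
  open Polynomials using (Box; horner)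
  open Recurrences using (Bd; bd; reach; total; ≤total; module Core)
  open RationalRelations

  p-< : ∀ n → p n < p (suc n)
  p-< n = nextPrime-> (p n)

  horner-size : ∀ {c : ℕ → ℤ} {C X x} → (∀ i → ∣ c i ∣ ≤ C) → ∣ x ∣ ≤ X → 1 ≤ X → ∀ i → ∣ horner c i x ∣ ≤ C * suc i * X ^ i
  horner-size {C = C} c≤ x≤ 1≤X zero = ≤-trans (c≤ 0) (≤-reflexive (sym (trans (*-identityʳ (C * 1)) (*-identityʳ C))))
  horner-size {c} {C} {X} {x} c≤ x≤ 1≤X (suc i) = begin
    ∣ x ℤ.* horner c i x ℤ.+ c (suc i) ∣            ≤⟨ ℤ.∣i+j∣≤∣i∣+∣j∣ (x ℤ.* horner c i x) (c (suc i)) ⟩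
    ∣ x ℤ.* horner c i x ∣ + ∣ c (suc i) ∣          ≡⟨ cong (_+ ∣ c (suc i) ∣) (ℤ.abs-* x (horner c i x)) ⟩
    ∣ x ∣ * ∣ horner c i x ∣ + ∣ c (suc i) ∣        ≤⟨ +-mono-≤ (*-mono-≤ x≤ (horner-size {c} {C} {X} {x} c≤ x≤ 1≤X i)) (c≤ (suc i)) ⟩
    X * (C * suc i * X ^ i) + C                     ≤⟨ +-monoʳ-≤ _ (m≤m*n C (X ^ suc i) {{>-nonZero (^-pos (suc i))}}) ⟩
    X * (C * suc i * X ^ i) + C * X ^ suc i         ≡⟨ collect X C (suc i) (X ^ i) ⟩
    C * suc (suc i) * X ^ suc i                     ∎
    where
    open ≤-Reasoning
    ^-pos : ∀ k → 0 < X ^ k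
    ^-pos k = m^n>0 X {{>-nonZero 1≤X}} k
    collect : ∀ X C i Y → X * (C * i * Y) + C * (X * Y) ≡ C * suc i * (X * Y)
    collect = solve-∀

  module Tail (d C : ℕ) (c : ℕ → ℤ) (c≤ : ∀ i → ∣ c i ∣ ≤ C) (T : ℕ → ℤ)
              (T-eq : ∀ n → + suc n ℤ.* T (suc n) ℤ.- T (suc (suc n)) ≡ horner c d (+ p (suc n)))
              (T-small : ∀ E .{{_ : NonZero E}} → ∃ λ M₀ → ∀ M → M₀ ≤ M → E * ∣ T (suc M) ∣ < M !) where

    F Q : ℕ
    F = C * suc d
    Q = 4 ^ d

    G : ℕ → ℕ
    G m = F * Q ^ m

    T-step : ∀ {n B} → ∣ horner c d (+ p (suc n)) ∣ ≤ B → suc n * ∣ T (suc n) ∣ ≤ B + ∣ T (suc (suc n)) ∣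
    T-step {n} {B} h≤ = begin
      suc n * ∣ T (suc n) ∣                                             ≡⟨ ℤ.abs-* (+ suc n) (T (suc n)) ⟨
      ∣ + suc n ℤ.* T (suc n) ∣                                         ≡⟨ cong ∣_∣ (trans (alg (+ suc n ℤ.* T (suc n)) (T (suc (suc n)))) (cong (ℤ._+ T (suc (suc n))) (T-eq n))) ⟩
      ∣ horner c d (+ p (suc n)) ℤ.+ T (suc (suc n)) ∣                  ≤⟨ ℤ.∣i+j∣≤∣i∣+∣j∣ (horner c d (+ p (suc n))) (T (suc (suc n))) ⟩
      ∣ horner c d (+ p (suc n)) ∣ + ∣ T (suc (suc n)) ∣                ≤⟨ +-monoˡ-≤ _ h≤ ⟩
      B + ∣ T (suc (suc n)) ∣                                           ∎
      where
      open ≤-Reasoning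
      alg : ∀ x y → x ≡ x ℤ.- y ℤ.+ y
      alg x y = sym (trans (ℤ.+-assoc x (ℤ.- y) y) (trans (cong (λ z → x ℤ.+ z) (ℤ.+-inverseˡ y)) (ℤ.+-identityʳ x)))

    term-size : ∀ m → ∣ horner c d (+ p m) ∣ ≤ G m
    term-size m = ≤-trans (horner-size {c} {C} {4 ^ m} {+ p m} c≤ (p≤4^n m) (m^n>0 4 m) d)
      (≤-reflexive (cong (F *_) (trans (^-*-assoc 4 m d) (trans (cong (4 ^_) (*-comm m d)) (sym (^-*-assoc 4 d m))))))

    -- Backward induction with majorant G. For n ≥ Q the factor n + 1 absorbs G (n + 1) + G (n + 2)
    -- = (Q + 1) G (n + 1), and it turns (n + 1)! into n!.
    back : ∀ E i n → Q ≤ n → E * ∣ T (suc (n + i)) ∣ ≤ E * G (suc (n + i)) + (n + i) ! →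
           E * ∣ T (suc n) ∣ ≤ E * G (suc n) + n !
    back E zero n _ h = subst (λ k → E * ∣ T (suc k) ∣ ≤ E * G (suc k) + k !) (+-identityʳ n) h
    back E (suc i) n Q≤n h = *-cancelˡ-≤ (suc n) (begin
      suc n * (E * t)                              ≡⟨ swap (suc n) E t ⟩
      E * (suc n * t)                              ≤⟨ *-monoʳ-≤ E (T-step (term-size (suc n))) ⟩
      E * (G (suc n) + ∣ T (suc (suc n)) ∣)        ≡⟨ *-distribˡ-+ E (G (suc n)) _ ⟩
      E * G (suc n) + E * ∣ T (suc (suc n)) ∣      ≤⟨ +-monoʳ-≤ (E * G (suc n)) (back E i (suc n) (m≤n⇒m≤1+n Q≤n)
                                                        (subst (λ k → E * ∣ T (suc k) ∣ ≤ E * G (suc k) + k !) (+-suc n i) h)) ⟩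
      E * G (suc n) + (E * (F * (Q * Q ^ suc n)) + suc n * n !)  ≡⟨ collect E F Q (Q ^ suc n) (suc n * n !) ⟩
      suc Q * (E * G (suc n)) + suc n * n !        ≤⟨ +-monoˡ-≤ (suc n * n !) (*-monoˡ-≤ (E * G (suc n)) (s≤s Q≤n)) ⟩
      suc n * (E * G (suc n)) + suc n * n !        ≡⟨ *-distribˡ-+ (suc n) (E * G (suc n)) (n !) ⟨
      suc n * (E * G (suc n) + n !)                ∎)
      where
      open ≤-Reasoning
      t = ∣ T (suc n) ∣
      swap : ∀ x y z → x * (y * z) ≡ y * (x * z)
      swap = solve-∀
      collect : ∀ E F Q q z → E * (F * q) + (E * (F * (Q * q)) + z) ≡ suc Q * (E * (F * q)) + z
      collect = solve-∀

    T-exponential : ∀ n → Q ≤ n → ∣ T (suc n) ∣ ≤ G (suc n)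
    T-exponential n Q≤n = ≤-pred (*-cancelˡ-< E _ _ (begin-strict
      E * ∣ T (suc n) ∣      ≤⟨ back E M₀ n Q≤n (≤-trans (<⇒≤ (proj₂ (T-small E) (n + M₀) (m≤n+m M₀ n))) (m≤n+m ((n + M₀) !) _)) ⟩
      E * G (suc n) + n !    <⟨ +-monoʳ-< (E * G (suc n)) (n<1+n (n !)) ⟩
      E * G (suc n) + E      ≡⟨ trans (+-comm (E * G (suc n)) E) (sym (*-suc E (G (suc n)))) ⟩
      E * suc (G (suc n))    ∎))
      where
      open ≤-Reasoning
      -- With E > n! the leftover n! is less than one unit of E, and integrality removes it.
      E = suc (n !)
      M₀ = proj₁ (T-small E)

    module _ {N B : ℕ} (2≤N : 2 ≤ N) (h≤ : ∀ n → suc n ≤ 2 * N → ∣ horner c d (+ p (suc n)) ∣ ≤ B) where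

      private instance
        N≢0 : NonZero N
        N≢0 = >-nonZero (<-trans z<s 2≤N)

      -- Each of the i steps divides by at least N, so the values of the polynomial enter through a
      -- geometric series, of sum at most 2 B as N ≥ 2.
      back′ : ∀ i n → N ≤ suc n → suc n + i ≤ 2 * N → N ^ i * ∣ T (suc n) ∣ ≤ 2 * (N ^ i * B) + ∣ T (suc n + i) ∣
      back′ zero n _ _ = ≤-trans (≤-reflexive (trans (*-identityˡ _) (cong (λ k → ∣ T k ∣) (sym (+-identityʳ (suc n)))))) (m≤n+m _ (2 * (1 * B)))
      back′ (suc i) n N≤ ≤2N = begin
        N * N ^ i * t                                        ≡⟨ regroup N (N ^ i) t ⟩
        N ^ i * (N * t)                                      ≤⟨ *-monoʳ-≤ (N ^ i) (≤-trans (*-monoˡ-≤ t N≤) (T-step (h≤ n (≤-trans (m≤m+n (suc n) (suc i)) ≤2N)))) ⟩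
        N ^ i * (B + t′)                                     ≡⟨ *-distribˡ-+ (N ^ i) B t′ ⟩
        N ^ i * B + N ^ i * t′                               ≤⟨ +-monoʳ-≤ (N ^ i * B) (back′ i (suc n) (m≤n⇒m≤1+n N≤) (≤-trans (≤-reflexive (sym (+-suc (suc n) i))) ≤2N)) ⟩
        N ^ i * B + (2 * (N ^ i * B) + ∣ T (suc (suc n) + i) ∣)  ≤⟨ m≤n+m _ (N ^ i * B) ⟩
        N ^ i * B + (N ^ i * B + (2 * (N ^ i * B) + ∣ T (suc (suc n) + i) ∣))  ≡⟨ collect (N ^ i * B) _ ⟩
        2 * (2 * (N ^ i * B)) + ∣ T (suc (suc n) + i) ∣      ≤⟨ +-monoˡ-≤ _ (*-monoʳ-≤ 2 (*-monoˡ-≤ (N ^ i * B) 2≤N)) ⟩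
        2 * (N * (N ^ i * B)) + ∣ T (suc (suc n) + i) ∣      ≡⟨ cong₂ (λ x k → 2 * x + ∣ T k ∣) (sym (*-assoc N (N ^ i) B)) (sym (+-suc (suc n) i)) ⟩
        2 * (N * N ^ i * B) + ∣ T (suc n + suc i) ∣          ∎
        where
        open ≤-Reasoning
        t = ∣ T (suc n) ∣
        t′ = ∣ T (suc (suc n)) ∣
        regroup : ∀ x y z → x * y * z ≡ y * (x * z)
        regroup = solve-∀
        collect : ∀ x y → x + (x + (2 * x + y)) ≡ 2 * (2 * x) + y
        collect = solve-∀

      -- The unrolling runs up to 2 N, where the exponential bound G (2 N) is available; the h or
      -- more divisions by N cancel it.
      T-polynomial : ∀ {n h} → N ≤ suc n → suc n + h ≤ 2 * N → Q < N → G (2 * N) ≤ N ^ h → ∣ T (suc n) ∣ ≤ suc (2 * B)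
      T-polynomial {n} {h} N≤ ≤2N Q<N G≤ = *-cancelˡ-≤ (N ^ i) {{m^n≢0 N i}} (begin
        N ^ i * ∣ T (suc n) ∣                       ≤⟨ back′ i n N≤ (≤-reflexive i≡) ⟩
        2 * (N ^ i * B) + ∣ T (suc n + i) ∣         ≡⟨ cong (λ k → 2 * (N ^ i * B) + ∣ T k ∣) i≡ ⟩
        2 * (N ^ i * B) + ∣ T (2 * N) ∣             ≤⟨ +-monoʳ-≤ (2 * (N ^ i * B)) T-end ⟩
        2 * (N ^ i * B) + N ^ i                     ≡⟨ collect (N ^ i) B ⟩
        N ^ i * suc (2 * B)                         ∎)
        where
        open ≤-Reasoning
        i = 2 * N ∸ suc n
        i≡ : suc n + i ≡ 2 * N
        i≡ = m+[n∸m]≡n (≤-trans (m≤m+n (suc n) h) ≤2N)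
        h≤i : h ≤ i
        h≤i = +-cancelˡ-≤ (suc n) h i (≤-trans ≤2N (≤-reflexive (sym i≡)))
        N≤2N : N ≤ 2 * N
        N≤2N = m≤n*m N 2
        end : suc (pred (2 * N)) ≡ 2 * N
        end = suc-pred (2 * N) {{m*n≢0 2 N}}
        T-end : ∣ T (2 * N) ∣ ≤ N ^ i
        T-end = ≤-trans (subst (λ k → ∣ T k ∣ ≤ G k) end (T-exponential (pred (2 * N)) (≤-pred (subst (Q <_) (sym end) (≤-trans Q<N N≤2N)))))
          (≤-trans G≤ (^-monoʳ-≤ N h≤i))
        collect : ∀ x B → 2 * (x * B) + x ≡ x * suc (2 * B)
        collect = solve-∀

  open Cubes p p-<

  n<2^n : ∀ n → n < 2 ^ n
  n<2^n = n<q^n {2} ≤-refl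

  -- N = 2^ν and a = 2^(τ + 2), so that a N = 2^2^τ, a bound to which p[1+k]≤2^t applies.
  record Scale (E : ℕ) : Set where
    field
      τ ν  : ℕ
      sum≡ : ν + (2 + τ) ≡ 2 ^ τ
      E≤τ  : E ≤ τ
      E<ν  : (2 + τ) * E < ν

  scale : ∀ E → Scale E
  scale E = record { τ = τ ; ν = 2 ^ τ ∸ (2 + τ) ; sum≡ = sum≡ ; E≤τ = ≤-trans (n≤1+n E) (m≤n*m (suc E) 4) ; E<ν = E<ν }
    where
    τ = 4 * suc E
    -- 2^τ = (2ˢ)² ≥ (s + 1)², and (s + 1)² exceeds (2 + τ) (E + 1) by s + 1.
    s = 2 * suc E
    big : (2 + τ) * suc E < 2 ^ τ
    big = begin-strict
      (2 + 4 * suc E) * suc E     <⟨ m<m+n _ (z<s {2 * suc E}) ⟩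
      (2 + 4 * suc E) * suc E + suc (2 * suc E)  ≡⟨ square (suc E) ⟩
      suc s * suc s               ≤⟨ *-mono-≤ (n<2^n s) (n<2^n s) ⟩
      2 ^ s * 2 ^ s               ≡⟨ ^-distribˡ-+-* 2 s s ⟨
      2 ^ (s + s)                 ≡⟨ cong (2 ^_) (four (suc E)) ⟩
      2 ^ τ                       ∎
      where
      open ≤-Reasoning
      square : ∀ x → (2 + 4 * x) * x + suc (2 * x) ≡ suc (2 * x) * suc (2 * x)
      square = solve-∀
      four : ∀ x → 2 * x + 2 * x ≡ 4 * x
      four = solve-∀
    sum≡ : 2 ^ τ ∸ (2 + τ) + (2 + τ) ≡ 2 ^ τ
    sum≡ = m∸n+n≡m (≤-trans (m≤m*n (2 + τ) (suc E)) (<⇒≤ big))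
    E<ν : (2 + τ) * E < 2 ^ τ ∸ (2 + τ)
    E<ν = +-cancelʳ-< (2 + τ) _ _ (≤-trans (≤-reflexive (cong suc (trans (+-comm ((2 + τ) * E) (2 + τ)) (sym (*-suc (2 + τ) E)))))
      (≤-trans big (≤-reflexive (sym sum≡))))

  module Scaled {E : ℕ} (sc : Scale E) (1≤E : 1 ≤ E) where
    open Scale sc

    a N : ℕ
    a = 2 ^ (2 + τ)
    N = 2 ^ ν

    a^ : ∀ k → a ^ k ≡ 2 ^ ((2 + τ) * k)
    a^ k = ^-*-assoc 2 (2 + τ) k

    4≤a : 4 ≤ a
    4≤a = ^-monoʳ-≤ 2 (m≤m+n 2 τ)

    2≤a : 2 ≤ a
    2≤a = ≤-trans (s≤s (s≤s z≤n)) 4≤a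

    E≤a : E ≤ a
    E≤a = ≤-trans E≤τ (≤-trans (n≤1+n τ) (≤-trans (n<2^n τ) (^-monoʳ-≤ 2 (m≤n+m τ 2))))

    a^<N : ∀ {k} → k ≤ E → a ^ k < N
    a^<N {k} k≤E = subst (_< N) (sym (a^ k)) (^-monoʳ-< 2 ≤-refl (≤-<-trans (*-monoʳ-≤ (2 + τ) k≤E) E<ν))

    E<ν′ : E < ν
    E<ν′ = ≤-<-trans (m≤n*m E (2 + τ)) E<ν

    2≤N : 2 ≤ N
    2≤N = ^-monoʳ-≤ 2 (≤-trans 1≤E (<⇒≤ E<ν′))

    aN≡ : a * N ≡ 2 ^ (2 ^ τ)
    aN≡ = trans (*-comm a N) (trans (sym (^-distribˡ-+-* 2 ν (2 + τ))) (cong (2 ^_) sum≡))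

    -- For t = 2^τ and k = 2 N the condition t k + 2 < 2ᵗ reads 2^(τ + 1) N + 2 < 2^(τ + 2) N; this
    -- is where the exponent τ + 2 of `a` comes from.
    p-end : p (suc (2 * N)) ≤ a * N
    p-end = subst (p (suc (2 * N)) ≤_) (sym aN≡) (p[1+k]≤2^t (2 ^ τ) (2 * N) (begin-strict
      2 + 2 ^ τ * (2 * N)         ≡⟨ cong (λ z → 2 + z) x≡ ⟩
      2 + x                       <⟨ +-monoˡ-< x 2<x ⟩
      x + x                       ≡⟨ cong (λ z → x + z) (sym (+-identityʳ x)) ⟩
      2 ^ suc (τ + suc ν)         ≡⟨ cong (2 ^_) (trans (rearrange τ ν) sum≡) ⟩
      2 ^ (2 ^ τ)                 ∎))
      where
      open ≤-Reasoning
      x = 2 ^ (τ + suc ν)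
      x≡ : 2 ^ τ * (2 * N) ≡ x
      x≡ = sym (^-distribˡ-+-* 2 τ (suc ν))
      2<x : 2 < x
      2<x = <-≤-trans (s≤s (s≤s (s≤s z≤n))) (^-monoʳ-≤ 2 {2} (≤-trans (s≤s (≤-trans 1≤E (<⇒≤ E<ν′))) (m≤n+m (suc ν) τ)))
      rearrange : ∀ τ ν → suc (τ + suc ν) ≡ ν + (2 + τ)
      rearrange = solve-∀

    p≤ : ∀ {m} → m ≤ 2 * N → p m ≤ a * N
    p≤ m≤ = ≤-trans (g-mono-≤ (m≤n⇒m≤1+n m≤)) p-end

  reach-≤ : ∀ {k X} {vs : Box k} → All (Small X) vs → reach vs ≤ k * X
  reach-≤ [] = z≤n
  reach-≤ {suc k} {X} {(Δ , _) ∷ vs} (((_ , Δ<) , _) ∷ small) = ≤-trans (+-mono-≤ (reach-≤ small) (<⇒≤ Δ<)) (≤-reflexive (+-comm (k * X) X))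

  -- A window of length W = a^(κ + σ + 2) on which p grows slowly, and in its
  -- initial part a shorter block on which p still grows slowly.
  record Place (a N H κ σ : ℕ) : Set where
    field
      n₁ n₂   : ℕ
      N≤n₁    : N ≤ n₁
      end     : n₁ + a ^ (κ + suc (suc σ)) ≤ N + H
      growth  : p (n₁ + a ^ (κ + suc (suc σ))) ≤ p n₁ + a ^ (κ + suc (suc σ) + 2)
      n₁≤n₂   : n₁ ≤ n₂
      inside  : n₂ + a ^ κ ≤ n₁ + a ^ (κ + suc σ)
      growth′ : p (n₂ + a ^ κ) ≤ p n₂ + a ^ (κ + 4)

  place : ∀ a N H κ σ m → 4 ≤ a → 1 ≤ m → H ≡ (m + m) * a ^ (κ + suc (suc σ)) → N ≡ H + H → p (N + H) ≤ a * N → Place a N H κ σ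
  -- As p (N + H) ≤ a N = c m, at most m of the 2 m blocks of length W that make up the interval
  -- from N to N + H grow by more than c.
  place a N H κ σ m 4≤a 1≤m H≡ N≡ p≤ = outer (good-blocks W c (m + m) m 1 N grows (+-monoʳ-≤ m 1≤m) (m^n>0 a (κ + suc (suc σ))))
    where
    instance
      a≢0 : NonZero a
      a≢0 = >-nonZero (≤-trans (s≤s z≤n) 4≤a)
    W = a ^ (κ + suc (suc σ))
    c = a * (4 * W)
    2≤a : 2 ≤ a
    2≤a = ≤-trans (s≤s (s≤s z≤n)) 4≤a
    grows : p (N + (m + m) * W) ≤ p N + c * m
    grows = ≤-trans (subst (λ h → p (N + h) ≤ a * N) H≡ p≤) (≤-trans (≤-reflexive (trans (cong (a *_) (trans N≡ (cong₂ _+_ H≡ H≡))) (collect a m W))) (m≤n+m (c * m) (p N)))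
      where
      collect : ∀ a m W → a * ((m + m) * W + (m + m) * W) ≡ a * (4 * W) * m
      collect = solve-∀
    c≤ : c ≤ a ^ (κ + suc (suc σ) + 2)
    c≤ = begin
      a * (4 * W)                         ≤⟨ *-monoʳ-≤ a (*-monoˡ-≤ W 4≤a) ⟩
      a * (a * W)                         ≡⟨ cong (a ^_) (+-comm 2 (κ + suc (suc σ))) ⟩
      a ^ (κ + suc (suc σ) + 2)           ∎
      where open ≤-Reasoning
    outer : (∃ λ (s : ℕ → ℕ) → (∀ i → i < 1 → N ≤ s i × s i + W ≤ N + (m + m) * W × p (s i + W) ≤ p (s i) + c) ×
                               (∀ i j → i < j → j < 1 → s i < s j)) → Place a N H κ σ
    outer (s , props , _) = inner (props 0 z<s)
      where
      n₁ = s 0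
      inner : (N ≤ n₁ × n₁ + W ≤ N + (m + m) * W × p (n₁ + W) ≤ p n₁ + c) → Place a N H κ σ
      -- Only an initial part of length a^(κ + σ + 1) is searched, so that the window still extends
      -- that far to the right of any block found.
      inner (N≤n₁ , end , growth) = finish (good-blocks (a ^ κ) (a ^ (κ + 4)) (a ^ suc σ) (a ^ σ) 1 n₁ grows′ enough (m^n>0 a κ))
        where
        len≡ : a ^ suc σ * a ^ κ ≡ a ^ (κ + suc σ)
        len≡ = trans (*-comm (a ^ suc σ) (a ^ κ)) (sym (^-distribˡ-+-* a κ (suc σ)))
        enough : a ^ σ + 1 ≤ a ^ suc σ
        enough = ≤-trans (+-monoʳ-≤ (a ^ σ) (m^n>0 a σ)) (≤-trans (≤-reflexive (cong (λ z → a ^ σ + z) (sym (+-identityʳ (a ^ σ))))) (*-monoˡ-≤ (a ^ σ) 2≤a))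
        grows′ : p (n₁ + a ^ suc σ * a ^ κ) ≤ p n₁ + a ^ (κ + 4) * a ^ σ
        grows′ = begin
          p (n₁ + a ^ suc σ * a ^ κ)      ≤⟨ g-mono-≤ (+-monoʳ-≤ n₁ (≤-trans (≤-reflexive len≡) (^-monoʳ-≤ a (+-monoʳ-≤ κ (n≤1+n (suc σ)))))) ⟩
          p (n₁ + W)                      ≤⟨ growth ⟩
          p n₁ + c                        ≤⟨ +-monoʳ-≤ (p n₁) c≤ ⟩
          p n₁ + a ^ (κ + suc (suc σ) + 2) ≡⟨ cong (λ z → p n₁ + z) (trans (cong (a ^_) (rearrange κ σ)) (^-distribˡ-+-* a (κ + 4) σ)) ⟩
          p n₁ + a ^ (κ + 4) * a ^ σ      ∎
          where
          open ≤-Reasoning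
          rearrange : ∀ κ σ → κ + suc (suc σ) + 2 ≡ κ + 4 + σ
          rearrange = solve-∀
        finish : (∃ λ (s : ℕ → ℕ) → (∀ i → i < 1 → n₁ ≤ s i × s i + a ^ κ ≤ n₁ + a ^ suc σ * a ^ κ × p (s i + a ^ κ) ≤ p (s i) + a ^ (κ + 4)) ×
                               (∀ i j → i < j → j < 1 → s i < s j)) → Place a N H κ σ
        finish (s′ , props′ , _) = record
          { n₁ = n₁ ; n₂ = s′ 0 ; N≤n₁ = N≤n₁
          ; end = ≤-trans end (≤-reflexive (cong (λ z → N + z) (sym H≡)))
          ; growth = ≤-trans growth (+-monoʳ-≤ (p n₁) c≤)
          ; n₁≤n₂ = proj₁ (props′ 0 z<s)
          ; inside = ≤-trans (proj₁ (proj₂ (props′ 0 z<s))) (≤-reflexive (cong (λ z → n₁ + z) len≡))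
          ; growth′ = proj₂ (proj₂ (props′ 0 z<s))
          }

  module Contradiction (d′ C : ℕ) (c : ℕ → ℤ) (c≤ : ∀ i → ∣ c i ∣ ≤ C) (c₀≢0 : c 0 ≢ 0ℤ) (T : ℕ → ℤ)
      (T-eq : ∀ n → + suc n ℤ.* T (suc n) ℤ.- T (suc (suc n)) ≡ horner c (suc d′) (+ p (suc n)))
      (T-small : ∀ E .{{_ : NonZero E}} → ∃ λ M₀ → ∀ M → M₀ ≤ M → E * ∣ T (suc M) ∣ < M !) where

    open Core d′ c c₀≢0 p p-< T
    open Tail d C c c≤ T T-eq T-small

    module At (κ ξ σ e E : ℕ)
        (ξ≤σ : suc (ξ + ξ) + slack ≤ σ) (K≤σ : K + ξ + slack ≤ σ)
        (d≤e : suc d ≤ e) (Λ≤e : κ + suc (suc σ) + 2 ≤ e) (ξ≤e : ξ ≤ e)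
        (contradiction≤E : contradiction-exp e ≤ E) (Λ≤E : κ + suc (suc σ) + 2 ≤ E) (F8d≤E : F + 8 * d ≤ E) (3FC≤E : 3 * F + C ≤ E)
        (sc : Scale E)
        (locate : ∀ a b → 2 ≤ a → p (b + a ^ κ) ≤ p b + a ^ (κ + 4) → Located M K (a ^ κ) (a ^ ξ) b) where

      Λ : ℕ
      Λ = κ + suc (suc σ)

      1≤E : 1 ≤ E
      1≤E = ≤-trans (≤-trans (s≤s z≤n) (m≤n+m 2 Λ)) Λ≤E

      open Scale sc
      open Scaled sc 1≤E

      x m H : ℕ
      -- Chosen so that N = 4 m a^Λ exactly; then 2 m blocks of length a^Λ fill H = N / 2.
      x = ν ∸ (2 + (2 + τ) * Λ)
      m = 2 ^ x
      H = (m + m) * a ^ Λ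

      ν≡ : (2 + (2 + τ) * Λ) + x ≡ ν
      ν≡ = m+[n∸m]≡n (≤-trans (≤-trans (+-monoˡ-≤ ((2 + τ) * Λ) (≤-trans (m≤m+n 2 τ) (m≤m*n (2 + τ) 2)))
        (≤-reflexive (trans (+-comm ((2 + τ) * 2) _) (sym (*-distribˡ-+ (2 + τ) Λ 2))))) (≤-trans (*-monoʳ-≤ (2 + τ) Λ≤E) (<⇒≤ E<ν)))

      N≡ : N ≡ H + H
      N≡ = begin
        2 ^ ν                                       ≡⟨ cong (2 ^_) (sym ν≡) ⟩
        2 ^ (2 + (2 + τ) * Λ + x)                  ≡⟨ ^-distribˡ-+-* 2 (2 + (2 + τ) * Λ) x ⟩
        2 * (2 * 2 ^ ((2 + τ) * Λ)) * m            ≡⟨ cong (λ z → 2 * (2 * z) * m) (sym (a^ Λ)) ⟩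
        2 * (2 * a ^ Λ) * m                        ≡⟨ regroup (a ^ Λ) m ⟩
        H + H                                       ∎
        where
        open ≡-Reasoning
        regroup : ∀ W m → 2 * (2 * W) * m ≡ (m + m) * W + (m + m) * W
        regroup = solve-∀

      2N≡ : N + H + H ≡ 2 * N
      2N≡ = trans (+-assoc N H H) (trans (cong (λ z → N + z) (sym N≡)) (cong (λ z → N + z) (sym (+-identityʳ N))))

      N+H≤2N : N + H ≤ 2 * N
      N+H≤2N = ≤-trans (m≤m+n (N + H) H) (≤-reflexive 2N≡)

      instance
        a≢0 : NonZero a
        a≢0 = >-nonZero (<-trans z<s 2≤a)
        N≢0 : NonZero N
        N≢0 = >-nonZero (<-trans z<s 2≤N)

      1≤H : 1 ≤ H
      1≤H = *-mono-≤ {1} {m + m} {1} (≤-trans (m^n>0 2 x) (m≤m+n m m)) (m^n>0 a Λ)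

      module _ (pl : Place a N H κ σ) (loc : Located M K (a ^ κ) (a ^ ξ) (Place.n₂ pl)) where
        open Place pl
        open Located loc renaming (pos to n₀)

        len : ℕ
        len = a ^ (κ + suc σ)

        N≤n₀ : N ≤ n₀
        N≤n₀ = ≤-trans N≤n₁ (≤-trans n₁≤n₂ ≤pos)

        n₀+len≤ : n₀ + len ≤ n₁ + a ^ Λ
        n₀+len≤ = begin
          n₀ + len             ≤⟨ +-monoˡ-≤ len (≤-trans (m≤m+n n₀ M) (≤-trans (<⇒≤ pos<) inside)) ⟩
          n₁ + len + len       ≡⟨ trans (+-assoc n₁ len len) (cong (λ z → n₁ + (len + z)) (sym (+-identityʳ len))) ⟩
          n₁ + 2 * len         ≤⟨ +-monoʳ-≤ n₁ (*-monoˡ-≤ len 2≤a) ⟩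
          n₁ + a * len         ≡⟨ cong (λ k → n₁ + a ^ k) (sym (+-suc κ (suc σ))) ⟩
          n₁ + a ^ Λ          ∎
          where open ≤-Reasoning

        In′ : ℕ → Set
        In′ j = n₀ ≤ j × j ≤ n₀ + len

        In-≤N+H : ∀ {j} → In′ j → j ≤ N + H
        In-≤N+H (_ , j≤) = ≤-trans j≤ (≤-trans n₀+len≤ end)

        In-≤2N : ∀ {j} → In′ j → j ≤ 2 * N
        In-≤2N inj = ≤-trans (In-≤N+H inj) N+H≤2N

        pow : ∀ {y k} → y ≤ a ^ k → k ≤ e → Bd a N e 0 (+ y)
        pow y≤ k≤ = bd (≤-trans y≤ (≤-trans (^-monoʳ-≤ a k≤) (≤-reflexive (sym (*-identityʳ _)))))

        1≤e : 1 ≤ e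
        1≤e = ≤-trans (s≤s z≤n) d≤e

        aN-size : ∀ {y} → y ≤ a * N → Bd a N e 1 (+ y)
        aN-size y≤ = bd (≤-trans y≤ (*-mono-≤ (≤-trans (≤-reflexive (sym (*-identityʳ a))) (^-monoʳ-≤ a 1≤e)) (≤-reflexive (sym (*-identityʳ N)))))

        1≤C : 1 ≤ C
        1≤C = ≤-trans (n≢0⇒n>0 (c₀≢0 ∘ ℤ.∣i∣≡0⇒i≡0)) (c≤ 0)

        1≤F : 1 ≤ F
        1≤F = *-mono-≤ {1} {C} {1} 1≤C (s≤s z≤n)

        B : ℕ
        B = F * (a * N) ^ d

        Q<N : Q < N
        Q<N = subst (_< N) (sym (^-*-assoc 2 2 d)) (^-monoʳ-< 2 ≤-refl (≤-<-trans (≤-trans (*-monoˡ-≤ d (m≤m+n 2 6)) (≤-trans (m≤n+m (8 * d) F) F8d≤E)) E<ν′))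

        -- Both sides are compared as powers of two: the left exponent is at most (F + 8 d) H,
        -- because N = 2 H, while N^H has exponent ν H.
        G≤N^H : G (2 * N) ≤ N ^ H
        G≤N^H = begin
          F * (4 ^ d) ^ (2 * N)                      ≡⟨ cong (F *_) (trans (cong (_^ (2 * N)) (^-*-assoc 2 2 d)) (^-*-assoc 2 (2 * d) (2 * N))) ⟩
          F * 2 ^ (2 * d * (2 * N))                  ≤⟨ *-monoˡ-≤ _ (≤-trans (≤-trans (n≤1+n F) (n<2^n F)) (^-monoʳ-≤ 2 (m≤m*n F H {{>-nonZero 1≤H}}))) ⟩
          2 ^ (F * H) * 2 ^ (2 * d * (2 * N))        ≡⟨ ^-distribˡ-+-* 2 (F * H) (2 * d * (2 * N)) ⟨
          2 ^ (F * H + 2 * d * (2 * N))              ≡⟨ cong (2 ^_) (trans (cong (λ z → F * H + 2 * d * (2 * z)) N≡) (collect F d H)) ⟩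
          2 ^ ((F + 8 * d) * H)                      ≤⟨ ^-monoʳ-≤ 2 (*-monoˡ-≤ H (≤-trans F8d≤E (<⇒≤ E<ν′))) ⟩
          2 ^ (ν * H)                                ≡⟨ ^-*-assoc 2 ν H ⟨
          N ^ H                                      ∎
          where
          open ≤-Reasoning
          collect : ∀ F d H → F * H + 2 * d * (2 * (H + H)) ≡ (F + 8 * d) * H
          collect = solve-∀

        1≤aN : 1 ≤ a * N
        1≤aN = *-mono-≤ {1} {a} {1} (<⇒≤ 2≤a) (<⇒≤ 2≤N)

        T-bound : ∀ {j} → In′ j → ∣ T j ∣ ≤ a ^ suc d * N ^ d
        T-bound {zero} (n₀≤0 , _) with () ← ≤-trans (<⇒≤ 2≤N) (≤-trans N≤n₀ n₀≤0)
        T-bound {suc n} inj@(n₀≤j , _) = begin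
          ∣ T (suc n) ∣             ≤⟨ T-polynomial {N} {B} 2≤N (λ n n≤ → horner-size {c} {C} {a * N} {+ p (suc n)} c≤ (p≤ n≤) 1≤aN d) {n} {H}
                                         (≤-trans N≤n₀ n₀≤j) (≤-trans (+-monoˡ-≤ H (In-≤N+H inj)) (≤-reflexive 2N≡)) Q<N G≤N^H ⟩
          suc (2 * B)               ≤⟨ +-monoˡ-≤ (2 * B) (*-mono-≤ {1} {F} {1} 1≤F (m^n>0 (a * N) {{>-nonZero 1≤aN}} d)) ⟩
          B + 2 * B                 ≡⟨ collect F ((a * N) ^ d) ⟩
          3 * F * (a * N) ^ d       ≤⟨ *-monoˡ-≤ _ (≤-trans (≤-trans (m≤m+n (3 * F) C) 3FC≤E) E≤a) ⟩
          a * (a * N) ^ d           ≡⟨ trans (cong (a *_) (^-distribʳ-* d a N)) (sym (*-assoc a (a ^ d) (N ^ d))) ⟩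
          a ^ suc d * N ^ d         ∎
          where
          open ≤-Reasoning
          collect : ∀ F X → F * X + 2 * (F * X) ≡ 3 * F * X
          collect = solve-∀

        p-growth : ∀ {j} → In′ j → Bd a N e 0 (+ p j ℤ.- + p n₀)
        p-growth {j} (n₀≤j , j≤) = bd (subst (_≤ a ^ e * 1) (sym (cong ∣_∣ (trans (ℤ.m-n≡m⊖n (p j) (p n₀)) (ℤ.⊖-≥ (g-mono-≤ n₀≤j)))))
          (Bd.bound (pow {p j ∸ p n₀} {Λ + 2} (m≤n+o⇒m∸n≤o (p j) (p n₀) (begin
            p j                               ≤⟨ g-mono-≤ (≤-trans j≤ n₀+len≤) ⟩
            p (n₁ + a ^ Λ)                   ≤⟨ growth ⟩
            p n₁ + a ^ (Λ + 2)               ≤⟨ +-monoˡ-≤ _ (g-mono-≤ (≤-trans n₁≤n₂ ≤pos)) ⟩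
            p n₀ + a ^ (Λ + 2)               ∎)) Λ≤e)))
          where open ≤-Reasoning

        double-pow : ∀ {y z k} → y ≤ a ^ k → z ≤ a ^ k → y + z ≤ a ^ suc k
        double-pow {k = k} y≤ z≤ = ≤-trans (+-mono-≤ y≤ z≤) (≤-trans (≤-reflexive (cong (λ z → a ^ k + z) (sym (+-identityʳ (a ^ k))))) (*-monoˡ-≤ (a ^ k) 2≤a))

        ≤a^ : ∀ n → n ≤ a ^ n
        ≤a^ n = ≤-trans (≤-trans (n≤1+n n) (n<2^n n)) (^-monoˡ-≤ n 2≤a)

        len≥ : ∀ {y k} → y ≤ a ^ k → k ≤ suc σ → y ≤ len
        len≥ y≤ k≤ = ≤-trans y≤ (^-monoʳ-≤ a (≤-trans k≤ (m≤n+m (suc σ) κ)))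

        room : ∀ {Δ η} → Δ < a ^ ξ → η < a ^ ξ → (2 + η) * Δ + slack ≤ len
        room {Δ} {η} Δ< η< = len≥ (double-pow {k = suc (ξ + ξ) + slack}
            (≤-trans (≤-trans (*-mono-≤ (double-pow {1} {suc η} {ξ} (m^n>0 a ξ) η<) (<⇒≤ Δ<)) (≤-reflexive (sym (^-distribˡ-+-* a (suc ξ) ξ)))) (^-monoʳ-≤ a (m≤m+n (suc (ξ + ξ)) slack)))
            (≤-trans (≤a^ slack) (^-monoʳ-≤ a (m≤n+m slack (suc (ξ + ξ))))))
          (s≤s ξ≤σ)

        reach-room : reach vecs + slack ≤ len
        reach-room = len≥ (double-pow {k = K + ξ + slack}
            (≤-trans (≤-trans (reach-≤ small) (≤-trans (*-monoˡ-≤ (a ^ ξ) (≤a^ K)) (≤-reflexive (sym (^-distribˡ-+-* a K ξ))))) (^-monoʳ-≤ a (m≤m+n (K + ξ) slack)))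
            (≤-trans (≤a^ slack) (^-monoʳ-≤ a (m≤n+m slack (K + ξ)))))
          (s≤s K≤σ)

        window : Window e
        window = record
          { a = a ; N = N ; n₀ = n₀ ; len = len ; vs = vecs ; 2≤a = 2≤a ; 1≤N = <⇒≤ 2≤N
          ; small-c = λ i → bd (≤-trans (c≤ i) (≤-trans (≤-trans (≤-trans (m≤n+m C (3 * F)) 3FC≤E) E≤a) (Bd.bound (pow {a} {1} (≤-reflexive (sym (*-identityʳ a))) 1≤e))))
          ; N≤n₀ = N≤n₀
          ; position = λ inj → aN-size (≤-trans (In-≤2N inj) (*-monoˡ-≤ N 2≤a))
          ; value = λ inj → aN-size (p≤ (In-≤2N inj))
          ; T-size = λ inj → bd (≤-trans (T-bound inj) (*-monoˡ-≤ (N ^ d) (^-monoʳ-≤ a d≤e)))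
          ; T-eq = λ { {zero} (n₀≤0 , _) → absurd n₀≤0 ; {suc n} _ → T-eq n }
          ; width = pow {len} {κ + suc σ} ≤-refl (≤-trans (+-monoʳ-≤ κ (n≤1+n (suc σ))) (≤-trans (m≤m+n Λ 2) Λ≤e))
          ; growth = p-growth
          ; cube = cube
          ; edges = All.map (λ { ((Δ>0 , Δ<) , (η>0 , η<)) → (Δ>0 , pow (<⇒≤ Δ<) ξ≤e) , (η>0 , pow (<⇒≤ η<) ξ≤e) }) small
          ; rooms = All.map (λ { ((_ , Δ<) , (_ , η<)) → room Δ< η< }) small
          ; reach≤ = reach-room
          }
          where
          absurd : ∀ {A : Set} → n₀ ≤ 0 → A
          absurd n₀≤0 with () ← ≤-trans (<⇒≤ 2≤N) (≤-trans N≤n₀ n₀≤0)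

        absurdity′ : ⊥
        absurdity′ = conclude (arithmetic-progression window (a^<N contradiction≤E))
          where
          prime-at : ∀ {j} → 1 ≤ j → Prime (p j)
          prime-at {suc j} _ = p-prime j
          conclude : (∃₂ λ Δ η → 0 < η × (∀ k → k ≤ suc η → p (k * Δ + n₀) ≡ p n₀ + k * η)) → ⊥
          conclude (Δ , η , η>0 , progression) = no-prime-AP (p n₀) η η>0 λ k k≤ →
            subst Prime (progression k k≤) (prime-at (≤-trans (<⇒≤ 2≤N) (≤-trans N≤n₀ (m≤n+m n₀ (k * Δ)))))

      absurdity : ⊥
      absurdity = absurdity′ pl (locate a (Place.n₂ pl) 2≤a (Place.growth′ pl))
        where
        pl : Place a N H κ σ
        pl = place a N H κ σ m 4≤a (m^n>0 2 x) refl N≡ (p≤ N+H≤2N)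

    absurdity : ⊥
    absurdity = go (cubes M K 4)
      where
      go : (∃₂ λ κ ξ → ∀ a b → 2 ≤ a → p (b + a ^ κ) ≤ p b + a ^ (κ + 4) → Located M K (a ^ κ) (a ^ ξ) b) → ⊥
      go (κ , ξ , locate) = At.absurdity κ ξ σ e E (m≤m+n (suc (ξ + ξ) + slack) (K + ξ + slack)) (m≤n+m (K + ξ + slack) (suc (ξ + ξ) + slack)) (m≤m+n (suc d) _)
        (≤-trans (m≤m+n (Λ + 2) ξ) (m≤n+m _ (suc d))) (≤-trans (m≤n+m ξ (Λ + 2)) (m≤n+m _ (suc d)))
        (m≤m+n (contradiction-exp e) _) (≤-trans (m≤m+n (Λ + 2) _) rest≤E)
        (≤-trans (≤-trans (m≤m+n (F + 8 * d) (3 * F + C)) (m≤n+m _ (Λ + 2))) rest≤E)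
        (≤-trans (≤-trans (m≤n+m (3 * F + C) (F + 8 * d)) (m≤n+m _ (Λ + 2))) rest≤E)
        (scale E) locate
        where
        -- Order of choice: κ and ξ come from the cubes; σ gives the window room for the
        -- progression; e bounds the exponents in the window; E, and with it a and N, comes last.
        σ Λ e E : ℕ
        σ = (suc (ξ + ξ) + slack) + (K + ξ + slack)
        Λ = κ + suc (suc σ)
        e = suc d + ((Λ + 2) + ξ)
        E = contradiction-exp e + ((Λ + 2) + ((F + 8 * d) + (3 * F + C)))
        rest≤E : (Λ + 2) + ((F + 8 * d) + (3 * F + C)) ≤ E
        rest≤E = m≤n+m _ (contradiction-exp e)

  no-recurrence : ∀ d C (c : ℕ → ℤ) → (∀ i → ∣ c i ∣ ≤ C) → c 0 ≢ 0ℤ → (T : ℕ → ℤ) →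
    (∀ n → + suc n ℤ.* T (suc n) ℤ.- T (suc (suc n)) ≡ horner c d (+ p (suc n))) →
    (∀ E .{{_ : NonZero E}} → ∃ λ M₀ → ∀ M → M₀ ≤ M → E * ∣ T (suc M) ∣ < M !) → ⊥
  no-recurrence (suc d′) C c c≤ c₀≢0 T T-eq T-small = Contradiction.absurdity d′ C c c≤ c₀≢0 T T-eq T-small
  -- For a constant polynomial T is bounded by F from some point on, so (m + 1) |T (m + 1)| ≤ 2 F;
  -- hence T vanishes for large m, and the recurrence gives c 0 = 0.
  no-recurrence zero C c c≤ c₀≢0 T T-eq T-small = c₀≢0 (trans (sym (T-eq n))
      (trans (cong₂ (λ x y → + suc n ℤ.* x ℤ.- y) (T≡0 n ≤-refl) (T≡0 (suc n) (n≤1+n n))) (alg (+ suc n))))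
    where
    open Tail 0 C c c≤ T T-eq T-small
    n = suc (F + F)
    alg : ∀ x → x ℤ.* 0ℤ ℤ.- 0ℤ ≡ 0ℤ
    alg = ℤSolver.solve-∀
    T≤F : ∀ m → n ≤ m → ∣ T (suc m) ∣ ≤ F
    T≤F m n≤m = ≤-trans (T-exponential m (≤-trans (s≤s z≤n) n≤m)) (≤-reflexive (trans (cong (F *_) (^-zeroˡ (suc m))) (*-identityʳ F)))
    T≡0 : ∀ m → n ≤ m → T (suc m) ≡ 0ℤ
    T≡0 m n≤m with ∣ T (suc m) ∣ ≟ 0
    ... | yes ∣T∣≡0 = ℤ.∣i∣≡0⇒i≡0 ∣T∣≡0
    ... | no ∣T∣≢0 = contradiction (begin-strict
      suc m                                ≤⟨ m≤m*n (suc m) ∣ T (suc m) ∣ {{≢-nonZero ∣T∣≢0}} ⟩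
      suc m * ∣ T (suc m) ∣                ≤⟨ T-step {m} {F} (≤-trans (c≤ 0) (≤-reflexive (sym (*-identityʳ C)))) ⟩
      F + ∣ T (suc (suc m)) ∣              ≤⟨ +-monoʳ-≤ F (T≤F (suc m) (≤-trans n≤m (n≤1+n m))) ⟩
      F + F                                <⟨ n<1+n (F + F) ⟩
      n                                    ≤⟨ n≤m ⟩
      m                                    <⟨ n<1+n m ⟩
      suc m                                ∎) (<-irrefl refl)
      where open ≤-Reasoning

  last-vanishes : ∀ d (c : ℕ → ℚ) → Null (partial (suc d) c) → c (suc d) ≡ 0ℚ
  last-vanishes d c null = decidable-stable (c (suc d) ℚ.≟ 0ℚ) λ c≢0 → go c≢0 (clear (suc (suc d)) c)
    where
    go : c (suc d) ≢ 0ℚ → (∃₂ λ D (a : ℕ → ℤ) → NonZero D × (∀ i → i < suc (suc d) → ι (+ D) ℚ.* c i ≡ ι (a i))) → ⊥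
    -- For j > d the index d ∸ j is 0, so that the bound C holds for every j.
    go c≢0 (D , a , D≢0 , a-eq) = no-recurrence d C (λ j → b (d ∸ j)) (λ j → ≤total (λ k → ∣ b k ∣) (suc d) (s≤s (m∸n≤m d j))) b≢0 T T-eq T-small
      where
      open Relation (suc d) c D a D≢0 a-eq
      C : ℕ
      C = total (λ k → ∣ b k ∣) (suc d)
      b≢0 : b d ≢ 0ℤ
      b≢0 b≡0 = c≢0 (positive-multiple-zero (ι (+ D)) (c (suc d)) (ι-positive D {{D≢0}}) (trans (a-eq (suc d) ≤-refl) (cong ι b≡0)))
      T : ℕ → ℤ
      -- A default value; the recurrence starts at T 1. The shift by one and the sign turn W into a
      -- solution of n T(n) - T(n + 1) = f(p n).
      T zero = 0ℤ
      T (suc m) = ℤ.- W m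
      T-eq : ∀ n → + suc n ℤ.* T (suc n) ℤ.- T (suc (suc n)) ≡ horner (λ j → b (d ∸ j)) d (+ p (suc n))
      T-eq n = trans (alg (+ suc n) (W n) (poly b (suc d) (+ p (suc n)))) (poly-horner b d (+ p (suc n)))
        where
        alg : ∀ x w q → x ℤ.* (ℤ.- w) ℤ.- (ℤ.- (x ℤ.* w ℤ.+ q)) ≡ q
        alg = ℤSolver.solve-∀
      T-small : ∀ E .{{_ : NonZero E}} → ∃ λ M₀ → ∀ M → M₀ ≤ M → E * ∣ T (suc M) ∣ < M !
      T-small E = let M₀ , small = W-small null E in
        M₀ , λ M M₀≤M → subst (λ k → E * k < M !) (sym (ℤ.∣-i∣≡∣i∣ (W M))) (small M M₀≤M)

open RationalRelations using (extend; extend-toℕ; seq-sum; null-cong; independence)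
open LargeScale using (last-vanishes)

theorem3 : LinearlyIndependent ℝ-leftModule 1,S
theorem3 n c relation i = trans (sym (extend-toℕ c i))
  (independence last-vanishes n (extend c)
    (null-cong (λ M → trans (ℚ.+-identityʳ _) (seq-sum c 1,S M)) relation) (toℕ i) (Fin.toℕ<n i))
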